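{- As sequences indexed by $n\geq1$, $$\mathrm{orb}=r+\mathrm{orb}_1\ast\mathbf{1},\qquad 2\,\mathrm{orb}_1=\mathrm{A113788}-r\ast\mu,\qquad \mathrm{orb}_2=r\ast\mu+\mathrm{orb}_1\ast e_2.$$ That is, for every $n\geq1$: $\mathrm{orb}(n)=r(n)+\sum_{d\mid n}\mathrm{orb}_1(d)$; $2\,\mathrm{orb}_1(n)=\frac1n\sum_{d\mid n}p(d)\mu(n/d)-\sum_{d\mid n}r(d)\mu(n/d)$; and $\mathrm{orb}_2(n)=\sum_{d\mid n}r(d)\mu(n/d)+[2\mid n]\,\mathrm{orb}_1(n/2)$.
   Context: For $n\geq1$ let $V_n=\{v_0,\dots,v_{n-1}\}$, indices modulo $n$. The dihedral group $D_{2n}$ generated by $\sigma(v_i)=v_{i+1}$ and $\tau(v_i)=v_{n-i}$ acts on subsets of $V_n$ elementwise. Let $\mathbf{X}_n$ be the family of subsets $X\subseteq V_n$ such that (a) there is no $i\in\mathbb{Z}_n$ with $v_i,v_{i+1}\in X$, and (b) for every $i\in\mathbb{Z}_n$ at least one of $v_i,v_{i+1},v_{i+2}$ lies in $X$ (for $n\geq 3$: the maximal independent sets of the cycle graph $C_n$). $\mathrm{orb}(n)$ is the number of $D_{2n}$-orbits of $\mathbf{X}_n$, and for $d\mid 2n$, $\mathrm{orb}_d(n)$ is the number of these orbits of cardinality $2n/d$ (equivalently, whose elements have stabilizer of order $d$). Perrin: $p(1)=0,p(2)=2,p(3)=3$, $p(n)=p(n-2)+p(n-3)$ ($n\geq4$).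 Padovan: $q(1)=0,q(2)=1,q(3)=1$, $q(n)=q(n-2)+q(n-3)$ ($n\geq4$); $r(2k-1)=q(k)$, $r(2k)=q(k+2)$. The Dirichlet convolution is $(f\ast g)(n)=\sum_{d\mid n}f(d)g(n/d)$; $\mu$ is the Möbius function; $\mathbf{1}(n)=1$; $e_2(n)=1$ if $n=2$ and $0$ otherwise; $\mathrm{A113788}(n)=\frac1n(p\ast\mu)(n)$. -}

module Defs where

open import Data.Bool.Base using (if_then_else_)
import Data.Bool.Properties as Bool
open import Data.Fin.Base using (Fin; toℕ)
import Data.Fin.Properties as Fin
open import Data.Fin.Subset using (Subset; inside; outside; _∈_)
open import Data.Fin.Subset.Properties using (_∈?_)
open import Data.Integer.Base as ℤ using (ℤ; +_; 0ℤ; 1ℤ; -1ℤ)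
open import Data.List.Base
  using (List; []; _∷_; _++_; map; filter; foldr; length; upTo; deduplicate)
import Data.List.Properties as List
open import Data.Nat.Base
  using (ℕ; zero; suc; _+_; _*_; _∸_; _/_; ⌊_/2⌋; ⌈_/2⌉; NonZero)
open import Data.Nat.Divisibility using (_∣?_)
open import Data.Nat.DivMod using (_mod_)
open import Data.Nat.GeneralisedArithmetic using (fold)
open import Data.Nat.Primality.Factorisation using (factorise; factors)
open import Data.Nat.Properties using (_≟_)
open import Data.List.Relation.Unary.Unique.DecPropositional _≟_ using (unique?)
open import Data.Product.Base using (_×_; ∃; _,_)
open import Data.Rational.Base as ℚ using (ℚ)
open import Data.Sum.Base using (_⊎_)
import Data.Vec.Base as Vec
import Data.Vec.Properties as Vec
open import Relation.Binary.Definitions using (DecidableEquality)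
open import Relation.Binary.PropositionalEquality using (_≡_)
open import Relation.Nullary using (¬_; Dec; does)
open import Relation.Nullary.Decidable using (map′; ¬?; _×-dec_; _⊎-dec_)

-- V_n is Fin n.  The modulus is non-zero as soon as a vertex is given.

σ : ∀ {n} → Fin n → Fin n
σ {n} i = _mod_ (suc (toℕ i)) n {{Fin.nonZeroIndex i}}

τ : ∀ {n} → Fin n → Fin n
τ {n} i = _mod_ (n ∸ toℕ i) n {{Fin.nonZeroIndex i}}

-- (k , ε) stands for σᵏ τᵋ.  Since σⁿ = τ² = 1 and τσ = σ⁻¹τ, these are all the
-- elements of the group of order 2n generated by σ and τ.  For n ≤ 2 it does
-- not act faithfully on Fin n, which does not affect the orbits.

Dihedral : ℕ → Set
Dihedral n = Fin n × Fin 2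

infixr 8 _·_ _•_

_·_ : ∀ {n} → Dihedral n → Fin n → Fin n
(k , ε) · v = fold (fold v τ (toℕ ε)) σ (toℕ k)

_•_ : ∀ {n} → Dihedral n → Subset n → Subset n
g • X = Vec.tabulate λ w → does (Fin.any? λ v → (v ∈? X) ×-dec (g · v Fin.≟ w))

IsMIS : ∀ {n} → Subset n → Set
IsMIS {n} X = (∀ i → ¬ (i ∈ X × σ i ∈ X))
            × (∀ i → i ∈ X ⊎ σ i ∈ X ⊎ σ (σ i) ∈ X)

isMIS? : ∀ {n} (X : Subset n) → Dec (IsMIS X)
isMIS? X = Fin.all? (λ i → ¬? ((i ∈? X) ×-dec (σ i ∈? X)))
     ×-dec Fin.all? (λ i → (i ∈? X) ⊎-dec ((σ i ∈? X) ⊎-dec (σ (σ i) ∈? X)))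

_≟ˢ_ : ∀ {n} → DecidableEquality (Subset n)
_≟ˢ_ = Vec.≡-dec Bool._≟_

infix 4 _∼_ _∼?_

_∼_ : ∀ {n} → Subset n → Subset n → Set
_∼_ {n} X Y = ∃ λ (g : Dihedral n) → g • X ≡ Y

_∼?_ : ∀ {n} (X Y : Subset n) → Dec (X ∼ Y)
X ∼? Y = map′ (λ (k , ε , e) → (k , ε) , e) (λ ((k , ε) , e) → k , ε , e)
  (Fin.any? λ k → Fin.any? λ ε → ((k , ε) • X) ≟ˢ Y)

subsets : ∀ n → List (Subset n)
subsets zero    = Vec.[] ∷ []
subsets (suc n) = map (outside Vec.∷_) (subsets n) ++ map (inside Vec.∷_) (subsets n)

𝐗 : ∀ n → List (Subset n)
𝐗 n = filter isMIS? (subsets n)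

-- A set of subsets is represented by the list of its members in the order in
-- which `subsets` enumerates them (each exactly once), so equal sets are equal
-- lists and the cardinality is the length.

orbit : ∀ {n} → Subset n → List (Subset n)
orbit {n} X = filter (X ∼?_) (subsets n)

orbits : ∀ n → List (List (Subset n))
orbits n = deduplicate (List.≡-dec _≟ˢ_) (map orbit (𝐗 n))

-- Sequences are indexed by n ≥ 1; their value at 0 carries no meaning and is
-- never used by _∗_ at a positive argument.

Seq : Set
Seq = ℕ → ℤ

orb : Seq
orb n = + length (orbits n)

-- The number of orbits of cardinality 2n/d, for d ∣ 2n.
orb[_] : ℕ → Seq
orb[ d ] n = + length (filter (λ O → length O * d ≟ 2 * n) (orbits n))

-- Perrin
p : Seq
p 0 = 0ℤ
p 1 = 0ℤ
p 2 = + 2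
p 3 = + 3
p (suc (suc (suc n@(suc _)))) = p (suc n) ℤ.+ p n

-- Padovan
q : Seq
q 0 = 0ℤ
q 1 = 0ℤ
q 2 = 1ℤ
q 3 = 1ℤ
q (suc (suc (suc n@(suc _)))) = q (suc n) ℤ.+ q n

-- r (2k) = q (k + 2) and r (2k - 1) = q k
r : Seq
r n = if does (2 ∣? n) then q (⌊ n /2⌋ + 2) else q ⌈ n /2⌉

infixl 7 _∗_

-- Dirichlet convolution; the divisors of n are d = suc k with k < n.
_∗_ : Seq → Seq → Seq
(f ∗ g) n = foldr ℤ._+_ 0ℤ
  (map (λ k → f (suc k) ℤ.* g (n / suc k)) (filter (λ k → suc k ∣? n) (upTo n)))

-- Möbius function: (-1)ᵏ on products of k distinct primes, 0 on non-squarefree n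
μ : Seq
μ zero      = 0ℤ
μ n@(suc _) = if does (unique? ps) then -1ℤ ℤ.^ length ps else 0ℤ
  where ps = factors (factorise n)

𝟏 : Seq
𝟏 _ = 1ℤ

e₂ : Seq
e₂ n = if does (n ≟ 2) then 1ℤ else 0ℤ

A113788 : (n : ℕ) .{{_ : NonZero n}} → ℚ
A113788 n = (p ∗ μ) n ℚ./ n

{-# OPTIONS --safe #-}

-- A vertex set X ⊆ V_n is read as the n-periodic sequence x : ℤ → Bool, so that being
-- a maximal independent set, having period d and having a mirror i ↦ s - i no longer
-- mention n.  If d is the least period of X, its orbit has d elements when x has a
-- mirror and 2d otherwise, and the sets of least period d in V_n are the lifts of those
-- in V_d.  With s(d) and a(d) the numbers of sets in V_d of least period d with and
-- without a mirror, and S(d) = s(d) / d, it follows that a(n) = 2n orb₁(n) and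
-- n orb₂(n) = s(n) + [2 ∣ n] a(n/2), while orb(n) = Σ_{d ∣ n} (orb₁(d) + S(d)).
-- Counting all sets by transfer matrices gives p(n) = Σ_{d ∣ n} (a(d) + s(d)), and
-- counting the pairs (mirror, set fixed by it) in two ways gives r(n) = Σ_{d ∣ n} S(d);
-- Möbius inversion does the rest.

module Submission where

open import Defs

open import Data.Bool.Base using (Bool; true; false; if_then_else_; not; _∧_; _∨_)
import Data.Bool.Properties as Bool
open import Data.Fin.Base using (Fin; zero; suc; toℕ; fromℕ<)
import Data.Fin.Properties as Fin
open import Data.Fin.Subset as Subset using (Subset; inside; outside)
open import Data.Fin.Subset.Properties using (_∈?_)
open import Data.Integer.Base as ℤ using (ℤ; +_; -[1+_]; 0ℤ; 1ℤ; -1ℤ; -_; _+_; _*_; _-_)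
open import Data.Integer.DivMod using (_/ℕ_; n%ℕd<d; a≡a%ℕn+[a/ℕn]*n)
import Data.Integer.Properties as ℤ
open import Data.Integer.Tactic.RingSolver using (solve-∀)
open import Data.List.Base using (List; []; _∷_; _++_; map; filter; foldr; length; upTo)
open import Data.List.Membership.Propositional using (_∈_)
open import Data.List.Membership.Propositional.Properties
  using (∈-map⁺; ∈-map⁻; ∈-filter⁺; ∈-filter⁻; ∈-upTo⁺; ∈-upTo⁻; ∈-++⁺ˡ; ∈-++⁺ʳ; ∈-++⁻; ∈-deduplicate⁺; ∈-deduplicate⁻)
open import Data.List.Membership.Propositional.Properties.WithK using (unique∧set⇒bag)
import Data.List.Properties as List
open import Data.List.Relation.Binary.BagAndSetEquality using (∼bag⇒↭)
open import Data.List.Relation.Binary.Permutation.Propositional as ↭ using (_↭_; ↭⇒↭ₛ)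
open import Data.List.Relation.Binary.Permutation.Propositional.Properties using (↭-length)
import Data.List.Relation.Binary.Permutation.Setoid.Properties as Permutation
open import Data.List.Relation.Unary.All as All using ([]; _∷_)
open import Data.List.Relation.Unary.AllPairs using ([]; _∷_)
open import Data.List.Relation.Unary.Any using (here; there)
open import Data.List.Relation.Unary.Unique.Propositional using (Unique)
import Data.List.Relation.Unary.Unique.Propositional.Properties as Unique
open import Data.List.Relation.Unary.Unique.DecPropositional.Properties using (deduplicate-!)
open import Data.Nat.Base as ℕ using (ℕ; zero; suc; NonZero)
open import Data.Nat.Coprimality using (coprime-divisor)
open import Data.Nat.Divisibility as ℕ using (_∣_; _∣?_; divides; divides-refl)
import Data.Nat.DivMod as ℕ
open import Data.Nat.GeneralisedArithmetic using (fold)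
open import Data.Nat.Induction using (<-rec)
open import Data.Nat.ListAction using (product)
open import Data.Nat.ListAction.Properties using (∈⇒∣product)
open import Data.Nat.Primality using (Prime; prime⇒irreducible; prime⇒nonZero; ¬prime[1])
open import Data.Nat.Primality.Factorisation
  using (PrimeFactorisation; factorise; factorisationUnique; factorisationHasAllPrimeFactors)
import Data.Nat.Properties as ℕ
open import Data.List.Relation.Unary.Unique.DecPropositional ℕ._≟_ using (unique?)
open import Data.Product.Base using (_×_; ∃; _,_; proj₁; proj₂)
import Data.Rational.Base as ℚ
import Data.Rational.Properties as ℚ
open import Data.Rational.Unnormalised.Base as ℚᵘ using (mkℚᵘ)
import Data.Rational.Unnormalised.Properties as ℚᵘ
open import Data.Sum.Base as Sum using (_⊎_; inj₁; inj₂; [_,_]′)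
open import Data.Vec.Base using (Vec; []; _∷_; lookup; tabulate)
import Data.Vec.Properties as Vec
open import Function.Base using (_∘_; id)
open import Function.Bundles using (mk⇔)
open import Relation.Binary.PropositionalEquality
  using (_≡_; _≢_; refl; sym; trans; cong; cong₂; subst; setoid; module ≡-Reasoning)
open import Relation.Nullary using (¬_; Dec; does; yes; no; contradiction)
open import Relation.Nullary.Decidable using (map′; ¬?; _×-dec_; dec-true; dec-false; does-⇔)
open import Relation.Unary using (Decidable)

open PrimeFactorisation

-- The two interleaved Padovan sequences in `r` come from the axes. A rotation by one step moves the
-- mirror i ↦ k - i to k + 2, so the number of sets with mirror k depends only on the parity of k,
-- and k = n, n - 1 represent all mirrors. For odd n each of these two has one axis through a vertex
-- and one between vertices; for even n, mirror n has both axes through vertices and mirror n - 1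
-- has both between. A set with a given mirror is a word running from one axis to the other, and
-- such words are governed by the same transfer matrix as the cyclic ones. Its characteristic
-- polynomial is x³ - x - 1, so all counts obey the recursion shared by `p` and `q`, and only three
-- initial values have to be compared. S is therefore defined from `orb[ 2 ]` and `orb[ 1 ]`, and
-- integer identities are proved after multiplication by n or 2n and then cancelled. Stabilizers
-- never occur, only orbit lengths, so the unfaithful action for n ≤ 2 needs no special treatment;
-- small n appear separately only because the words have at least two letters.

private variable
  A B : Set
  P : A → Set
  xs ys : List A

-- Finite sums over lists

∑ : List A → (A → ℤ) → ℤ
∑ xs f = foldr _+_ 0ℤ (map f xs)

𝟙 : {P : Set} → Dec P → ℤ
𝟙 P? = if does P? then 1ℤ else 0ℤ

𝟙-yes : {P : Set} (P? : Dec P) → P → 𝟙 P? ≡ 1ℤ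
𝟙-yes (yes _) _ = refl
𝟙-yes (no ¬p) p = contradiction p ¬p

𝟙-no : {P : Set} (P? : Dec P) → ¬ P → 𝟙 P? ≡ 0ℤ
𝟙-no (yes p) ¬p = contradiction p ¬p
𝟙-no (no _)  _  = refl

𝟙-cong : {P Q : Set} (P? : Dec P) (Q? : Dec Q) → (P → Q) → (Q → P) → 𝟙 P? ≡ 𝟙 Q?
𝟙-cong P? (yes q) _ g = 𝟙-yes P? (g q)
𝟙-cong P? (no ¬q) f _ = 𝟙-no P? (¬q ∘ f)

does-true : {P : Set} (P? : Dec P) → does P? ≡ true → P
does-true (yes p) _ = p

does-false : {P : Set} (P? : Dec P) → does P? ≡ false → ¬ P
does-false (no ¬p) _ = ¬p

∑-cong : ∀ (xs : List A) {f g} → (∀ {x} → x ∈ xs → f x ≡ g x) → ∑ xs f ≡ ∑ xs g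
∑-cong []       _ = refl
∑-cong (x ∷ xs) e = cong₂ _+_ (e (here refl)) (∑-cong xs (e ∘ there))

∑-+ : ∀ (xs : List A) f g → ∑ xs (λ x → f x + g x) ≡ ∑ xs f + ∑ xs g
∑-+ []       f g = refl
∑-+ (x ∷ xs) f g = trans (cong (_+_ (f x + g x)) (∑-+ xs f g)) (lemma (f x) (g x) (∑ xs f) (∑ xs g))
  where
  lemma : ∀ a b c d → a + b + (c + d) ≡ a + c + (b + d)
  lemma = solve-∀

∑-*ˡ : ∀ (xs : List A) c f → ∑ xs (λ x → c * f x) ≡ c * ∑ xs f
∑-*ˡ []       c f = sym (ℤ.*-zeroʳ c)
∑-*ˡ (x ∷ xs) c f = trans (cong (_+_ (c * f x)) (∑-*ˡ xs c f)) (sym (ℤ.*-distribˡ-+ c (f x) (∑ xs f)))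

∑-const : ∀ (xs : List A) c → ∑ xs (λ _ → c) ≡ + length xs * c
∑-const []       c = sym (ℤ.*-zeroˡ c)
∑-const (x ∷ xs) c = trans (cong (_+_ c) (∑-const xs c)) (sym (ℤ.suc-* (+ length xs) c))

∑-1 : ∀ (xs : List A) → ∑ xs (λ _ → 1ℤ) ≡ + length xs
∑-1 xs = trans (∑-const xs 1ℤ) (ℤ.*-identityʳ _)

∑-0 : ∀ (xs : List A) {f} → (∀ {x} → x ∈ xs → f x ≡ 0ℤ) → ∑ xs f ≡ 0ℤ
∑-0 xs e = trans (∑-cong xs e) (trans (∑-const xs 0ℤ) (ℤ.*-zeroʳ (+ length xs)))

∑-++ : ∀ (xs ys : List A) f → ∑ (xs ++ ys) f ≡ ∑ xs f + ∑ ys f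
∑-++ []       ys f = sym (ℤ.+-identityˡ _)
∑-++ (x ∷ xs) ys f = trans (cong (_+_ (f x)) (∑-++ xs ys f)) (sym (ℤ.+-assoc (f x) (∑ xs f) (∑ ys f)))

∑-map : ∀ (g : A → B) xs f → ∑ (map g xs) f ≡ ∑ xs (f ∘ g)
∑-map g []       f = refl
∑-map g (x ∷ xs) f = cong (_+_ (f (g x))) (∑-map g xs f)

∑-swap : ∀ (xs : List A) (ys : List B) (F : A → B → ℤ) →
         ∑ xs (λ x → ∑ ys (F x)) ≡ ∑ ys (λ y → ∑ xs (λ x → F x y))
∑-swap []       ys F = sym (∑-0 ys (λ _ → refl))
∑-swap (x ∷ xs) ys F = trans (cong (_+_ (∑ ys (F x))) (∑-swap xs ys F)) (sym (∑-+ ys (F x) (λ y → ∑ xs (λ x → F x y))))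

∑-filter : ∀ (P? : Decidable P) (xs : List A) f →
           ∑ (filter P? xs) f ≡ ∑ xs (λ x → 𝟙 (P? x) * f x)
∑-filter P? []       f = refl
∑-filter P? (x ∷ xs) f with P? x
... | yes _ = cong₂ _+_ (sym (ℤ.*-identityˡ (f x))) (∑-filter P? xs f)
... | no  _ = trans (∑-filter P? xs f) (sym (trans (cong (λ z → z + ∑ xs (λ x → 𝟙 (P? x) * f x)) (ℤ.*-zeroˡ (f x))) (ℤ.+-identityˡ _)))

∑-↭ : ∀ {xs ys : List A} f → xs ↭ ys → ∑ xs f ≡ ∑ ys f
∑-↭ f ↭.refl         = refl
∑-↭ f (↭.prep x p)   = cong (_+_ (f x)) (∑-↭ f p)
∑-↭ f (↭.swap {xs} {ys} x y p) = trans (cong (λ s → f x + (f y + s)) (∑-↭ f p)) (lemma (f x) (f y) (∑ ys f))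
  where
  lemma : ∀ a b c → a + (b + c) ≡ b + (a + c)
  lemma = solve-∀
∑-↭ f (↭.trans p q)  = trans (∑-↭ f p) (∑-↭ f q)

Unique-↭ : Unique xs → Unique ys → (∀ {x} → x ∈ xs → x ∈ ys) → (∀ {x} → x ∈ ys → x ∈ xs) → xs ↭ ys
Unique-↭ u v f g = ∼bag⇒↭ (unique∧set⇒bag u v (mk⇔ f g))

∑-reindex : ∀ {xs ys : List A} f → Unique xs → Unique ys →
            (∀ {x} → x ∈ xs → x ∈ ys) → (∀ {x} → x ∈ ys → x ∈ xs) → ∑ xs f ≡ ∑ ys f
∑-reindex f u v i j = ∑-↭ f (Unique-↭ u v i j)

Unique-map : ∀ (g : A → B) {xs} → (∀ {x y} → x ∈ xs → y ∈ xs → g x ≡ g y → x ≡ y) →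
             Unique xs → Unique (map g xs)
Unique-map g inj []       = []
Unique-map g {x ∷ xs} inj (x∉ ∷ u) =
  All.tabulate (λ {z} z∈ gx≡z → let y , y∈ , z≡gy = ∈-map⁻ g z∈ in
                 All.lookup x∉ y∈ (inj (here refl) (there y∈) (trans gx≡z z≡gy)))
  ∷ Unique-map g (λ a b → inj (there a) (there b)) u

-- The inverse `h` is asked for only on members of the lists; it yields injectivity of `g` on `xs`
-- and surjectivity onto `ys` together.
∑-bij : ∀ {xs : List A} {ys : List B} (g : A → B) (h : B → A) f → Unique xs → Unique ys →
        (∀ {x} → x ∈ xs → g x ∈ ys × h (g x) ≡ x) → (∀ {y} → y ∈ ys → h y ∈ xs × g (h y) ≡ y) →
        ∑ xs (f ∘ g) ≡ ∑ ys f
∑-bij {xs = xs} g h f u v i j = trans (sym (∑-map g xs f)) (∑-reindex f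
  (Unique-map g (λ a b e → trans (sym (proj₂ (i a))) (trans (cong h e) (proj₂ (i b)))) u) v
  (λ z∈ → let x , x∈ , z≡gx = ∈-map⁻ g z∈ in subst (_∈ _) (sym z≡gx) (proj₁ (i x∈)))
  (λ y∈ → subst (_∈ map g xs) (proj₂ (j y∈)) (∈-map⁺ g (proj₁ (j y∈)))))

∑-single : ∀ {xs : List A} (P? : Decidable P) f {x} → Unique xs → x ∈ xs → P x →
           (∀ {y} → y ∈ xs → P y → y ≡ x) → ∑ xs (λ y → 𝟙 (P? y) * f y) ≡ f x
∑-single {xs = xs} P? f {x} u x∈ px only = begin
  ∑ xs (λ y → 𝟙 (P? y) * f y) ≡⟨ ∑-filter P? xs f ⟨
  ∑ (filter P? xs) f          ≡⟨ ∑-reindex f (Unique.filter⁺ P? u) ([] ∷ [])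
                                   (λ y∈ → let y∈xs , py = ∈-filter⁻ P? y∈ in here (only y∈xs py))
                                   (λ { (here refl) → ∈-filter⁺ P? x∈ px }) ⟩
  f x + 0ℤ                    ≡⟨ ℤ.+-identityʳ (f x) ⟩
  f x                         ∎
  where open ≡-Reasoning

∑-swap-filter : ∀ {R : A → B → Set} (R? : ∀ x y → Dec (R x y)) xs ys (F : A → B → ℤ) →
                ∑ xs (λ x → ∑ (filter (R? x) ys) (F x)) ≡
                ∑ ys (λ y → ∑ (filter (λ x → R? x y) xs) (λ x → F x y))
∑-swap-filter R? xs ys F = begin
  ∑ xs (λ x → ∑ (filter (R? x) ys) (F x))                ≡⟨ ∑-cong xs {f = λ x → ∑ (filter (R? x) ys) (F x)} (λ {x} _ → ∑-filter (R? x) ys (F x)) ⟩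
  ∑ xs (λ x → ∑ ys (λ y → 𝟙 (R? x y) * F x y))           ≡⟨ ∑-swap xs ys (λ x y → 𝟙 (R? x y) * F x y) ⟩
  ∑ ys (λ y → ∑ xs (λ x → 𝟙 (R? x y) * F x y))           ≡⟨ ∑-cong ys {g = λ y → ∑ (filter (λ x → R? x y) xs) (λ x → F x y)} (λ {y} _ → sym (∑-filter (λ x → R? x y) xs (λ x → F x y))) ⟩
  ∑ ys (λ y → ∑ (filter (λ x → R? x y) xs) (λ x → F x y)) ∎
  where open ≡-Reasoning

∑-split : ∀ {P : A → Set} (P? : Decidable P) xs f →
          ∑ xs f ≡ ∑ (filter P? xs) f + ∑ (filter (¬? ∘ P?) xs) f
∑-split P? []       f = refl
∑-split P? (x ∷ xs) f with P? x
... | yes _ = trans (cong (_+_ (f x)) (∑-split P? xs f)) (sym (ℤ.+-assoc (f x) _ _))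
... | no  _ = trans (cong (_+_ (f x)) (∑-split P? xs f)) (lemma (f x) (∑ (filter P? xs) f) _)
  where
  lemma : ∀ a b c → a + (b + c) ≡ b + (a + c)
  lemma = solve-∀

-- Divisors and Möbius inversion

infixl 7 _÷_

-- A total quotient, so that summands over divisors need no `NonZero` instance; on successors it
-- computes to the `_/_` occurring in `_∗_`.
_÷_ : ℕ → ℕ → ℕ
n ÷ zero  = 0
n ÷ suc d = n ℕ./ suc d

m*n÷n≡m : ∀ m n .{{_ : NonZero n}} → (m ℕ.* n) ÷ n ≡ m
m*n÷n≡m m (suc n) = ℕ.m*n/n≡m m (suc n)

∣-nonZero : ∀ {d n} .{{_ : NonZero n}} → d ∣ n → NonZero d
∣-nonZero {zero}  {suc n} 0∣n = contradiction (ℕ.0∣⇒≡0 0∣n) λ ()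
∣-nonZero {suc d} _ = _

n÷d*d≡n : ∀ {d n} .{{_ : NonZero n}} → d ∣ n → n ÷ d ℕ.* d ≡ n
n÷d*d≡n {d} d∣n@(divides-refl c) = cong (ℕ._* d) (m*n÷n≡m c d {{∣-nonZero d∣n}})

n÷d∣n : ∀ {d n} .{{_ : NonZero n}} → d ∣ n → n ÷ d ∣ n
n÷d∣n {d} d∣n = divides d (sym (trans (ℕ.*-comm d _) (n÷d*d≡n d∣n)))

n÷[n÷d]≡d : ∀ {d n} .{{_ : NonZero n}} → d ∣ n → n ÷ (n ÷ d) ≡ d
n÷[n÷d]≡d {d} {n} d∣n = trans
  (cong (_÷ (n ÷ d)) (sym (trans (ℕ.*-comm d _) (n÷d*d≡n d∣n))))
  (m*n÷n≡m d (n ÷ d) {{∣-nonZero (n÷d∣n d∣n)}})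

-- Built like the index list inside `_∗_`, which makes `∗≡∑` a single use of `∑-map`.
divisors : ℕ → List ℕ
divisors n = map suc (filter (λ k → suc k ∣? n) (upTo n))

∈-divisors⁺ : ∀ {d n} .{{_ : NonZero n}} → d ∣ n → d ∈ divisors n
∈-divisors⁺ {zero}  {suc n} 0∣n = contradiction (ℕ.0∣⇒≡0 0∣n) λ ()
∈-divisors⁺ {suc k} {n}     d∣n = ∈-map⁺ suc (∈-filter⁺ (λ k → suc k ∣? n) (∈-upTo⁺ (ℕ.∣⇒≤ d∣n)) d∣n)

∈-divisors⁻ : ∀ {d n} → d ∈ divisors n → d ∣ n
∈-divisors⁻ {d} {n} d∈ with ∈-map⁻ suc d∈
... | k , k∈ , refl = proj₂ (∈-filter⁻ (λ k → suc k ∣? n) {xs = upTo n} k∈)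

divisors-unique : ∀ n → Unique (divisors n)
divisors-unique n = Unique.map⁺ ℕ.suc-injective (Unique.filter⁺ (λ k → suc k ∣? n) (Unique.upTo⁺ n))

∗≡∑ : ∀ f g n → (f ∗ g) n ≡ ∑ (divisors n) (λ d → f d * g (n ÷ d))
∗≡∑ f g n = sym (∑-map suc (filter (λ k → suc k ∣? n) (upTo n)) (λ d → f d * g (n ÷ d)))

-- The Möbius function and its divisor sums

Unique-resp-↭ : ∀ {ps qs : List ℕ} → ps ↭ qs → Unique ps → Unique qs
Unique-resp-↭ ps↭qs = Permutation.Unique-resp-↭ (setoid ℕ) (↭⇒↭ₛ ps↭qs)

if-yes : ∀ {P : Set} (P? : Dec P) {x y : A} → P → (if does P? then x else y) ≡ x
if-yes (yes _) _ = refl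
if-yes (no ¬p) p = contradiction p ¬p

if-no : ∀ {P : Set} (P? : Dec P) {x y : A} → ¬ P → (if does P? then x else y) ≡ y
if-no (yes p) ¬p = contradiction p ¬p
if-no (no _)  _  = refl

-- `μ` inspects the factorisation chosen by `factorise`. Uniqueness up to permutation lets any other
-- one replace it, in particular the one that `cons` obtains by putting a prime in front.
μ-squarefree : ∀ n .{{_ : NonZero n}} (F : PrimeFactorisation n) →
               Unique (factors F) → μ n ≡ -1ℤ ℤ.^ length (factors F)
μ-squarefree (suc n) F u = trans
  (if-yes (unique? (factors F₀)) (Unique-resp-↭ (factorisationUnique F F₀) u))
  (cong (-1ℤ ℤ.^_) (↭-length (factorisationUnique F₀ F)))
  where F₀ = factorise (suc n)

μ-¬squarefree : ∀ n .{{_ : NonZero n}} (F : PrimeFactorisation n) → ¬ Unique (factors F) → μ n ≡ 0ℤ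
μ-¬squarefree (suc n) F ¬u =
  if-no (unique? (factors F₀)) (¬u ∘ Unique-resp-↭ (factorisationUnique F₀ F))
  where F₀ = factorise (suc n)

module _ {p} (p-prime : Prime p) where

  cons : ∀ {n} → PrimeFactorisation n → PrimeFactorisation (p ℕ.* n)
  cons F = record
    { factors = p ∷ factors F
    ; isFactorisation = cong (p ℕ.*_) (isFactorisation F)
    ; factorsPrime = p-prime ∷ factorsPrime F }

  private
    p*n≢0 : ∀ n .{{_ : NonZero n}} → NonZero (p ℕ.* n)
    p*n≢0 n = ℕ.m*n≢0 p n {{prime⇒nonZero p-prime}}

  μ-prime-∣ : ∀ n .{{_ : NonZero n}} → p ∣ n → μ (p ℕ.* n) ≡ 0ℤ
  μ-prime-∣ n p∣n = μ-¬squarefree (p ℕ.* n) {{p*n≢0 n}} (cons F)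
    λ { (p∉ ∷ _) → All.lookup p∉ (factorisationHasAllPrimeFactors p-prime
          (subst (p ∣_) (isFactorisation F) p∣n) (factorsPrime F)) refl }
    where F = factorise n

  μ-prime-∤ : ∀ n .{{_ : NonZero n}} → ¬ p ∣ n → μ (p ℕ.* n) ≡ - μ n
  μ-prime-∤ n p∤n with unique? (factors (factorise n))
  ... | no ¬u = trans
    (μ-¬squarefree (p ℕ.* n) {{p*n≢0 n}} (cons (factorise n)) λ { (_ ∷ u) → ¬u u })
    (cong -_ (sym (μ-¬squarefree n (factorise n) ¬u)))
  ... | yes u = trans
    (μ-squarefree (p ℕ.* n) {{p*n≢0 n}} (cons (factorise n)) (All.tabulate p∉ ∷ u))
    (trans (ℤ.-1*i≡-i _) (cong -_ (sym (μ-squarefree n (factorise n) u))))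
    where
    p∉ : ∀ {q} → q ∈ factors (factorise n) → p ≢ q
    p∉ q∈ refl = p∤n (subst (p ∣_) (sym (isFactorisation (factorise n))) (∈⇒∣product q∈))

  -- The divisors of pn prime to p are the divisors of n prime to p. The other divisors are pd with
  -- d ∣ n, where `μ` is -μ(d) if p does not divide d and 0 if it does. The two parts cancel.
  ∑μ-prime-multiple : ∀ n .{{_ : NonZero n}} → ∑ (divisors (p ℕ.* n)) μ ≡ 0ℤ
  ∑μ-prime-multiple n = begin
    ∑ (divisors (p ℕ.* n)) μ
      ≡⟨ ∑-split (p ∣?_) (divisors (p ℕ.* n)) μ ⟩
    ∑ (filter (p ∣?_) (divisors (p ℕ.* n))) μ + ∑ (filter (¬? ∘ (p ∣?_)) (divisors (p ℕ.* n))) μ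
      ≡⟨ cong₂ _+_ multiples nonmultiples ⟩
    - ∑ coprimes μ + ∑ coprimes μ
      ≡⟨ ℤ.+-inverseˡ (∑ coprimes μ) ⟩
    0ℤ ∎
    where
    open ≡-Reasoning
    instance
      _ = prime⇒nonZero p-prime
      _ = p*n≢0 n
    coprimes = filter (¬? ∘ (p ∣?_)) (divisors n)

    nonmultiples : ∑ (filter (¬? ∘ (p ∣?_)) (divisors (p ℕ.* n))) μ ≡ ∑ coprimes μ
    nonmultiples = ∑-reindex μ
      (Unique.filter⁺ _ (divisors-unique (p ℕ.* n))) (Unique.filter⁺ _ (divisors-unique n))
      (λ {d} d∈ → let d∈′ , p∤d = ∈-filter⁻ (¬? ∘ (p ∣?_)) {xs = divisors (p ℕ.* n)} d∈ in
        ∈-filter⁺ (¬? ∘ (p ∣?_)) (∈-divisors⁺ (coprime-divisor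
          (λ { (c∣d , c∣p) → [ id , (λ { refl → contradiction c∣d p∤d }) ]′ (prime⇒irreducible p-prime c∣p) })
          (∈-divisors⁻ d∈′))) p∤d)
      (λ {d} d∈ → let d∈′ , p∤d = ∈-filter⁻ (¬? ∘ (p ∣?_)) {xs = divisors n} d∈ in
        ∈-filter⁺ (¬? ∘ (p ∣?_)) (∈-divisors⁺ (ℕ.∣n⇒∣m*n p (∈-divisors⁻ d∈′))) p∤d)

    μ-p* : ∀ {d} → d ∈ divisors n → μ (p ℕ.* d) ≡ -1ℤ * (𝟙 (¬? (p ∣? d)) * μ d)
    μ-p* {d} d∈ with p ∣? d
    ... | yes p∣d = trans (μ-prime-∣ d {{∣-nonZero (∈-divisors⁻ d∈)}} p∣d) (cong (-1ℤ *_) (sym (ℤ.*-zeroˡ (μ d))))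
    ... | no  p∤d = trans (μ-prime-∤ d {{∣-nonZero (∈-divisors⁻ d∈)}} p∤d)
                     (trans (sym (ℤ.-1*i≡-i (μ d))) (cong (-1ℤ *_) (sym (ℤ.*-identityˡ (μ d)))))

    multiples : ∑ (filter (p ∣?_) (divisors (p ℕ.* n))) μ ≡ - ∑ coprimes μ
    multiples = begin
      ∑ (filter (p ∣?_) (divisors (p ℕ.* n))) μ
        ≡⟨ ∑-bij (p ℕ.*_) (_÷ p) μ (divisors-unique n) (Unique.filter⁺ _ (divisors-unique (p ℕ.* n)))
             (λ {d} d∈ → ∈-filter⁺ (p ∣?_) (∈-divisors⁺ (ℕ.*-monoʳ-∣ p (∈-divisors⁻ d∈))) (ℕ.m∣m*n d) ,
                          trans (cong (_÷ p) (ℕ.*-comm p d)) (m*n÷n≡m d p))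
             (λ {d} d∈ → let d∈′ , p∣d = ∈-filter⁻ (p ∣?_) {xs = divisors (p ℕ.* n)} d∈
                             instance _ = ∣-nonZero (∈-divisors⁻ {n = p ℕ.* n} d∈′)
                             p*d÷p≡d = trans (ℕ.*-comm p (d ÷ p)) (n÷d*d≡n p∣d) in
               ∈-divisors⁺ (ℕ.*-cancelˡ-∣ p (subst (_∣ p ℕ.* n) (sym p*d÷p≡d) (∈-divisors⁻ d∈′))) , p*d÷p≡d) ⟨
      ∑ (divisors n) (λ d → μ (p ℕ.* d))
        ≡⟨ ∑-cong (divisors n) μ-p* ⟩
      ∑ (divisors n) (λ d → -1ℤ * (𝟙 (¬? (p ∣? d)) * μ d))
        ≡⟨ ∑-*ˡ (divisors n) -1ℤ (λ d → 𝟙 (¬? (p ∣? d)) * μ d) ⟩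
      -1ℤ * ∑ (divisors n) (λ d → 𝟙 (¬? (p ∣? d)) * μ d)
        ≡⟨ cong (-1ℤ *_) (∑-filter (¬? ∘ (p ∣?_)) (divisors n) μ) ⟨
      -1ℤ * ∑ coprimes μ
        ≡⟨ ℤ.-1*i≡-i _ ⟩
      - ∑ coprimes μ ∎

-- Only the head of the factorisation matters: without one n is 1, otherwise n is a multiple of a
-- prime.
∑μ : ∀ n .{{_ : NonZero n}} → ∑ (divisors n) μ ≡ 𝟙 (n ℕ.≟ 1)
∑μ n = go n (factorise n)
  where
  go : ∀ n .{{_ : NonZero n}} → PrimeFactorisation n → ∑ (divisors n) μ ≡ 𝟙 (n ℕ.≟ 1)
  go n record { factors = [] ; isFactorisation = refl } = refl
  go n record { factors = p ∷ ps ; isFactorisation = refl ; factorsPrime = p-prime ∷ _ } =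
    trans (∑μ-prime-multiple p-prime (product ps) {{ℕ.m*n≢0⇒n≢0 p}})
      (sym (𝟙-no (n ℕ.≟ 1) λ n≡1 → ¬prime[1] (subst Prime (ℕ.m*n≡1⇒m≡1 p _ n≡1) p-prime)))

-- After expanding f(d) and exchanging the sums, the coefficient of h(e) is the sum of μ over the
-- divisors of n/e, which vanishes unless e = n.
möbius-inversion : ∀ {f h : Seq} → (∀ n .{{_ : NonZero n}} → f n ≡ ∑ (divisors n) h) →
                   ∀ n .{{_ : NonZero n}} → (f ∗ μ) n ≡ h n
möbius-inversion {f} {h} f≡∑h n = begin
  (f ∗ μ) n
    ≡⟨ ∗≡∑ f μ n ⟩
  ∑ (divisors n) (λ d → f d * μ (n ÷ d))
    ≡⟨ ∑-cong (divisors n) expand ⟩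
  ∑ (divisors n) (λ d → ∑ (filter (_∣? d) (divisors n)) (λ e → μ (n ÷ d) * h e))
    ≡⟨ ∑-swap-filter (λ d e → e ∣? d) (divisors n) (divisors n) (λ d e → μ (n ÷ d) * h e) ⟩
  ∑ (divisors n) (λ e → ∑ (filter (e ∣?_) (divisors n)) (λ d → μ (n ÷ d) * h e))
    ≡⟨ ∑-cong (divisors n) collapse ⟩
  ∑ (divisors n) (λ e → 𝟙 (e ℕ.≟ n) * h e)
    ≡⟨ ∑-single (ℕ._≟ n) h (divisors-unique n) (∈-divisors⁺ ℕ.∣-refl) refl (λ _ → id) ⟩
  h n ∎
  where
  open ≡-Reasoning
  expand : ∀ {d} → d ∈ divisors n →
           f d * μ (n ÷ d) ≡ ∑ (filter (_∣? d) (divisors n)) (λ e → μ (n ÷ d) * h e)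
  expand {d} d∈ = begin
    f d * μ (n ÷ d)            ≡⟨ ℤ.*-comm (f d) _ ⟩
    μ (n ÷ d) * f d            ≡⟨ cong (μ (n ÷ d) *_) (f≡∑h d) ⟩
    μ (n ÷ d) * ∑ (divisors d) h ≡⟨ ∑-*ˡ (divisors d) (μ (n ÷ d)) h ⟨
    ∑ (divisors d) (λ e → μ (n ÷ d) * h e)
      ≡⟨ ∑-reindex (λ e → μ (n ÷ d) * h e) (divisors-unique d) (Unique.filter⁺ _ (divisors-unique n))
           (λ e∈ → ∈-filter⁺ (_∣? d) (∈-divisors⁺ (ℕ.∣-trans (∈-divisors⁻ e∈) (∈-divisors⁻ d∈))) (∈-divisors⁻ e∈))
           (λ e∈ → ∈-divisors⁺ (proj₂ (∈-filter⁻ (_∣? d) {xs = divisors n} e∈))) ⟩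
    ∑ (filter (_∣? d) (divisors n)) (λ e → μ (n ÷ d) * h e) ∎
    where instance _ = ∣-nonZero (∈-divisors⁻ d∈)

  collapse : ∀ {e} → e ∈ divisors n →
             ∑ (filter (e ∣?_) (divisors n)) (λ d → μ (n ÷ d) * h e) ≡ 𝟙 (e ℕ.≟ n) * h e
  collapse {e} e∈ = begin
    ∑ (filter (e ∣?_) (divisors n)) (λ d → μ (n ÷ d) * h e)
      ≡⟨ ∑-cong (filter (e ∣?_) (divisors n)) (λ {d} _ → ℤ.*-comm (μ (n ÷ d)) (h e)) ⟩
    ∑ (filter (e ∣?_) (divisors n)) (λ d → h e * μ (n ÷ d))
      ≡⟨ ∑-*ˡ (filter (e ∣?_) (divisors n)) (h e) (λ d → μ (n ÷ d)) ⟩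
    h e * ∑ (filter (e ∣?_) (divisors n)) (λ d → μ (n ÷ d))
      -- The involution d ↦ n/d carries the multiples of e among the divisors of n onto the divisors
      -- of n/e.
      ≡⟨ cong (h e *_) (∑-bij (n ÷_) (n ÷_) μ (Unique.filter⁺ _ (divisors-unique n)) (divisors-unique (n ÷ e))
           (λ {d} d∈ → let d∈′ , e∣d = ∈-filter⁻ (e ∣?_) {xs = divisors n} d∈ ; d∣n = ∈-divisors⁻ d∈′ in
             ∈-divisors⁺ (÷-antitone e∣d d∣n) , n÷[n÷d]≡d d∣n)
           (λ {c} c∈ → let c∣n = ℕ.∣-trans (∈-divisors⁻ c∈) (n÷d∣n e∣n) in
             ∈-filter⁺ (e ∣?_) (∈-divisors⁺ (n÷d∣n c∣n))
               (subst (_∣ n ÷ c) (n÷[n÷d]≡d e∣n) (÷-antitone (∈-divisors⁻ c∈) (n÷d∣n e∣n))) ,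
             n÷[n÷d]≡d c∣n)) ⟩
    h e * ∑ (divisors (n ÷ e)) μ
      ≡⟨ cong (h e *_) (∑μ (n ÷ e)) ⟩
    h e * 𝟙 (n ÷ e ℕ.≟ 1)
      ≡⟨ ℤ.*-comm (h e) _ ⟩
    𝟙 (n ÷ e ℕ.≟ 1) * h e
      ≡⟨ cong (_* h e) (𝟙-cong (n ÷ e ℕ.≟ 1) (e ℕ.≟ n)
           (λ n÷e≡1 → trans (sym (ℕ.*-identityˡ e)) (trans (cong (ℕ._* e) (sym n÷e≡1)) (n÷d*d≡n e∣n)))
           (λ { refl → trans (cong (_÷ e) (sym (ℕ.*-identityˡ e))) (m*n÷n≡m 1 e) })) ⟩
    𝟙 (e ℕ.≟ n) * h e ∎
    where
    e∣n = ∈-divisors⁻ e∈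
    instance
      _ = ∣-nonZero e∣n
      _ = ∣-nonZero (n÷d∣n e∣n)
    ÷-antitone : ∀ {a b} → a ∣ b → b ∣ n → n ÷ b ∣ n ÷ a
    ÷-antitone {a} {b} a∣b b∣n = ℕ.*-cancelʳ-∣ a (subst (n ÷ b ℕ.* a ∣_)
      (trans (n÷d*d≡n b∣n) (sym (n÷d*d≡n (ℕ.∣-trans a∣b b∣n)))) (ℕ.*-monoʳ-∣ (n ÷ b) a∣b))
      where instance _ = ∣-nonZero (ℕ.∣-trans a∣b b∣n)

-- Subsets of V_n as periodic sequences

Periodic : ℕ → (ℤ → Bool) → Set
Periodic d x = ∀ i → x (i + + d) ≡ x i

-- The reflection has its axis at s/2; recording s keeps the parameter an integer when the axis
-- passes between two vertices.
Mirror : ℤ → (ℤ → Bool) → Set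
Mirror s x = ∀ i → x (s - i) ≡ x i

-- Testing both adjacent pairs makes a window equivalent to its reversal, on which every argument
-- about reflections relies.
admissible : Bool → Bool → Bool → Bool
admissible a b c = not (a ∧ b) ∧ not (b ∧ c) ∧ (a ∨ b ∨ c)

Admissible : (ℤ → Bool) → Set
Admissible x = ∀ i → admissible (x i) (x (1ℤ + i)) (x (+ 2 + i)) ≡ true

admissible-reverse : ∀ a b c → admissible a b c ≡ admissible c b a
admissible-reverse false false false = refl
admissible-reverse false false true  = refl
admissible-reverse false true  false = refl
admissible-reverse false true  true  = refl
admissible-reverse true  false false = refl
admissible-reverse true  false true  = refl
admissible-reverse true  true  false = refl
admissible-reverse true  true  true  = refl

periodic-*ℕ : ∀ {d x} → Periodic d x → ∀ k i → x (i + + k * + d) ≡ x i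
periodic-*ℕ {d} {x} per zero    i = cong x (trans (cong (_+_ i) (ℤ.*-zeroˡ (+ d))) (ℤ.+-identityʳ i))
periodic-*ℕ {d} {x} per (suc k) i = trans (cong x (lemma i (+ k) (+ d))) (trans (per _) (periodic-*ℕ {d} {x} per k i))
  where
  lemma : ∀ i k d → i + (1ℤ + k) * d ≡ i + k * d + d
  lemma = solve-∀

periodic-* : ∀ {d x} → Periodic d x → ∀ z i → x (i + z * + d) ≡ x i
periodic-* {d} {x} per (+ k)    i = periodic-*ℕ {d} {x} per k i
periodic-* {d} {x} per -[1+ k ] i = trans (sym (periodic-*ℕ {d} {x} per (suc k) _))
  (cong x (lemma i (+ suc k) (+ d)))
  where
  lemma : ∀ i k d → i + (- k) * d + k * d ≡ i
  lemma = solve-∀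

periodic-≡ : ∀ {d x} → Periodic d x → ∀ z {i j} → i ≡ j + z * + d → x i ≡ x j
periodic-≡ {d} {x} per z {i} {j} e = trans (cong x e) (periodic-* {d} {x} per z j)

residue-unique : ∀ {n a b} → a ℕ.< n → b ℕ.< n → ∀ z → + a ≡ + b + z * + n → a ≡ b
residue-unique {n} {a} {b} a<n b<n (+ zero) e =
  ℤ.+-injective (trans e (trans (cong (_+_ (+ b)) (ℤ.*-zeroˡ (+ n))) (ℤ.+-identityʳ (+ b))))
residue-unique {n} {a} {b} a<n b<n (+ suc k) e = contradiction a<n (ℕ.≤⇒≯ n≤a)
  where
  n≤a : n ℕ.≤ a
  n≤a = subst (n ℕ.≤_) (sym (ℤ.+-injective (trans e (cong (_+_ (+ b)) (sym (ℤ.pos-* (suc k) n))))))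
          (ℕ.≤-trans (ℕ.m≤m+n n (k ℕ.* n)) (ℕ.m≤n+m (n ℕ.+ k ℕ.* n) b))
residue-unique {n} {a} {b} a<n b<n -[1+ k ] e = sym (residue-unique b<n a<n (+ suc k)
  (trans (lemma (+ b) (+ suc k) (+ n)) (cong (λ z → z + + suc k * + n) (sym e))))
  where
  lemma : ∀ b k n → b ≡ b + (- k) * n + k * n
  lemma = solve-∀

module _ (n : ℕ) .{{_ : NonZero n}} where

  residue : ℤ → Fin n
  residue i = fromℕ< (n%ℕd<d i n)

  residue-spec : ∀ i → i ≡ + toℕ (residue i) + (i /ℕ n) * + n
  residue-spec i = trans (a≡a%ℕn+[a/ℕn]*n i n)
    (cong (λ r → + r + (i /ℕ n) * + n) (sym (Fin.toℕ-fromℕ< (n%ℕd<d i n))))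

  residue-cong : ∀ z i j → i ≡ j + z * + n → residue i ≡ residue j
  residue-cong z i j e = Fin.toℕ-injective (residue-unique (Fin.toℕ<n (residue i)) (Fin.toℕ<n (residue j))
    (j /ℕ n + z - i /ℕ n) (begin
      + a                              ≡⟨ lemma₁ (+ a) (i /ℕ n) (+ n) ⟩
      + a + i /ℕ n * + n - i /ℕ n * + n ≡⟨ cong (_- i /ℕ n * + n) (residue-spec i) ⟨
      i - i /ℕ n * + n                 ≡⟨ cong (_- i /ℕ n * + n) e ⟩
      j + z * + n - i /ℕ n * + n       ≡⟨ cong (λ j → j + z * + n - i /ℕ n * + n) (residue-spec j) ⟩
      + b + j /ℕ n * + n + z * + n - i /ℕ n * + n ≡⟨ lemma₂ (+ b) (j /ℕ n) z (i /ℕ n) (+ n) ⟩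
      + b + (j /ℕ n + z - i /ℕ n) * + n ∎))
    where
    open ≡-Reasoning
    a = toℕ (residue i)
    b = toℕ (residue j)
    lemma₁ : ∀ a q n → a ≡ a + q * n - q * n
    lemma₁ = solve-∀
    lemma₂ : ∀ b r z q n → b + r * n + z * n - q * n ≡ b + (r + z - q) * n
    lemma₂ = solve-∀

  residue-toℕ : ∀ v → residue (+ toℕ v) ≡ v
  residue-toℕ v = Fin.toℕ-injective (trans (Fin.toℕ-fromℕ< _) (ℕ.m<n⇒m%n≡m (Fin.toℕ<n v)))

  periodic-ext : ∀ {x y} → Periodic n x → Periodic n y →
                 (∀ v → x (+ toℕ {n} v) ≡ y (+ toℕ v)) → ∀ i → x i ≡ y i
  periodic-ext {x} {y} px py e i = begin
    x i                     ≡⟨ periodic-≡ {n} {x} px (i /ℕ n) (residue-spec i) ⟩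
    x (+ toℕ (residue i))   ≡⟨ e (residue i) ⟩
    y (+ toℕ (residue i))   ≡⟨ periodic-≡ {n} {y} py (i /ℕ n) (residue-spec i) ⟨
    y i                     ∎
    where open ≡-Reasoning

  -- One period decides an equation between n-periodic sequences; this is what makes periods and
  -- mirrors, which quantify over all integers, decidable.
  periodic-≗? : ∀ {x y} → Periodic n x → Periodic n y → Dec (∀ i → x i ≡ y i)
  periodic-≗? {x} {y} px py = map′ (periodic-ext {x} {y} px py) (λ e v → e (+ toℕ v))
    (Fin.all? λ v → x (+ toℕ v) Bool.≟ y (+ toℕ v))

  at : Subset n → ℤ → Bool
  at X i = lookup X (residue i)

  fromFun : (ℤ → Bool) → Subset n
  fromFun x = tabulate λ v → x (+ toℕ v)

  at-periodic : ∀ X → Periodic n (at X)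
  at-periodic X i = cong (lookup X) (residue-cong 1ℤ (i + + n) i (cong (_+_ i) (sym (ℤ.*-identityˡ (+ n)))))

  at-toℕ : ∀ X v → at X (+ toℕ v) ≡ lookup X v
  at-toℕ X v = cong (lookup X) (residue-toℕ v)

  at-fromFun : ∀ {x} → Periodic n x → ∀ i → at (fromFun x) i ≡ x i
  at-fromFun {x} per = periodic-ext {at (fromFun x)} {x} (at-periodic (fromFun x)) per
    λ v → trans (at-toℕ (fromFun x) v) (Vec.lookup∘tabulate _ v)

  at-injective : ∀ {X Y} → (∀ i → at X i ≡ at Y i) → X ≡ Y
  at-injective {X} {Y} e = trans (sym (Vec.tabulate∘lookup X)) (trans
    (Vec.tabulate-cong λ v → trans (sym (at-toℕ X v)) (trans (e (+ toℕ v)) (at-toℕ Y v))) (Vec.tabulate∘lookup Y))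

  fromFun-≗at : ∀ {X x} → (∀ i → x i ≡ at X i) → fromFun x ≡ X
  fromFun-≗at {X} {x} e = at-injective λ i → trans
    (at-fromFun {x} (λ i → trans (e (i + + n)) (trans (at-periodic X i) (sym (e i)))) i) (e i)

  at-periodic-ℤ : ∀ X z i j → i ≡ j + z * + n → at X i ≡ at X j
  at-periodic-ℤ X z i j e = cong (lookup X) (residue-cong z i j e)

  abstract
    periodic? : ∀ d X → Dec (Periodic d (at X))
    periodic? d X = periodic-≗? {λ i → at X (i + + d)} {at X}
      (λ i → at-periodic-ℤ X 1ℤ (i + + n + + d) (i + + d) (lemma i (+ n) (+ d))) (at-periodic X)
      where
      lemma : ∀ i n d → i + n + d ≡ i + d + 1ℤ * n
      lemma = solve-∀

  abstract
    mirror? : ∀ s X → Dec (Mirror s (at X))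
    mirror? s X = periodic-≗? {λ i → at X (s - i)} {at X}
      (λ i → at-periodic-ℤ X -1ℤ (s - (i + + n)) (s - i) (lemma i (+ n) s)) (at-periodic X)
      where
      lemma : ∀ i n s → s - (i + n) ≡ s - i + -1ℤ * n
      lemma = solve-∀

lookup-∈ : ∀ {n} {X : Subset n} {v} → v Subset.∈ X → lookup X v ≡ true
lookup-∈ = Vec.[]=⇒lookup

∈-lookup : ∀ {n} {X : Subset n} {v} → lookup X v ≡ true → v Subset.∈ X
∈-lookup {X = X} {v} = Vec.lookup⇒[]= v X

admissible⁺ : ∀ {a b c} → ¬ (a ≡ true × b ≡ true) → ¬ (b ≡ true × c ≡ true) →
              a ≡ true ⊎ b ≡ true ⊎ c ≡ true → admissible a b c ≡ true
admissible⁺ {true}  {true}          f g h = contradiction (refl , refl) f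
admissible⁺ {_}     {true}  {true}  f g h = contradiction (refl , refl) g
admissible⁺ {true}  {false} {_}     f g h = refl
admissible⁺ {false} {true}  {false} f g h = refl
admissible⁺ {false} {false} {true}  f g h = refl
admissible⁺ {false} {false} {false} f g (inj₁ ())
admissible⁺ {false} {false} {false} f g (inj₂ (inj₁ ()))
admissible⁺ {false} {false} {false} f g (inj₂ (inj₂ ()))

admissible⁻ : ∀ {a b c} → admissible a b c ≡ true →
              ¬ (a ≡ true × b ≡ true) × (a ≡ true ⊎ b ≡ true ⊎ c ≡ true)
admissible⁻ {true}  {false} {_}     _ = (λ ()) , inj₁ refl
admissible⁻ {false} {true}  {false} _ = (λ ()) , inj₂ (inj₁ refl)
admissible⁻ {false} {false} {true}  _ = (λ ()) , inj₂ (inj₂ refl)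

module _ {n : ℕ} .{{_ : NonZero n}} where

  -- Holds by computation: on nonnegative integers `residue` reduces to the `_mod_` in the
  -- definition of `σ`.
  σ-residue : ∀ (v : Fin n) → σ v ≡ residue n (1ℤ + + toℕ v)
  σ-residue v = refl

  σ-residue-ℤ : ∀ i → σ (residue n i) ≡ residue n (1ℤ + i)
  σ-residue-ℤ i = trans (σ-residue (residue n i)) (sym (residue-cong n (i /ℕ n) (1ℤ + i) (1ℤ + + toℕ (residue n i))
    (trans (cong (_+_ 1ℤ) (residue-spec n i)) (sym (ℤ.+-assoc 1ℤ (+ toℕ (residue n i)) (i /ℕ n * + n))))))

  at-σ : ∀ X i → lookup X (σ (residue n i)) ≡ at n X (1ℤ + i)
  at-σ X i = cong (lookup X) (σ-residue-ℤ i)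

  at-σσ : ∀ X i → lookup X (σ (σ (residue n i))) ≡ at n X (+ 2 + i)
  at-σσ X i = trans (cong (lookup X ∘ σ) (σ-residue-ℤ i))
    (trans (at-σ X (1ℤ + i)) (cong (at n X) (sym (ℤ.+-assoc 1ℤ 1ℤ i))))

  IsMIS⇒Admissible : ∀ {X : Subset n} → IsMIS X → Admissible (at n X)
  IsMIS⇒Admissible {X} (independent , maximal) i = admissible⁺
    (λ (a , b) → independent v (∈-lookup a , ∈-lookup (trans (at-σ X i) b)))
    (λ (b , c) → independent (σ v) (∈-lookup (trans (at-σ X i) b) , ∈-lookup (trans (at-σσ X i) c)))
    (Sum.map lookup-∈ (Sum.map (λ b → trans (sym (at-σ X i)) (lookup-∈ b))
                               (λ c → trans (sym (at-σσ X i)) (lookup-∈ c))) (maximal v))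
    where v = residue n i

  Admissible⇒IsMIS : ∀ {X : Subset n} → Admissible (at n X) → IsMIS X
  Admissible⇒IsMIS {X} adm =
    (λ v → let v≡ = at-toℕ n X v ; i = + toℕ v in λ (a , b) → proj₁ (admissible⁻ (adm i))
       (trans v≡ (lookup-∈ a) , trans (sym (at-σ X i)) (trans (cong (lookup X ∘ σ) (residue-toℕ n v)) (lookup-∈ b)))) ,
    (λ v → let i = + toℕ v in Sum.map (λ a → ∈-lookup (trans (sym (at-toℕ n X v)) a))
       (Sum.map (λ b → ∈-lookup (trans (cong (lookup X ∘ σ) (sym (residue-toℕ n v))) (trans (at-σ X i) b)))
                (λ c → ∈-lookup (trans (cong (lookup X ∘ σ ∘ σ) (sym (residue-toℕ n v))) (trans (at-σσ X i) c))))
       (proj₂ (admissible⁻ (adm i))))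

-- The dihedral action

Rotated : ℤ → (ℤ → Bool) → (ℤ → Bool) → Set
Rotated k x y = ∀ i → y (k + i) ≡ x i

Reflected : ℤ → (ℤ → Bool) → (ℤ → Bool) → Set
Reflected k x y = ∀ i → y (k - i) ≡ x i

-- Equivalence under the infinite dihedral group acting on ℤ. No modulus enters, so sets in
-- different V_n can be compared as well.
Congruent : (ℤ → Bool) → (ℤ → Bool) → Set
Congruent x y = ∃ λ k → Rotated k x y ⊎ Reflected k x y

k+[-k+i]≡i : ∀ k i → k + (- k + i) ≡ i
k+[-k+i]≡i = solve-∀

k-[k-i]≡i : ∀ k i → k - (k - i) ≡ i
k-[k-i]≡i = solve-∀

rotated-sym : ∀ {x y} k → Rotated k x y → Rotated (- k) y x
rotated-sym {y = y} k ρ i = trans (sym (ρ (- k + i))) (cong y (k+[-k+i]≡i k i))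

reflected-sym : ∀ {x y} k → Reflected k x y → Reflected k y x
reflected-sym {y = y} k ρ i = trans (sym (ρ (k - i))) (cong y (k-[k-i]≡i k i))

congruent-sym : ∀ {x y} → Congruent x y → Congruent y x
congruent-sym {x} {y} (k , inj₁ ρ) = - k , inj₁ (rotated-sym {x} {y} k ρ)
congruent-sym {x} {y} (k , inj₂ ρ) = k , inj₂ (reflected-sym {x} {y} k ρ)

congruent-trans : ∀ {x y z} → Congruent x y → Congruent y z → Congruent x z
congruent-trans {z = z} (k , inj₁ ρ) (l , inj₁ ς) =
  l + k , inj₁ λ i → trans (cong z (ℤ.+-assoc l k i)) (trans (ς (k + i)) (ρ i))
congruent-trans {z = z} (k , inj₁ ρ) (l , inj₂ ς) =
  l - k , inj₂ λ i → trans (cong z (lemma l k i)) (trans (ς (k + i)) (ρ i))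
  where
  lemma : ∀ l k i → l - k - i ≡ l - (k + i)
  lemma = solve-∀
congruent-trans {z = z} (k , inj₂ ρ) (l , inj₁ ς) =
  l + k , inj₂ λ i → trans (cong z (ℤ.+-assoc l k (- i))) (trans (ς (k - i)) (ρ i))
congruent-trans {z = z} (k , inj₂ ρ) (l , inj₂ ς) =
  l - k , inj₁ λ i → trans (cong z (lemma l k i)) (trans (ς (k - i)) (ρ i))
  where
  lemma : ∀ l k i → l - k + i ≡ l - (k - i)
  lemma = solve-∀

congruent-refl : ∀ {x y} → (∀ i → y i ≡ x i) → Congruent x y
congruent-refl {y = y} e = 0ℤ , inj₁ λ i → trans (cong y (ℤ.+-identityˡ i)) (e i)

periodic-resp : ∀ {d x y} → Congruent x y → Periodic d x → Periodic d y
periodic-resp {d} {x} {y} (k , inj₁ ρ) px i = begin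
  y (i + + d)         ≡⟨ rotated-sym {x} {y} k ρ (i + + d) ⟨
  x (- k + (i + + d)) ≡⟨ cong x (ℤ.+-assoc (- k) i (+ d)) ⟨
  x (- k + i + + d)   ≡⟨ px (- k + i) ⟩
  x (- k + i)         ≡⟨ rotated-sym {x} {y} k ρ i ⟩
  y i                 ∎
  where open ≡-Reasoning
periodic-resp {d} {x} {y} (k , inj₂ ρ) px i = begin
  y (i + + d)           ≡⟨ reflected-sym {x} {y} k ρ (i + + d) ⟨
  x (k - (i + + d))     ≡⟨ px (k - (i + + d)) ⟨
  x (k - (i + + d) + + d) ≡⟨ cong x (lemma k i (+ d)) ⟩
  x (k - i)             ≡⟨ reflected-sym {x} {y} k ρ i ⟩
  y i                   ∎
  where
  open ≡-Reasoning
  lemma : ∀ k i d → k - (i + d) + d ≡ k - i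
  lemma = solve-∀

-- Conjugating i ↦ s - i by the shift by k gives the mirror s + 2k, and by i ↦ k - i the mirror 2k -
-- s.
mirror-resp : ∀ {x y} → Congruent x y → ∀ {s} → Mirror s x → ∃ λ s → Mirror s y
mirror-resp {x} {y} (k , inj₁ ρ) {s} m = s + k + k , λ i → begin
  y (s + k + k - i)           ≡⟨ rotated-sym {x} {y} k ρ (s + k + k - i) ⟨
  x (- k + (s + k + k - i))   ≡⟨ cong x (lemma k s i) ⟩
  x (s - (- k + i))           ≡⟨ m (- k + i) ⟩
  x (- k + i)                 ≡⟨ rotated-sym {x} {y} k ρ i ⟩
  y i                         ∎
  where
  open ≡-Reasoning
  lemma : ∀ k s i → - k + (s + k + k - i) ≡ s - (- k + i)
  lemma = solve-∀
mirror-resp {x} {y} (k , inj₂ ρ) {s} m = k + k - s , λ i → begin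
  y (k + k - s - i)       ≡⟨ reflected-sym {x} {y} k ρ (k + k - s - i) ⟨
  x (k - (k + k - s - i)) ≡⟨ cong x (lemma k s i) ⟩
  x (s - (k - i))         ≡⟨ m (k - i) ⟩
  x (k - i)               ≡⟨ reflected-sym {x} {y} k ρ i ⟩
  y i                     ∎
  where
  open ≡-Reasoning
  lemma : ∀ k s i → k - (k + k - s - i) ≡ s - (k - i)
  lemma = solve-∀

admissible-cong : ∀ {a b c a′ b′ c′} → a ≡ a′ → b ≡ b′ → c ≡ c′ →
                  admissible a b c ≡ true → admissible a′ b′ c′ ≡ true
admissible-cong refl refl refl = id

admissible-resp : ∀ {x y} → Congruent x y → Admissible x → Admissible y
admissible-resp {x} {y} (k , inj₁ ρ) ax i = admissible-cong
  (ρ′ i) (trans (cong x (lemma k 1ℤ i)) (ρ′ (1ℤ + i))) (trans (cong x (lemma k (+ 2) i)) (ρ′ (+ 2 + i)))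
  (ax (- k + i))
  where
  ρ′ = rotated-sym {x} {y} k ρ
  lemma : ∀ k c i → c + (- k + i) ≡ - k + (c + i)
  lemma = solve-∀
admissible-resp {x} {y} (k , inj₂ ρ) ax i = admissible-cong
  (trans (cong x (lemma₂ k i)) (ρ′ i)) (trans (cong x (lemma₁ k i)) (ρ′ (1ℤ + i))) (ρ′ (+ 2 + i))
  (trans (sym (admissible-reverse (x j) (x (1ℤ + j)) (x (+ 2 + j)))) (ax j))
  where
  -- The window of `y` at i is the window of `x` at j read backwards.
  j = k - (+ 2 + i)
  ρ′ = reflected-sym {x} {y} k ρ
  lemma₁ : ∀ k i → 1ℤ + (k - (+ 2 + i)) ≡ k - (1ℤ + i)
  lemma₁ = solve-∀
  lemma₂ : ∀ k i → + 2 + (k - (+ 2 + i)) ≡ k - i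
  lemma₂ = solve-∀

-- The image is defined by an existential; injectivity makes v the only preimage of f v, so
-- membership of f v in the image is membership of v in X.
lookup-image : ∀ {n} (f : Fin n → Fin n) → (∀ {v w} → f v ≡ f w → v ≡ w) → ∀ X v →
  lookup (tabulate λ w → does (Fin.any? λ v → (v ∈? X) ×-dec (f v Fin.≟ w))) (f v) ≡ lookup X v
lookup-image f f-inj X v = trans (Vec.lookup∘tabulate _ (f v)) (lemma (lookup X v) refl)
  where
  dec = Fin.any? λ u → (u ∈? X) ×-dec (f u Fin.≟ f v)
  lemma : ∀ b → lookup X v ≡ b → does dec ≡ b
  lemma true  e = dec-true dec (v , ∈-lookup e , refl)
  lemma false e = dec-false dec λ { (u , u∈X , fu≡fv) →
    contradiction (trans (sym e) (trans (cong (lookup X) (sym (f-inj fu≡fv))) (lookup-∈ u∈X))) λ () }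

module _ {n : ℕ} .{{_ : NonZero n}} where

  residue-injective : ∀ i j → residue n i ≡ residue n j → ∃ λ z → i ≡ j + z * + n
  residue-injective i j e = i /ℕ n - j /ℕ n , (begin
    i                                               ≡⟨ residue-spec n i ⟩
    + toℕ (residue n i) + i /ℕ n * + n              ≡⟨ cong (λ r → + toℕ r + i /ℕ n * + n) e ⟩
    + toℕ (residue n j) + i /ℕ n * + n              ≡⟨ lemma (+ toℕ (residue n j)) (j /ℕ n) (i /ℕ n) (+ n) ⟩
    + toℕ (residue n j) + j /ℕ n * + n + (i /ℕ n - j /ℕ n) * + n
                                                    ≡⟨ cong (λ j′ → j′ + (i /ℕ n - j /ℕ n) * + n) (residue-spec n j) ⟨
    j + (i /ℕ n - j /ℕ n) * + n                     ∎)
    where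
    open ≡-Reasoning
    lemma : ∀ a q p n → a + p * n ≡ a + q * n + (p - q) * n
    lemma = solve-∀

  σ^-residue : ∀ k i → fold (residue n i) σ k ≡ residue n (+ k + i)
  σ^-residue zero    i = cong (residue n) (sym (ℤ.+-identityˡ i))
  σ^-residue (suc k) i = trans (cong σ (σ^-residue k i))
    (trans (σ-residue-ℤ (+ k + i)) (cong (residue n) (sym (ℤ.+-assoc 1ℤ (+ k) i))))

  τ-residue : ∀ (v : Fin n) → τ v ≡ residue n (- + toℕ v)
  τ-residue v = trans τ-residue-∸ (residue-cong n 1ℤ (+ (n ℕ.∸ toℕ v)) (- + toℕ v) (begin
    + (n ℕ.∸ toℕ v)       ≡⟨ ℤ.⊖-≥ (ℕ.<⇒≤ (Fin.toℕ<n v)) ⟨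
    n ℤ.⊖ toℕ v           ≡⟨ ℤ.m-n≡m⊖n n (toℕ v) ⟨
    + n - + toℕ v         ≡⟨ lemma (+ n) (+ toℕ v) ⟩
    - + toℕ v + 1ℤ * + n  ∎))
    where
    open ≡-Reasoning
    τ-residue-∸ : τ v ≡ residue n (+ (n ℕ.∸ toℕ v))
    τ-residue-∸ = refl
    lemma : ∀ n v → n - v ≡ - v + 1ℤ * n
    lemma = solve-∀

  rotation-residue : ∀ k v → (k , zero) · v ≡ residue n (+ toℕ k + + toℕ v)
  rotation-residue k v = trans (cong (λ v → fold v σ (toℕ k)) (sym (residue-toℕ n v))) (σ^-residue (toℕ k) (+ toℕ v))

  reflection-residue : ∀ k v → (k , suc zero) · v ≡ residue n (+ toℕ k - + toℕ v)
  reflection-residue k v = trans (cong (λ v → fold v σ (toℕ k)) (τ-residue v)) (σ^-residue (toℕ k) (- + toℕ v))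

  private
    toℕ-injective-mod : ∀ z (v w : Fin n) → + toℕ v ≡ + toℕ w + z * + n → v ≡ w
    toℕ-injective-mod z v w e = Fin.toℕ-injective (residue-unique (Fin.toℕ<n v) (Fin.toℕ<n w) z e)

  rotation-injective : ∀ k {v w : Fin n} → (k , zero) · v ≡ (k , zero) · w → v ≡ w
  rotation-injective k {v} {w} e with residue-injective (+ toℕ k + + toℕ v) (+ toℕ k + + toℕ w)
    (trans (sym (rotation-residue k v)) (trans e (rotation-residue k w)))
  ... | z , e′ = toℕ-injective-mod z v w (begin
    + toℕ v                                   ≡⟨ lemma (+ toℕ k) (+ toℕ v) ⟨
    - + toℕ k + (+ toℕ k + + toℕ v)           ≡⟨ cong (_+_ (- + toℕ k)) e′ ⟩
    - + toℕ k + (+ toℕ k + + toℕ w + z * + n) ≡⟨ lemma′ (+ toℕ k) (+ toℕ w) (z * + n) ⟩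
    + toℕ w + z * + n                         ∎)
    where
    open ≡-Reasoning
    lemma : ∀ k v → - k + (k + v) ≡ v
    lemma = solve-∀
    lemma′ : ∀ k w m → - k + (k + w + m) ≡ w + m
    lemma′ = solve-∀

  reflection-injective : ∀ k {v w : Fin n} → (k , suc zero) · v ≡ (k , suc zero) · w → v ≡ w
  reflection-injective k {v} {w} e with residue-injective (+ toℕ k - + toℕ v) (+ toℕ k - + toℕ w)
    (trans (sym (reflection-residue k v)) (trans e (reflection-residue k w)))
  ... | z , e′ = toℕ-injective-mod (- z) v w (begin
    + toℕ v                             ≡⟨ k-[k-i]≡i (+ toℕ k) (+ toℕ v) ⟨
    + toℕ k - (+ toℕ k - + toℕ v)       ≡⟨ cong (λ i → + toℕ k - i) e′ ⟩
    + toℕ k - (+ toℕ k - + toℕ w + z * + n) ≡⟨ lemma (+ toℕ k) (+ toℕ w) z (+ n) ⟩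
    + toℕ w + - z * + n                 ∎)
    where
    open ≡-Reasoning
    lemma : ∀ k w z n → k - (k - w + z * n) ≡ w + - z * n
    lemma = solve-∀

  rotation-• : ∀ k X → Rotated (+ toℕ k) (at n X) (at n ((k , zero) • X))
  rotation-• k X = periodic-ext n {λ i → at n Y (+ toℕ k + i)} {at n X}
    (λ i → at-periodic-ℤ n Y 1ℤ (+ toℕ k + (i + + n)) (+ toℕ k + i) (lemma (+ toℕ k) i (+ n))) (at-periodic n X)
    λ v → begin
      lookup Y (residue n (+ toℕ k + + toℕ v)) ≡⟨ cong (lookup Y) (rotation-residue k v) ⟨
      lookup Y ((k , zero) · v)                ≡⟨ lookup-image ((k , zero) ·_) (rotation-injective k) X v ⟩
      lookup X v                               ≡⟨ at-toℕ n X v ⟨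
      at n X (+ toℕ v)                         ∎
    where
    open ≡-Reasoning
    Y = (k , zero) • X
    lemma : ∀ k i n → k + (i + n) ≡ k + i + 1ℤ * n
    lemma = solve-∀

  reflection-• : ∀ k X → Reflected (+ toℕ k) (at n X) (at n ((k , suc zero) • X))
  reflection-• k X = periodic-ext n {λ i → at n Y (+ toℕ k - i)} {at n X}
    (λ i → at-periodic-ℤ n Y -1ℤ (+ toℕ k - (i + + n)) (+ toℕ k - i) (lemma (+ toℕ k) i (+ n))) (at-periodic n X)
    λ v → begin
      lookup Y (residue n (+ toℕ k - + toℕ v)) ≡⟨ cong (lookup Y) (reflection-residue k v) ⟨
      lookup Y ((k , suc zero) · v)            ≡⟨ lookup-image ((k , suc zero) ·_) (reflection-injective k) X v ⟩
      lookup X v                               ≡⟨ at-toℕ n X v ⟨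
      at n X (+ toℕ v)                         ∎
    where
    open ≡-Reasoning
    Y = (k , suc zero) • X
    lemma : ∀ k i n → k - (i + n) ≡ k - i + -1ℤ * n
    lemma = solve-∀

  -- Together with the converse this replaces the group law: `∼` inherits reflexivity, symmetry and
  -- transitivity from integer shifts, and `Dihedral` is never given a multiplication.
  ∼⇒congruent : ∀ {X Y : Subset n} → X ∼ Y → Congruent (at n X) (at n Y)
  ∼⇒congruent {X} ((k , zero)     , refl) = + toℕ k , inj₁ (rotation-• k X)
  ∼⇒congruent {X} ((k , suc zero) , refl) = + toℕ k , inj₂ (reflection-• k X)

  -- An arbitrary shift k becomes a group element by reduction modulo n, which n-periodicity of the
  -- sequences absorbs.
  congruent⇒∼ : ∀ {X Y : Subset n} → Congruent (at n X) (at n Y) → X ∼ Y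
  congruent⇒∼ {X} {Y} (k , inj₁ ρ) = (residue n k , zero) , at-injective n λ i → begin
    at n ((residue n k , zero) • X) i ≡⟨ rotated-sym {at n X} {at n ((residue n k , zero) • X)} (+ toℕ (residue n k)) (rotation-• (residue n k) X) i ⟨
    at n X (- + toℕ (residue n k) + i)
      ≡⟨ at-periodic-ℤ n X (k /ℕ n) (- + toℕ (residue n k) + i) (- k + i)
           (trans (lemma (+ toℕ (residue n k)) (k /ℕ n) i (+ n))
             (cong (λ k′ → - k′ + i + k /ℕ n * + n) (sym (residue-spec n k)))) ⟩
    at n X (- k + i)                  ≡⟨ rotated-sym {at n X} {at n Y} k ρ i ⟩
    at n Y i                          ∎
    where
    open ≡-Reasoning
    lemma : ∀ a q i n → - a + i ≡ - (a + q * n) + i + q * n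
    lemma = solve-∀
  congruent⇒∼ {X} {Y} (k , inj₂ ρ) = (residue n k , suc zero) , at-injective n λ i → begin
    at n ((residue n k , suc zero) • X) i ≡⟨ reflected-sym {at n X} {at n ((residue n k , suc zero) • X)} (+ toℕ (residue n k)) (reflection-• (residue n k) X) i ⟨
    at n X (+ toℕ (residue n k) - i)
      ≡⟨ at-periodic-ℤ n X (- (k /ℕ n)) (+ toℕ (residue n k) - i) (k - i)
           (trans (lemma (+ toℕ (residue n k)) (k /ℕ n) i (+ n))
             (cong (λ k′ → k′ - i + - (k /ℕ n) * + n) (sym (residue-spec n k)))) ⟩
    at n X (k - i)                        ≡⟨ reflected-sym {at n X} {at n Y} k ρ i ⟩
    at n Y i                              ∎
    where
    open ≡-Reasoning
    lemma : ∀ a q i n → a - i ≡ a + q * n - i + - q * n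
    lemma = solve-∀

  ∼-refl : ∀ {X : Subset n} → X ∼ X
  ∼-refl {X} = congruent⇒∼ (congruent-refl {at n X} {at n X} λ _ → refl)

  ∼-sym : ∀ {X Y : Subset n} → X ∼ Y → Y ∼ X
  ∼-sym {X} {Y} X∼Y = congruent⇒∼ (congruent-sym {at n X} {at n Y} (∼⇒congruent X∼Y))

  ∼-trans : ∀ {X Y Z : Subset n} → X ∼ Y → Y ∼ Z → X ∼ Z
  ∼-trans {X} {Y} {Z} X∼Y Y∼Z = congruent⇒∼ (congruent-trans {at n X} {at n Y} {at n Z} (∼⇒congruent X∼Y) (∼⇒congruent Y∼Z))

-- Enumerations of subsets and orbits

∈-subsets : ∀ {n} (X : Subset n) → X ∈ subsets n
∈-subsets []          = here refl
∈-subsets {suc n} (outside ∷ X) = ∈-++⁺ˡ (∈-map⁺ (outside ∷_) (∈-subsets X))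
∈-subsets {suc n} (inside  ∷ X) = ∈-++⁺ʳ (map (outside ∷_) (subsets n)) (∈-map⁺ (inside ∷_) (∈-subsets X))

subsets-unique : ∀ n → Unique (subsets n)
subsets-unique zero    = [] ∷ []
subsets-unique (suc n) = Unique.++⁺ (Unique.map⁺ Vec.∷-injectiveʳ (subsets-unique n))
  (Unique.map⁺ Vec.∷-injectiveʳ (subsets-unique n)) λ (X∈ , X∈′) → disjoint (∈-map⁻ _ X∈) (∈-map⁻ _ X∈′)
  where
  disjoint : ∀ {X : Subset (suc n)} → (∃ λ Y → Y ∈ subsets n × X ≡ outside ∷ Y) →
             ¬ (∃ λ Y → Y ∈ subsets n × X ≡ inside ∷ Y)
  disjoint (_ , _ , refl) (_ , _ , ())

𝐗-unique : ∀ n → Unique (𝐗 n)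
𝐗-unique n = Unique.filter⁺ isMIS? (subsets-unique n)

orbit-unique : ∀ {n} (X : Subset n) → Unique (orbit X)
orbit-unique {n} X = Unique.filter⁺ (X ∼?_) (subsets-unique n)

∈-orbit⁺ : ∀ {n} {X Y : Subset n} → X ∼ Y → Y ∈ orbit X
∈-orbit⁺ {X = X} {Y} = ∈-filter⁺ (X ∼?_) (∈-subsets Y)

∈-orbit⁻ : ∀ {n} {X Y : Subset n} → Y ∈ orbit X → X ∼ Y
∈-orbit⁻ {n} {X} Y∈ = proj₂ (∈-filter⁻ (X ∼?_) {xs = subsets n} Y∈)

module _ {n : ℕ} .{{_ : NonZero n}} where

  ∈-𝐗⁺ : ∀ {X : Subset n} → Admissible (at n X) → X ∈ 𝐗 n
  ∈-𝐗⁺ {X} adm = ∈-filter⁺ isMIS? (∈-subsets X) (Admissible⇒IsMIS adm)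

  ∈-𝐗⁻ : ∀ {X : Subset n} → X ∈ 𝐗 n → Admissible (at n X)
  ∈-𝐗⁻ X∈ = IsMIS⇒Admissible (proj₂ (∈-filter⁻ isMIS? {xs = subsets n} X∈))

  orbit-cong : ∀ {X Y : Subset n} → X ∼ Y → orbit X ≡ orbit Y
  orbit-cong {X} {Y} X∼Y = List.filter-≐ (X ∼?_) (Y ∼?_) (∼-trans (∼-sym X∼Y) , ∼-trans X∼Y) (subsets n)

  orbit-injective : ∀ {X Y : Subset n} → orbit X ≡ orbit Y → X ∼ Y
  orbit-injective {X} {Y} e = ∈-orbit⁻ (subst (Y ∈_) (sym e) (∈-orbit⁺ (∼-refl {X = Y})))

-- Orbits, least periods and mirrors

-- The orbits partition 𝐗 n. Since `orbit` filters all subsets, invariance of admissibility under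
-- congruence is needed to keep an orbit inside 𝐗 n.
∑-orbits : ∀ n .{{_ : NonZero n}} (g : Subset n → ℤ) → ∑ (orbits n) (λ O → ∑ O g) ≡ ∑ (𝐗 n) g
∑-orbits n g = begin
  ∑ (orbits n) (λ O → ∑ O g)
    ≡⟨ ∑-cong (orbits n) fibre ⟩
  ∑ (orbits n) (λ O → ∑ (filter (λ X → orbit X ≟ᴼ O) (𝐗 n)) g)
    ≡⟨ ∑-swap-filter (λ O X → orbit X ≟ᴼ O) (orbits n) (𝐗 n) (λ _ X → g X) ⟩
  ∑ (𝐗 n) (λ X → ∑ (filter (λ O → orbit X ≟ᴼ O) (orbits n)) (λ _ → g X))
    ≡⟨ ∑-cong (𝐗 n) (λ {X} X∈ → trans (∑-filter (λ O → orbit X ≟ᴼ O) (orbits n) (λ _ → g X))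
         (∑-single (λ O → orbit X ≟ᴼ O) (λ _ → g X) (deduplicate-! _≟ᴼ_ (map orbit (𝐗 n)))
           (∈-deduplicate⁺ _≟ᴼ_ (∈-map⁺ orbit X∈)) refl (λ _ → sym))) ⟩
  ∑ (𝐗 n) g ∎
  where
  open ≡-Reasoning
  _≟ᴼ_ = List.≡-dec (_≟ˢ_ {n})
  fibre : ∀ {O} → O ∈ orbits n → ∑ O g ≡ ∑ (filter (λ X → orbit X ≟ᴼ O) (𝐗 n)) g
  fibre O∈ with ∈-map⁻ orbit (∈-deduplicate⁻ _≟ᴼ_ (map orbit (𝐗 n)) O∈)
  ... | X , X∈ , refl = ∑-reindex g (orbit-unique X) (Unique.filter⁺ (λ Y → orbit Y ≟ᴼ orbit X) (𝐗-unique n))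
    (λ {Y} Y∈ → ∈-filter⁺ (λ Y → orbit Y ≟ᴼ orbit X)
       (∈-𝐗⁺ (admissible-resp {at n X} {at n Y} (∼⇒congruent (∈-orbit⁻ Y∈)) (∈-𝐗⁻ X∈)))
       (orbit-cong (∼-sym (∈-orbit⁻ Y∈))))
    (λ {Y} Y∈ → ∈-orbit⁺ (orbit-injective (sym (proj₂ (∈-filter⁻ (λ Y → orbit Y ≟ᴼ orbit X) {xs = 𝐗 n} Y∈)))))

-- Minimal for divisibility rather than for size, so that uniqueness is antisymmetry of `_∣_` and
-- the least period divides n at once.
record MinimalPeriod (d : ℕ) (x : ℤ → Bool) : Set where
  field
    nonZero  : NonZero d
    periodic : Periodic d x
    minimal  : ∀ {e} → Periodic e x → d ∣ e

open MinimalPeriod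

Symmetric : (ℤ → Bool) → Set
Symmetric x = ∃ λ s → Mirror s x

minimalPeriod-unique : ∀ {d e x} → MinimalPeriod d x → MinimalPeriod e x → d ≡ e
minimalPeriod-unique D E = ℕ.∣-antisym (minimal D (periodic E)) (minimal E (periodic D))

minimalPeriod-resp : ∀ {d x y} → Congruent x y → MinimalPeriod d x → MinimalPeriod d y
minimalPeriod-resp {x = x} {y} x≅y D = record
  { nonZero  = nonZero D
  ; periodic = periodic-resp {x = x} {y} x≅y (periodic D)
  ; minimal  = λ e-per → minimal D (periodic-resp {x = y} {x} (congruent-sym {x} {y} x≅y) e-per) }

symmetric-resp : ∀ {x y} → Congruent x y → Symmetric x → Symmetric y
symmetric-resp {x} {y} x≅y (s , m) = mirror-resp {x} {y} x≅y {s} m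

∃-least : ∀ {P : ℕ → Set} → Decidable P → ∀ m → P m → ∃ λ k → P k × (∀ {j} → j ℕ.< k → ¬ P j)
∃-least {P} P? = <-rec _ search
  where
  search : ∀ m → (∀ {k} → k ℕ.< m → P k → ∃ λ k → P k × (∀ {j} → j ℕ.< k → ¬ P j)) →
           P m → ∃ λ k → P k × (∀ {j} → j ℕ.< k → ¬ P j)
  search m rec pm with ℕ.anyUpTo? P? m
  ... | yes (k , k<m , pk) = rec k<m pk
  ... | no  none           = m , pm , λ j<m pj → none (_ , j<m , pj)

mirror-≡ : ∀ {d x} → Periodic d x → ∀ z {s t} → s ≡ t + z * + d → Mirror t x → Mirror s x
mirror-≡ {d} {x} px z {s} {t} e m i = trans (periodic-≡ {d} {x} px z {s - i} {t - i}
  (trans (cong (λ s → s - i) e) (lemma t (z * + d) i))) (m i)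
  where
  lemma : ∀ t m i → t + m - i ≡ t - i + m
  lemma = solve-∀

-- Two reflections compose to the translation by the difference of their parameters.
mirrors⇒periodic : ∀ {e s x} → Mirror s x → Mirror (s + + e) x → Periodic e x
mirrors⇒periodic {e} {s} {x} m m′ i =
  trans (sym (m′ (i + + e))) (trans (cong x (lemma s (+ e) i)) (m i))
  where
  lemma : ∀ s e i → s + e - (i + e) ≡ s - i
  lemma = solve-∀

module _ {n : ℕ} .{{_ : NonZero n}} where

  abstract
    -- The smallest positive period divides every period e, because the remainder of e is again a
    -- period and too small to be positive.
    ∃-minimalPeriod : (X : Subset n) → ∃ λ d → MinimalPeriod d (at n X)
    -- The search runs over successors, as 0 is a period of every sequence; it starts from the known
    -- period n.
    ∃-minimalPeriod X with ∃-least (λ k → periodic? n (suc k) X) (ℕ.pred n)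
                             (subst (λ m → Periodic m (at n X)) (sym (ℕ.suc-pred n)) (at-periodic n X))
    ... | k , per , least = suc k , record { nonZero = _ ; periodic = per ; minimal = divides-period }
      where
      divides-period : ∀ {e} → Periodic e (at n X) → suc k ∣ e
      divides-period {e} e-per = ℕ.m%n≡0⇒n∣m e (suc k) (lemma (e ℕ.% suc k) refl)
        where
        remainder : Periodic (e ℕ.% suc k) (at n X)
        remainder i = trans (sym (periodic-* {suc k} {at n X} per (+ (e ℕ./ suc k)) (i + + (e ℕ.% suc k))))
          (trans (cong (at n X) (begin
            i + + (e ℕ.% suc k) + + (e ℕ./ suc k) * + suc k
              ≡⟨ ℤ.+-assoc i (+ (e ℕ.% suc k)) (+ (e ℕ./ suc k) * + suc k) ⟩
            i + (+ (e ℕ.% suc k) + + (e ℕ./ suc k) * + suc k)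
              ≡⟨ cong (λ m → i + (+ (e ℕ.% suc k) + m)) (ℤ.pos-* (e ℕ./ suc k) (suc k)) ⟨
            i + + (e ℕ.% suc k ℕ.+ e ℕ./ suc k ℕ.* suc k)
              ≡⟨ cong (λ m → i + + m) (ℕ.m≡m%n+[m/n]*n e (suc k)) ⟨
            i + + e ∎)) (e-per i))
          where open ≡-Reasoning
        lemma : ∀ j → e ℕ.% suc k ≡ j → e ℕ.% suc k ≡ 0
        lemma zero    eq = eq
        lemma (suc j) eq = contradiction (subst (λ m → Periodic m (at n X)) eq remainder)
          (least (ℕ.s<s⁻¹ (subst (ℕ._< suc k) eq (ℕ.m%n<n e (suc k)))))

  period : Subset n → ℕ
  period X = proj₁ (∃-minimalPeriod X)

  period-minimal : ∀ X → MinimalPeriod (period X) (at n X)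
  period-minimal X = proj₂ (∃-minimalPeriod X)

  period-∣ : ∀ X → period X ∣ n
  period-∣ X = minimal (period-minimal X) (at-periodic n X)

  abstract
    symmetric? : (X : Subset n) → Dec (Symmetric (at n X))
    symmetric? X = map′ (λ (v , m) → + toℕ v , m)
      (λ (s , m) → residue n s , mirror-≡ {n} {at n X} (at-periodic n X) (- (s /ℕ n)) {+ toℕ (residue n s)} {s}
        (trans (lemma (+ toℕ (residue n s)) (s /ℕ n) (+ n)) (cong (λ t → t + - (s /ℕ n) * + n) (sym (residue-spec n s)))) m)
      (Fin.any? λ v → mirror? n (+ toℕ v) X)
      where
      lemma : ∀ a q n → a ≡ a + q * n + - q * n
      lemma = solve-∀

  symmetry : Subset n → Bool
  symmetry X = does (symmetric? X)

  symmetric : ∀ X → symmetry X ≡ true → Symmetric (at n X)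
  symmetric X = does-true (symmetric? X)

  asymmetric : ∀ X → symmetry X ≡ false → ¬ Symmetric (at n X)
  asymmetric X = does-false (symmetric? X)

period-≡ : ∀ {m n} .{{_ : NonZero m}} .{{_ : NonZero n}} {X : Subset m} {Y : Subset n} →
           Congruent (at m X) (at n Y) → period X ≡ period Y
period-≡ {m} {n} {X} {Y} X≅Y = minimalPeriod-unique
  (minimalPeriod-resp {x = at m X} {at n Y} X≅Y (period-minimal X)) (period-minimal Y)

symmetry-≡ : ∀ {m n} .{{_ : NonZero m}} .{{_ : NonZero n}} {X : Subset m} {Y : Subset n} →
             Congruent (at m X) (at n Y) → symmetry X ≡ symmetry Y
symmetry-≡ {m} {n} {X} {Y} X≅Y = does-⇔ (mk⇔ (symmetric-resp {at m X} {at n Y} X≅Y)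
  (symmetric-resp {at n Y} {at m X} (congruent-sym {at m X} {at n Y} X≅Y))) (symmetric? X) (symmetric? Y)

-- The orbit and the mirrors of a single set

orbitLength : ℕ → Bool → ℕ
orbitLength d symmetric = if symmetric then d else 2 ℕ.* d

<-∣⇒≡0 : ∀ {d e} → d ∣ e → e ℕ.< d → e ≡ 0
<-∣⇒≡0 {d} {zero}  _   _   = refl
<-∣⇒≡0 {d} {suc e} d∣e e<d = contradiction (ℕ.∣⇒≤ d∣e) (ℕ.<⇒≱ e<d)

m+n*o<p*o : ∀ {m n o p} → m ℕ.< o → n ℕ.< p → m ℕ.+ n ℕ.* o ℕ.< p ℕ.* o
m+n*o<p*o {n = n} {o} m<o n<p = ℕ.<-≤-trans (ℕ.+-monoˡ-< (n ℕ.* o) m<o) (ℕ.*-monoˡ-≤ o n<p)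

module _ {n : ℕ} .{{_ : NonZero n}} (X : Subset n) where

  private
    d = period X
    x = at n X
    D = period-minimal X
    x-periodic = at-periodic n X
    instance _ = nonZero D

  rotate : ℤ → Subset n
  rotate k = fromFun n λ i → x (- k + i)

  reflect : ℤ → Subset n
  reflect k = fromFun n λ i → x (k - i)

  at-rotate : ∀ k i → at n (rotate k) i ≡ x (- k + i)
  at-rotate k = at-fromFun n {λ i → x (- k + i)} λ i →
    trans (cong x (sym (ℤ.+-assoc (- k) i (+ n)))) (x-periodic (- k + i))

  at-reflect : ∀ k i → at n (reflect k) i ≡ x (k - i)
  at-reflect k = at-fromFun n {λ i → x (k - i)} λ i → at-periodic-ℤ n X -1ℤ (k - (i + + n)) (k - i) (lemma k i (+ n))
    where
    lemma : ∀ k i n → k - (i + n) ≡ k - i + -1ℤ * n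
    lemma = solve-∀

  private
    -- Common core of three injectivity statements: if P relates i to i + e, then e is a period,
    -- hence a multiple of d, and e ≤ j < d leaves only e = 0.
    separated-≤ : (P : ℕ → ℕ → Set) → (∀ i e → P i (i ℕ.+ e) → Periodic e x) →
                  ∀ {i j} → i ℕ.≤ j → j ℕ.< d → P i j → i ≡ j
    separated-≤ P P⇒periodic {i} {j} i≤j j<d pij =
      sym (trans (sym (ℕ.m+[n∸m]≡n i≤j)) (trans (cong (i ℕ.+_) e≡0) (ℕ.+-identityʳ i)))
      where
      e≡0 = <-∣⇒≡0 (minimal D (P⇒periodic i (j ℕ.∸ i) (subst (P i) (sym (ℕ.m+[n∸m]≡n i≤j)) pij)))
                   (ℕ.≤-<-trans (ℕ.m∸n≤m j i) j<d)

    separated : (P : ℕ → ℕ → Set) → (∀ {i j} → P i j → P j i) →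
                (∀ i e → P i (i ℕ.+ e) → Periodic e x) → ∀ {i j} → i ℕ.< d → j ℕ.< d → P i j → i ≡ j
    separated P P-sym P⇒periodic {i} {j} i<d j<d pij with ℕ.≤-total i j
    ... | inj₁ i≤j = separated-≤ P P⇒periodic i≤j j<d pij
    ... | inj₂ j≤i = sym (separated-≤ P P⇒periodic j≤i i<d (P-sym pij))

  rotate-injective : ∀ {i j} → i ℕ.< d → j ℕ.< d → rotate (+ i) ≡ rotate (+ j) → i ≡ j
  rotate-injective = separated (λ i j → rotate (+ i) ≡ rotate (+ j)) sym λ i e eq t → begin
    x (t + + e)                           ≡⟨ cong x (lemma₁ t (+ e) (+ i)) ⟩
    x (- + i + (+ i + + e + t))           ≡⟨ at-rotate (+ i) (+ i + + e + t) ⟨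
    at n (rotate (+ i)) (+ i + + e + t)   ≡⟨ cong (λ Y → at n Y (+ i + + e + t)) eq ⟩
    at n (rotate (+ i + + e)) (+ i + + e + t) ≡⟨ at-rotate (+ i + + e) (+ i + + e + t) ⟩
    x (- (+ i + + e) + (+ i + + e + t))   ≡⟨ cong x (lemma₂ t (+ i + + e)) ⟩
    x t                                   ∎
    where
    open ≡-Reasoning
    lemma₁ : ∀ t e i → t + e ≡ - i + (i + e + t)
    lemma₁ = solve-∀
    lemma₂ : ∀ t k → - k + (k + t) ≡ t
    lemma₂ = solve-∀

  reflect-injective : ∀ {i j} → i ℕ.< d → j ℕ.< d → reflect (+ i) ≡ reflect (+ j) → i ≡ j
  reflect-injective = separated (λ i j → reflect (+ i) ≡ reflect (+ j)) sym λ i e eq t → begin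
    x (t + + e)                               ≡⟨ cong x (lemma t (+ e) (+ i)) ⟩
    x (+ i + + e - (+ i - t))                 ≡⟨ at-reflect (+ i + + e) (+ i - t) ⟨
    at n (reflect (+ i + + e)) (+ i - t)      ≡⟨ cong (λ Y → at n Y (+ i - t)) eq ⟨
    at n (reflect (+ i)) (+ i - t)            ≡⟨ at-reflect (+ i) (+ i - t) ⟩
    x (+ i - (+ i - t))                       ≡⟨ cong x (k-[k-i]≡i (+ i) t) ⟩
    x t                                       ∎
    where
    open ≡-Reasoning
    lemma : ∀ t e i → t + e ≡ i + e - (i - t)
    lemma = solve-∀

  mirror-injective : ∀ {i j} → i ℕ.< d → j ℕ.< d → Mirror (+ i) x → Mirror (+ j) x → i ≡ j
  mirror-injective i<d j<d m m′ = separated (λ i j → Mirror (+ i) x × Mirror (+ j) x) (λ (a , b) → b , a)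
    (λ i e (a , b) → mirrors⇒periodic {e} {+ i} {x} a b) i<d j<d (m , m′)

  -- Undoing the rotation turns the coincidence into a reflection that fixes x.
  rotate≡reflect⇒symmetric : ∀ {k l} → rotate k ≡ reflect l → Symmetric x
  rotate≡reflect⇒symmetric {k} {l} eq = l - k , λ i → begin
    x (l - k - i)              ≡⟨ cong x (lemma l k i) ⟩
    x (l - (k + i))            ≡⟨ at-reflect l (k + i) ⟨
    at n (reflect l) (k + i)   ≡⟨ cong (λ Y → at n Y (k + i)) eq ⟨
    at n (rotate k) (k + i)    ≡⟨ at-rotate k (k + i) ⟩
    x (- k + (k + i))          ≡⟨ cong x (lemma′ k i) ⟩
    x i                        ∎
    where
    open ≡-Reasoning
    lemma : ∀ l k i → l - k - i ≡ l - (k + i)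
    lemma = solve-∀
    lemma′ : ∀ k i → - k + (k + i) ≡ i
    lemma′ = solve-∀

  rotations reflections : List (Subset n)
  rotations   = map (λ k → rotate (+ k)) (upTo d)
  reflections = map (λ k → reflect (+ k)) (upTo d)

  rotations-unique : Unique rotations
  rotations-unique = Unique-map (λ k → rotate (+ k))
    (λ i∈ j∈ → rotate-injective (∈-upTo⁻ i∈) (∈-upTo⁻ j∈)) (Unique.upTo⁺ d)

  reflections-unique : Unique reflections
  reflections-unique = Unique-map (λ k → reflect (+ k))
    (λ i∈ j∈ → reflect-injective (∈-upTo⁻ i∈) (∈-upTo⁻ j∈)) (Unique.upTo⁺ d)

  private
    k≡residue : ∀ k → k ≡ + toℕ (residue d k) + (k /ℕ d) * + d
    k≡residue k = residue-spec d k

  ∈-rotations : ∀ {Y} k → Rotated k x (at n Y) → Y ∈ rotations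
  ∈-rotations {Y} k ρ = subst (_∈ rotations) (at-injective n λ i → begin
      at n (rotate (+ k′)) i   ≡⟨ at-rotate (+ k′) i ⟩
      x (- + k′ + i)           ≡⟨ periodic-≡ {d} {x} (periodic D) (k /ℕ d) { - + k′ + i} { - k + i} (trans (lemma (+ k′) (k /ℕ d) i (+ d))
                                    (cong (λ k → - k + i + k₀ /ℕ d * + d) (sym (k≡residue k)))) ⟩
      x (- k + i)              ≡⟨ rotated-sym {x} {at n Y} k ρ i ⟩
      at n Y i                 ∎)
    (∈-map⁺ (λ k → rotate (+ k)) (∈-upTo⁺ (Fin.toℕ<n (residue d k))))
    where
    open ≡-Reasoning
    k₀ = k
    k′ = toℕ (residue d k)
    lemma : ∀ a q i n → - a + i ≡ - (a + q * n) + i + q * n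
    lemma = solve-∀

  ∈-reflections : ∀ {Y} k → Reflected k x (at n Y) → Y ∈ reflections
  ∈-reflections {Y} k ρ = subst (_∈ reflections) (at-injective n λ i → begin
      at n (reflect (+ k′)) i  ≡⟨ at-reflect (+ k′) i ⟩
      x (+ k′ - i)             ≡⟨ periodic-≡ {d} {x} (periodic D) (- (k /ℕ d)) {+ k′ - i} {k - i} (trans (lemma (+ k′) (k /ℕ d) i (+ d))
                                    (cong (λ k → k - i + - (k₀ /ℕ d) * + d) (sym (k≡residue k)))) ⟩
      x (k - i)                ≡⟨ reflected-sym {x} {at n Y} k ρ i ⟩
      at n Y i                 ∎)
    (∈-map⁺ (λ k → reflect (+ k)) (∈-upTo⁺ (Fin.toℕ<n (residue d k))))
    where
    open ≡-Reasoning
    k₀ = k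
    k′ = toℕ (residue d k)
    lemma : ∀ a q i n → a - i ≡ a + q * n - i + - q * n
    lemma = solve-∀

  rotation-∼ : ∀ {Y} → Y ∈ rotations → X ∼ Y
  rotation-∼ Y∈ with ∈-map⁻ (λ k → rotate (+ k)) Y∈
  ... | k , _ , refl = congruent⇒∼ (+ k , inj₁ λ i →
    trans (at-rotate (+ k) (+ k + i)) (cong x (lemma (+ k) i)))
    where
    lemma : ∀ k i → - k + (k + i) ≡ i
    lemma = solve-∀

  reflection-∼ : ∀ {Y} → Y ∈ reflections → X ∼ Y
  reflection-∼ Y∈ with ∈-map⁻ (λ k → reflect (+ k)) Y∈
  ... | k , _ , refl = congruent⇒∼ (+ k , inj₂ λ i →
    trans (at-reflect (+ k) (+ k - i)) (cong x (k-[k-i]≡i (+ k) i)))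

  private
    length-upTo-map : ∀ (f : ℕ → Subset n) → length (map f (upTo d)) ≡ d
    length-upTo-map f = trans (List.length-map f (upTo d)) (List.length-upTo d)

  -- The d rotations are distinct, and so are the d reflections. With a mirror every reflection is
  -- also a rotation; without one the two families are disjoint.
  length-orbit : length (orbit X) ≡ orbitLength (period X) (symmetry X)
  length-orbit = go (symmetry X) refl
    where
    go : ∀ b → symmetry X ≡ b → length (orbit X) ≡ orbitLength d b
    go true  e = trans
      (↭-length (Unique-↭ (orbit-unique X) rotations-unique (λ {Y} Y∈ → cover {Y} (∼⇒congruent (∈-orbit⁻ Y∈)))
        (∈-orbit⁺ ∘ rotation-∼)))
      (length-upTo-map _)
      where
      s = proj₁ (symmetric X e)
      cover : ∀ {Y} → Congruent x (at n Y) → Y ∈ rotations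
      cover     (k , inj₁ ρ) = ∈-rotations k ρ
      -- Composed with the mirror s, the reflection i ↦ k - i becomes the shift by k - s.
      cover {Y} (k , inj₂ ρ) = ∈-rotations {Y} (k - s) λ i →
        trans (cong (at n Y) (lemma k s i)) (trans (ρ (s - i)) (proj₂ (symmetric X e) i))
        where
        lemma : ∀ k s i → k - s + i ≡ k - (s - i)
        lemma = solve-∀
    go false e = trans
      (↭-length (Unique-↭ (orbit-unique X)
        (Unique.++⁺ rotations-unique reflections-unique disjoint)
        (λ {Y} Y∈ → cover {Y} (∼⇒congruent (∈-orbit⁻ Y∈)))
        (λ Y∈ → ∈-orbit⁺ ([ rotation-∼ , reflection-∼ ]′ (∈-++⁻ rotations Y∈)))))
      (trans (List.length-++ rotations)
        (cong₂ ℕ._+_ (length-upTo-map _) (trans (length-upTo-map _) (sym (ℕ.+-identityʳ d)))))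
      where
      disjoint : ∀ {Y} → ¬ (Y ∈ rotations × Y ∈ reflections)
      disjoint (Y∈ , Y∈′) with ∈-map⁻ (λ k → rotate (+ k)) Y∈ | ∈-map⁻ (λ k → reflect (+ k)) Y∈′
      ... | k , _ , refl | l , _ , eq = asymmetric X e (rotate≡reflect⇒symmetric {+ k} {+ l} eq)
      cover : ∀ {Y} → Congruent x (at n Y) → Y ∈ rotations ++ reflections
      cover (k , inj₁ ρ) = ∈-++⁺ˡ (∈-rotations k ρ)
      cover (k , inj₂ ρ) = ∈-++⁺ʳ rotations (∈-reflections k ρ)

  -- The mirrors of a set of least period d form a single residue class modulo d, if there are any,
  -- and such a class has n/d members below n.
  ∑-mirrors : ∑ (upTo n) (λ k → 𝟙 (mirror? n (+ k) X)) ≡ (if symmetry X then + (n ÷ d) else 0ℤ)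
  ∑-mirrors = go (symmetry X) refl
    where
    go : ∀ b → symmetry X ≡ b → ∑ (upTo n) (λ k → 𝟙 (mirror? n (+ k) X)) ≡ (if b then + (n ÷ d) else 0ℤ)
    go false e = ∑-0 (upTo n) λ {k} _ → 𝟙-no (mirror? n (+ k) X) λ m → asymmetric X e (+ k , m)
    go true  e = begin
      ∑ (upTo n) (λ k → 𝟙 (mirror? n (+ k) X))
        ≡⟨ ∑-cong (upTo n) (λ {k} _ → sym (ℤ.*-identityʳ (𝟙 (mirror? n (+ k) X)))) ⟩
      ∑ (upTo n) (λ k → 𝟙 (mirror? n (+ k) X) * 1ℤ)
        ≡⟨ ∑-filter (λ k → mirror? n (+ k) X) (upTo n) (λ _ → 1ℤ) ⟨
      ∑ (filter (λ k → mirror? n (+ k) X) (upTo n)) (λ _ → 1ℤ)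
        ≡⟨ ∑-bij (ℕ._/ d) (λ j → s ℕ.+ j ℕ.* d) (λ _ → 1ℤ)
             (Unique.filter⁺ _ (Unique.upTo⁺ n)) (Unique.upTo⁺ (n ÷ d)) to from ⟩
      ∑ (upTo (n ÷ d)) (λ _ → 1ℤ)
        ≡⟨ ∑-1 (upTo (n ÷ d)) ⟩
      + length (upTo (n ÷ d))
        ≡⟨ cong +_ (List.length-upTo (n ÷ d)) ⟩
      + (n ÷ d) ∎
      where
      open ≡-Reasoning
      s₀ = proj₁ (symmetric X e)
      s = toℕ (residue d s₀)
      s<d : s ℕ.< d
      s<d = Fin.toℕ<n (residue d s₀)
      s-mirror : Mirror (+ s) x
      s-mirror = mirror-≡ {d} {x} (periodic D) (- (s₀ /ℕ d)) {+ s} {s₀}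
        (trans (lemma (+ s) (s₀ /ℕ d) (+ d)) (cong (λ t → t + - (s₀ /ℕ d) * + d) (sym (k≡residue s₀))))
        (proj₂ (symmetric X e))
        where
        lemma : ∀ a q n → a ≡ a + q * n + - q * n
        lemma = solve-∀
      n≡ : n ≡ n ÷ d ℕ.* d
      n≡ = sym (n÷d*d≡n (period-∣ X))
      to : ∀ {k} → k ∈ filter (λ k → mirror? n (+ k) X) (upTo n) →
           k ℕ./ d ∈ upTo (n ÷ d) × s ℕ.+ k ℕ./ d ℕ.* d ≡ k
      -- The remainder of k modulo d is itself a mirror below d, hence equal to s.
      to {k} k∈ = ∈-upTo⁺ (ℕ.m<n*o⇒m/o<n (subst (k ℕ.<_) n≡ (∈-upTo⁻ (proj₁ k∈′)))) ,
        trans (cong (ℕ._+ k ℕ./ d ℕ.* d) (mirror-injective s<d (ℕ.m%n<n k d) s-mirror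
          (mirror-≡ {d} {x} (periodic D) (- + (k ℕ./ d)) {+ (k ℕ.% d)} {+ k} (trans (lemma (+ (k ℕ.% d)) (+ (k ℕ./ d)) (+ d))
             (cong (λ t → t + - + (k ℕ./ d) * + d) (trans (cong (_+_ (+ (k ℕ.% d))) (sym (ℤ.pos-* (k ℕ./ d) d)))
               (cong +_ (sym (ℕ.m≡m%n+[m/n]*n k d)))))) (proj₂ k∈′))))
          (sym (ℕ.m≡m%n+[m/n]*n k d))
        where
        k∈′ = ∈-filter⁻ (λ k → mirror? n (+ k) X) {xs = upTo n} k∈
        lemma : ∀ a q n → a ≡ a + q * n + - q * n
        lemma = solve-∀
      from : ∀ {j} → j ∈ upTo (n ÷ d) →
             s ℕ.+ j ℕ.* d ∈ filter (λ k → mirror? n (+ k) X) (upTo n) × (s ℕ.+ j ℕ.* d) ℕ./ d ≡ j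
      from {j} j∈ = ∈-filter⁺ (λ k → mirror? n (+ k) X) (∈-upTo⁺ (subst (s ℕ.+ j ℕ.* d ℕ.<_) (sym n≡) (m+n*o<p*o s<d (∈-upTo⁻ j∈))))
          (mirror-≡ {d} {x} (periodic D) (+ j) {+ (s ℕ.+ j ℕ.* d)} {+ s} (cong (_+_ (+ s)) (ℤ.pos-* j d)) s-mirror) ,
        trans (ℕ.+-distrib-/-∣ʳ s {d = d} (ℕ.n∣m*n j)) (cong₂ ℕ._+_ (ℕ.m<n⇒m/n≡0 s<d) (ℕ.m*n/n≡m j d))

-- Sorting 𝐗 n by least period and symmetry

primitiveCount : Bool → Seq
-- A default value, since `period` needs a nonzero modulus; sums over the divisors of a positive
-- number never reach it.
primitiveCount b zero      = 0ℤ
primitiveCount b n@(suc _) = ∑ (filter (λ X → period X ℕ.≟ n) (𝐗 n)) (λ X → 𝟙 (symmetry X Bool.≟ b))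

-- For d ∣ n, restriction to one period and repetition are inverse bijections between the sets of
-- least period d in V_n and in V_d. The underlying sequence does not change, so neither do period,
-- symmetry and admissibility.
∑-by-type : ∀ (w : ℕ → Bool → ℤ) n .{{_ : NonZero n}} →
            ∑ (𝐗 n) (λ X → w (period X) (symmetry X)) ≡
            ∑ (divisors n) (λ d → w d false * primitiveCount false d + w d true * primitiveCount true d)
∑-by-type w n = begin
  ∑ (𝐗 n) (λ X → w (period X) (symmetry X))
    ≡⟨ ∑-cong (𝐗 n) (λ {X} _ → sym (trans
         (∑-filter (λ d → period X ℕ.≟ d) (divisors n) (λ d → w d (symmetry X)))
         (∑-single (λ d → period X ℕ.≟ d) (λ d → w d (symmetry X)) (divisors-unique n)
           (∈-divisors⁺ (period-∣ X)) refl (λ _ → sym)))) ⟩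
  ∑ (𝐗 n) (λ X → ∑ (filter (λ d → period X ℕ.≟ d) (divisors n)) (λ d → w d (symmetry X)))
    ≡⟨ ∑-swap-filter (λ X d → period X ℕ.≟ d) (𝐗 n) (divisors n) (λ X d → w d (symmetry X)) ⟩
  ∑ (divisors n) (λ d → ∑ (filter (λ X → period X ℕ.≟ d) (𝐗 n)) (λ X → w d (symmetry X)))
    ≡⟨ ∑-cong (divisors n) (λ {d} d∈ → by-type d (∈-divisors⁻ d∈)) ⟩
  ∑ (divisors n) (λ d → w d false * primitiveCount false d + w d true * primitiveCount true d) ∎
  where
  open ≡-Reasoning

  by-type : ∀ d → d ∣ n → ∑ (filter (λ X → period X ℕ.≟ d) (𝐗 n)) (λ X → w d (symmetry X)) ≡
                          w d false * primitiveCount false d + w d true * primitiveCount true d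
  by-type zero      0∣n = contradiction (ℕ.0∣⇒≡0 0∣n) (ℕ.≢-nonZero⁻¹ n)
  by-type d@(suc _) d∣n = begin
    ∑ Xs (λ X → w d (symmetry X))
      ≡⟨ ∑-cong Xs (λ {X} X∈ → cong (w d) (symmetry-≡ (same {X} (down-≗ X∈)))) ⟩
    ∑ Xs (λ X → w d (symmetry (down X)))
      ≡⟨ ∑-bij down up (λ Y → w d (symmetry Y)) (Unique.filter⁺ _ (𝐗-unique n)) (Unique.filter⁺ _ (𝐗-unique d)) to from ⟩
    ∑ Ys (λ Y → w d (symmetry Y))
      ≡⟨ ∑-cong Ys (λ {Y} _ → split (symmetry Y)) ⟩
    ∑ Ys (λ Y → w d false * 𝟙 (symmetry Y Bool.≟ false) + w d true * 𝟙 (symmetry Y Bool.≟ true))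
      ≡⟨ ∑-+ Ys (λ Y → w d false * 𝟙 (symmetry Y Bool.≟ false)) (λ Y → w d true * 𝟙 (symmetry Y Bool.≟ true)) ⟩
    ∑ Ys (λ Y → w d false * 𝟙 (symmetry Y Bool.≟ false)) + ∑ Ys (λ Y → w d true * 𝟙 (symmetry Y Bool.≟ true))
      ≡⟨ cong₂ _+_ (∑-*ˡ Ys (w d false) (λ Y → 𝟙 (symmetry Y Bool.≟ false)))
                   (∑-*ˡ Ys (w d true) (λ Y → 𝟙 (symmetry Y Bool.≟ true))) ⟩
    w d false * primitiveCount false d + w d true * primitiveCount true d ∎
    where
    Xs = filter (λ X → period X ℕ.≟ d) (𝐗 n)
    Ys = filter (λ Y → period Y ℕ.≟ d) (𝐗 d)

    split : ∀ b → w d b ≡ w d false * 𝟙 (b Bool.≟ false) + w d true * 𝟙 (b Bool.≟ true)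
    split false = sym (trans (cong₂ _+_ (ℤ.*-identityʳ (w d false)) (ℤ.*-zeroʳ (w d true))) (ℤ.+-identityʳ (w d false)))
    split true  = sym (trans (cong₂ _+_ (ℤ.*-zeroʳ (w d false)) (ℤ.*-identityʳ (w d true))) (ℤ.+-identityˡ (w d true)))

    down : Subset n → Subset d
    down X = fromFun d (at n X)
    up : Subset d → Subset n
    up Y = fromFun n (at d Y)

    down-≗ : ∀ {X} → X ∈ Xs → ∀ i → at d (down X) i ≡ at n X i
    down-≗ {X} X∈ = at-fromFun d {at n X}
      (subst (λ e → Periodic e (at n X)) (proj₂ (∈-filter⁻ (λ X → period X ℕ.≟ d) {xs = 𝐗 n} X∈)) (periodic (period-minimal X)))

    up-≗ : ∀ Y i → at n (up Y) i ≡ at d Y i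
    up-≗ Y = at-fromFun n {at d Y} (multiple d∣n)
      where
      multiple : ∀ {n} → d ∣ n → Periodic n (at d Y)
      multiple (divides-refl c) i = trans (cong (λ m → at d Y (i + m)) (ℤ.pos-* c d))
        (periodic-* {d} {at d Y} (at-periodic d Y) (+ c) i)

    same : ∀ {X} → (∀ i → at d (down X) i ≡ at n X i) → Congruent (at n X) (at d (down X))
    same {X} = congruent-refl {at n X} {at d (down X)}

    to : ∀ {X} → X ∈ Xs → down X ∈ Ys × up (down X) ≡ X
    to {X} X∈ = ∈-filter⁺ (λ Y → period Y ℕ.≟ d)
        (∈-𝐗⁺ (admissible-resp {at n X} {at d (down X)} X≅ (∈-𝐗⁻ X∈𝐗)))
        (trans (sym (period-≡ X≅)) X-period) ,
      fromFun-≗at n {X} {at d (down X)} (down-≗ X∈)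
      where
      X≅ = same {X} (down-≗ X∈)
      X∈𝐗 = proj₁ (∈-filter⁻ (λ X → period X ℕ.≟ d) {xs = 𝐗 n} X∈)
      X-period = proj₂ (∈-filter⁻ (λ X → period X ℕ.≟ d) {xs = 𝐗 n} X∈)

    from : ∀ {Y} → Y ∈ Ys → up Y ∈ Xs × down (up Y) ≡ Y
    from {Y} Y∈ = ∈-filter⁺ (λ X → period X ℕ.≟ d)
        (∈-𝐗⁺ (admissible-resp {at d Y} {at n (up Y)} Y≅ (∈-𝐗⁻ Y∈𝐗)))
        (trans (sym (period-≡ Y≅)) Y-period) ,
      fromFun-≗at d {Y} {at n (up Y)} (up-≗ Y)
      where
      Y≅ = congruent-refl {at d Y} {at n (up Y)} (up-≗ Y)
      Y∈𝐗 = proj₁ (∈-filter⁻ (λ Y → period Y ℕ.≟ d) {xs = 𝐗 d} Y∈)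
      Y-period = proj₂ (∈-filter⁻ (λ Y → period Y ℕ.≟ d) {xs = 𝐗 d} Y∈)

-- Transfer matrices

⟦_⟧ : Bool → ℤ
⟦ b ⟧ = if b then 1ℤ else 0ℤ

⟦∧⟧ : ∀ a b → ⟦ a ∧ b ⟧ ≡ ⟦ a ⟧ * ⟦ b ⟧
⟦∧⟧ false b = sym (ℤ.*-zeroˡ ⟦ b ⟧)
⟦∧⟧ true  b = sym (ℤ.*-identityˡ ⟦ b ⟧)

∧-true⁻ : ∀ {a b} → a ∧ b ≡ true → a ≡ true × b ≡ true
∧-true⁻ {true} {true} _ = refl , refl

∧-true⁺ : ∀ {a b} → a ≡ true → b ≡ true → a ∧ b ≡ true
∧-true⁺ refl refl = refl

walk : (Bool → Bool → Bool) → Bool → Bool → ∀ {m} → Vec Bool m → Bool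
walk E a b []      = E a b
walk E a b (c ∷ w) = admissible a b c ∧ walk E b c w

-- One format for cyclic words and for half-words between two axes: `G` judges the first two letters
-- and `E` the last two. `E` also receives the first two, because closing a cycle compares both
-- ends.
valid : (Bool → Bool → Bool) → (Bool → Bool → Bool → Bool → Bool) → ∀ {m} → Vec Bool (2 ℕ.+ m) → Bool
valid G E (a ∷ b ∷ w) = G a b ∧ walk (E a b) a b w

-- The m-th power of the transfer matrix on pairs of letters, applied to the vector `E`.
walks : (Bool → Bool → Bool) → Bool → Bool → Seq
walks E a b zero    = ⟦ E a b ⟧
walks E a b (suc m) = ⟦ admissible a b false ⟧ * walks E b false m + ⟦ admissible a b true ⟧ * walks E b true m

validWords : (Bool → Bool → Bool) → (Bool → Bool → Bool → Bool → Bool) → Seq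
validWords G E m =
  (⟦ G false false ⟧ * walks (E false false) false false m + ⟦ G false true ⟧ * walks (E false true) false true m)
  + (⟦ G true false ⟧ * walks (E true false) true false m + ⟦ G true true ⟧ * walks (E true true) true true m)

∑-subsets-suc : ∀ n (f : Subset (suc n) → ℤ) →
                ∑ (subsets (suc n)) f ≡ ∑ (subsets n) (f ∘ (outside ∷_)) + ∑ (subsets n) (f ∘ (inside ∷_))
∑-subsets-suc n f = trans (∑-++ (map (outside ∷_) (subsets n)) (map (inside ∷_) (subsets n)) f)
  (cong₂ _+_ (∑-map (outside ∷_) (subsets n) f) (∑-map (inside ∷_) (subsets n) f))

∑-∧ : ∀ (xs : List A) a (f : A → Bool) → ∑ xs (λ x → ⟦ a ∧ f x ⟧) ≡ ⟦ a ⟧ * ∑ xs (λ x → ⟦ f x ⟧)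
∑-∧ xs a f = trans (∑-cong xs (λ {x} _ → ⟦∧⟧ a (f x))) (∑-*ˡ xs ⟦ a ⟧ (λ x → ⟦ f x ⟧))

∑-walk : ∀ E a b m → ∑ (subsets m) (λ w → ⟦ walk E a b w ⟧) ≡ walks E a b m
∑-walk E a b zero    = ℤ.+-identityʳ ⟦ E a b ⟧
∑-walk E a b (suc m) = trans (∑-subsets-suc m (λ w → ⟦ walk E a b w ⟧)) (cong₂ _+_ (branch false) (branch true))
  where
  branch : ∀ c → ∑ (subsets m) (λ w → ⟦ admissible a b c ∧ walk E b c w ⟧) ≡ ⟦ admissible a b c ⟧ * walks E b c m
  branch c = trans (∑-∧ (subsets m) (admissible a b c) (λ w → walk E b c w))
    (cong (⟦ admissible a b c ⟧ *_) (∑-walk E b c m))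

∑-valid : ∀ G E m → ∑ (subsets (2 ℕ.+ m)) (λ w → ⟦ valid G E w ⟧) ≡ validWords G E m
∑-valid G E m = trans (∑-subsets-suc (suc m) (λ w → ⟦ valid G E w ⟧)) (cong₂ _+_ (after false) (after true))
  where
  branch : ∀ a b → ∑ (subsets m) (λ w → ⟦ G a b ∧ walk (E a b) a b w ⟧) ≡ ⟦ G a b ⟧ * walks (E a b) a b m
  branch a b = trans (∑-∧ (subsets m) (G a b) (λ w → walk (E a b) a b w))
    (cong (⟦ G a b ⟧ *_) (∑-walk (E a b) a b m))
  after : ∀ a → ∑ (subsets (suc m)) (λ w → ⟦ valid G E (a ∷ w) ⟧) ≡
                ⟦ G a false ⟧ * walks (E a false) a false m + ⟦ G a true ⟧ * walks (E a true) a true m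
  after a = trans (∑-subsets-suc m (λ w → ⟦ valid G E (a ∷ w) ⟧)) (cong₂ _+_ (branch a false) (branch a true))

PadovanLike : Seq → Set
PadovanLike f = ∀ m → f (3 ℕ.+ m) ≡ f (1 ℕ.+ m) + f m

padovanLike-unique : ∀ f g → PadovanLike f → PadovanLike g →
                     f 0 ≡ g 0 → f 1 ≡ g 1 → f 2 ≡ g 2 → ∀ m → f m ≡ g m
padovanLike-unique f g F G e₀ e₁ e₂ 0 = e₀
padovanLike-unique f g F G e₀ e₁ e₂ 1 = e₁
padovanLike-unique f g F G e₀ e₁ e₂ 2 = e₂
padovanLike-unique f g F G e₀ e₁ e₂ (suc (suc (suc m))) = trans (F m)
  (trans (cong₂ _+_ (padovanLike-unique f g F G e₀ e₁ e₂ (suc m)) (padovanLike-unique f g F G e₀ e₁ e₂ m)) (sym (G m)))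

padovanLike-+ : ∀ {f g : Seq} → PadovanLike f → PadovanLike g → PadovanLike (λ m → f m + g m)
padovanLike-+ {f} {g} F G m = trans (cong₂ _+_ (F m) (G m)) (lemma (f (1 ℕ.+ m)) (f m) (g (1 ℕ.+ m)) (g m))
  where
  lemma : ∀ a b c d → a + b + (c + d) ≡ a + c + (b + d)
  lemma = solve-∀

padovanLike-* : ∀ c {f : Seq} → PadovanLike f → PadovanLike (λ m → c * f m)
padovanLike-* c {f} F m = trans (cong (c *_) (F m)) (ℤ.*-distribˡ-+ c (f (1 ℕ.+ m)) (f m))

padovanLike-0 : ∀ {f : Seq} → PadovanLike (λ m → 0ℤ * f m)
padovanLike-0 {f} m = trans (ℤ.*-zeroˡ (f (3 ℕ.+ m))) (sym (cong₂ _+_ (ℤ.*-zeroˡ (f (1 ℕ.+ m))) (ℤ.*-zeroˡ (f m))))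

module _ (E : Bool → Bool → Bool) where

  walks-00 : ∀ m → walks E false false (suc m) ≡ walks E false true m
  walks-00 m = lemma (walks E false false m) (walks E false true m)
    where
    lemma : ∀ a b → 0ℤ * a + 1ℤ * b ≡ b
    lemma = solve-∀

  walks-01 : ∀ m → walks E false true (suc m) ≡ walks E true false m
  walks-01 m = lemma (walks E true false m) (walks E true true m)
    where
    lemma : ∀ a b → 1ℤ * a + 0ℤ * b ≡ a
    lemma = solve-∀

  walks-10 : ∀ m → walks E true false (suc m) ≡ walks E false false m + walks E false true m
  walks-10 m = cong₂ _+_ (ℤ.*-identityˡ (walks E false false m)) (ℤ.*-identityˡ (walks E false true m))

  -- The steps are 00 → 01, 01 → 10, 10 → 00 and 10 → 01. This graph has one simple cycle of length
  -- 2 and one of length 3, whence the characteristic polynomial x³ - x - 1. The start 11 is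
  -- excluded: nothing continues it, but `E` may accept it at m = 0, and that would break the
  -- recursion.
  walks-padovanLike : ∀ a b → a ∧ b ≡ false → PadovanLike (walks E a b)
  walks-padovanLike false false _ m = begin
    walks E false false (3 ℕ.+ m)                   ≡⟨ walks-00 (2 ℕ.+ m) ⟩
    walks E false true (2 ℕ.+ m)                    ≡⟨ walks-01 (1 ℕ.+ m) ⟩
    walks E true false (1 ℕ.+ m)                    ≡⟨ walks-10 m ⟩
    walks E false false m + walks E false true m    ≡⟨ ℤ.+-comm (walks E false false m) _ ⟩
    walks E false true m + walks E false false m    ≡⟨ cong (λ z → z + walks E false false m) (walks-00 m) ⟨
    walks E false false (1 ℕ.+ m) + walks E false false m ∎
    where open ≡-Reasoning
  walks-padovanLike false true  _ m = begin
    walks E false true (3 ℕ.+ m)                            ≡⟨ walks-01 (2 ℕ.+ m) ⟩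
    walks E true false (2 ℕ.+ m)                            ≡⟨ walks-10 (1 ℕ.+ m) ⟩
    walks E false false (1 ℕ.+ m) + walks E false true (1 ℕ.+ m) ≡⟨ cong (λ z → z + walks E false true (1 ℕ.+ m)) (walks-00 m) ⟩
    walks E false true m + walks E false true (1 ℕ.+ m)     ≡⟨ ℤ.+-comm (walks E false true m) _ ⟩
    walks E false true (1 ℕ.+ m) + walks E false true m     ∎
    where open ≡-Reasoning
  walks-padovanLike true  false _ m = begin
    walks E true false (3 ℕ.+ m)                                 ≡⟨ walks-10 (2 ℕ.+ m) ⟩
    walks E false false (2 ℕ.+ m) + walks E false true (2 ℕ.+ m) ≡⟨ cong₂ _+_ (trans (walks-00 (1 ℕ.+ m)) (walks-01 m)) (walks-01 (1 ℕ.+ m)) ⟩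
    walks E true false m + walks E true false (1 ℕ.+ m)          ≡⟨ ℤ.+-comm (walks E true false m) _ ⟩
    walks E true false (1 ℕ.+ m) + walks E true false m          ∎
    where open ≡-Reasoning

validWords-padovanLike : ∀ G E → G true true ≡ false → PadovanLike (validWords G E)
validWords-padovanLike G E ¬G = padovanLike-+ {λ m → f false false m + f false true m} {λ m → f true false m + f true true m}
  (padovanLike-+ {f false false} {f false true} (term false false refl) (term false true refl))
  (padovanLike-+ {f true false} {f true true} (term true false refl)
    (subst (λ g → PadovanLike (λ m → ⟦ g ⟧ * walks (E true true) true true m)) (sym ¬G)
      (padovanLike-0 {walks (E true true) true true})))
  where
  f : Bool → Bool → Seq
  f a b m = ⟦ G a b ⟧ * walks (E a b) a b m
  term : ∀ a b → a ∧ b ≡ false → PadovanLike (f a b)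
  term a b e = padovanLike-* ⟦ G a b ⟧ {walks (E a b) a b} (walks-padovanLike (E a b) a b e)

prefix : ∀ m → (ℕ → Bool) → Vec Bool m
prefix m u = tabulate {n = m} (u ∘ toℕ)

walk⁺ : ∀ E m u → (∀ {j} → j ℕ.< m → admissible (u j) (u (1 ℕ.+ j)) (u (2 ℕ.+ j)) ≡ true) →
        E (u m) (u (1 ℕ.+ m)) ≡ true → walk E (u 0) (u 1) (prefix m (u ∘ (2 ℕ.+_))) ≡ true
walk⁺ E zero    u adm end = end
walk⁺ E (suc m) u adm end = ∧-true⁺ (adm (ℕ.s≤s ℕ.z≤n)) (walk⁺ E m (u ∘ suc) (adm ∘ ℕ.s≤s) end)

walk⁻ : ∀ E m u → walk E (u 0) (u 1) (prefix m (u ∘ (2 ℕ.+_))) ≡ true →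
        (∀ {j} → j ℕ.< m → admissible (u j) (u (1 ℕ.+ j)) (u (2 ℕ.+ j)) ≡ true) × E (u m) (u (1 ℕ.+ m)) ≡ true
walk⁻ E zero    u e = (λ ()) , e
walk⁻ E (suc m) u e with ∧-true⁻ {admissible (u 0) (u 1) (u 2)} e
... | e₀ , e′ with walk⁻ E m (u ∘ suc) e′
... | adm , end = (λ { {zero} _ → e₀ ; {suc j} (ℕ.s≤s j<m) → adm j<m }) , end

prefix-at : ∀ n .{{_ : NonZero n}} (X : Subset n) → prefix n (λ j → at n X (+ j)) ≡ X
prefix-at n X = trans (Vec.tabulate-cong (at-toℕ n X)) (Vec.tabulate∘lookup X)

𝟙-≟true : ∀ b → 𝟙 (b Bool.≟ true) ≡ ⟦ b ⟧
𝟙-≟true false = refl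
𝟙-≟true true  = refl

admissible-mod : ∀ n .{{_ : NonZero n}} {x} → Periodic n x →
  (∀ {j} → j ℕ.< n → admissible (x (+ j)) (x (+ (1 ℕ.+ j))) (x (+ (2 ℕ.+ j))) ≡ true) → Admissible x
admissible-mod n {x} x-periodic adm i = admissible-cong
  (trans (cong x (sym (ℤ.+-identityˡ (+ j)))) (trans (shift 0ℤ) (cong x (ℤ.+-identityˡ i))))
  (shift 1ℤ) (shift (+ 2)) (adm (Fin.toℕ<n (residue n i)))
  where
  j = toℕ (residue n i)
  shift : ∀ c → x (c + + j) ≡ x (c + i)
  shift c = sym (periodic-≡ {n} {x} x-periodic (i /ℕ n) {c + i} {c + + j}
    (trans (cong (_+_ c) (residue-spec n i)) (sym (ℤ.+-assoc c (+ j) (i /ℕ n * + n)))))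

-- Cyclic words and the Perrin numbers

cyclicStart : Bool → Bool → Bool
cyclicStart a b = not (a ∧ b)

-- The two windows that run over the end of the word back into its beginning.
cyclicEnd : Bool → Bool → Bool → Bool → Bool
cyclicEnd a b y z = admissible y z a ∧ admissible z a b

admissible⇒¬∧ : ∀ a b c → admissible a b c ≡ true → not (a ∧ b) ≡ true
admissible⇒¬∧ a b c = proj₁ ∘ ∧-true⁻ {not (a ∧ b)}

module _ (m : ℕ) (X : Subset (2 ℕ.+ m)) where

  private
    n = 2 ℕ.+ m
    u : ℕ → Bool
    u j = at n X (+ j)
    wrap : ∀ j → u (n ℕ.+ j) ≡ u j
    wrap j = trans (cong u (ℕ.+-comm n j)) (at-periodic n X (+ j))

    wrap₀ : u n ≡ u 0
    wrap₀ = trans (cong u (sym (ℕ.+-identityʳ n))) (wrap 0)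
    wrap₁ : u (1 ℕ.+ n) ≡ u 1
    wrap₁ = trans (cong u (ℕ.+-comm 1 n)) (wrap 1)

  admissible⇒cyclic : Admissible (at n X) → valid cyclicStart cyclicEnd X ≡ true
  admissible⇒cyclic adm = subst (λ Y → valid cyclicStart cyclicEnd Y ≡ true) (prefix-at n X) (∧-true⁺
    (admissible⇒¬∧ (u 0) (u 1) (u 2) (adm 0ℤ))
    (walk⁺ (cyclicEnd (u 0) (u 1)) m u (λ {j} _ → adm (+ j)) (∧-true⁺
      (admissible-cong {u m} {u (1 ℕ.+ m)} {u n} refl refl wrap₀ (adm (+ m)))
      (admissible-cong {u (1 ℕ.+ m)} {u n} {u (1 ℕ.+ n)} refl wrap₀ wrap₁ (adm (+ (1 ℕ.+ m)))))))

  cyclic⇒admissible : valid cyclicStart cyclicEnd X ≡ true → Admissible (at n X)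
  cyclic⇒admissible v = admissible-mod n {at n X} (at-periodic n X) λ j<n → go (ℕ.m<1+n⇒m<n∨m≡n j<n)
    where
    split₁ = ∧-true⁻ {cyclicStart (u 0) (u 1)} (subst (λ Y → valid cyclicStart cyclicEnd Y ≡ true) (sym (prefix-at n X)) v)
    split₂ = walk⁻ (cyclicEnd (u 0) (u 1)) m u (proj₂ split₁)
    split₃ = ∧-true⁻ {admissible (u m) (u (1 ℕ.+ m)) (u 0)} (proj₂ split₂)
    go : ∀ {j} → j ℕ.< 1 ℕ.+ m ⊎ j ≡ 1 ℕ.+ m → admissible (u j) (u (1 ℕ.+ j)) (u (2 ℕ.+ j)) ≡ true
    go (inj₂ refl) = admissible-cong {u (1 ℕ.+ m)} {u 0} {u 1} refl (sym wrap₀) (sym wrap₁) (proj₂ split₃)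
    go (inj₁ j≤m) with ℕ.m<1+n⇒m<n∨m≡n j≤m
    ... | inj₁ j<m  = proj₁ split₂ j<m
    ... | inj₂ refl = admissible-cong {u m} {u (1 ℕ.+ m)} {u 0} refl refl (sym wrap₀) (proj₁ split₃)

-- Both sides satisfy the same recursion and agree at n = 2, 3, 4. Words with two initial letters
-- begin at n = 2, so n = 1 is left to `p≡∑`.
length-𝐗 : ∀ m → ∑ (𝐗 (2 ℕ.+ m)) (λ _ → 1ℤ) ≡ p (2 ℕ.+ m)
length-𝐗 m = begin
  ∑ (𝐗 n) (λ _ → 1ℤ)                                       ≡⟨ ∑-filter isMIS? (subsets n) (λ _ → 1ℤ) ⟩
  ∑ (subsets n) (λ X → 𝟙 (isMIS? X) * 1ℤ)                  ≡⟨ ∑-cong (subsets n) (λ {X} _ → bracket X) ⟩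
  ∑ (subsets n) (λ X → ⟦ valid cyclicStart cyclicEnd X ⟧)  ≡⟨ ∑-valid cyclicStart cyclicEnd m ⟩
  validWords cyclicStart cyclicEnd m                       ≡⟨ padovanLike-unique (validWords cyclicStart cyclicEnd) (λ m → p (2 ℕ.+ m))
    (validWords-padovanLike cyclicStart cyclicEnd refl) (λ _ → refl) refl refl refl m ⟩
  p (2 ℕ.+ m)                                              ∎
  where
  open ≡-Reasoning
  n = 2 ℕ.+ m
  bracket : ∀ X → 𝟙 (isMIS? X) * 1ℤ ≡ ⟦ valid cyclicStart cyclicEnd X ⟧
  bracket X = trans (ℤ.*-identityʳ (𝟙 (isMIS? X))) (trans
    (𝟙-cong (isMIS? X) (valid cyclicStart cyclicEnd X Bool.≟ true)
      (admissible⇒cyclic m X ∘ IsMIS⇒Admissible) (Admissible⇒IsMIS ∘ cyclic⇒admissible m X))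
    (𝟙-≟true (valid cyclicStart cyclicEnd X)))

-- Maximal independent sets with a given mirror

-- A mirror of a periodic sequence has two axes; the flags tell whether they pass
-- between two vertices (true) or through a vertex (false).
axisStart : Bool → Bool → Bool → Bool
axisStart s a b = admissible (if s then a else b) a b

axisEnd : Bool → Bool → Bool → Bool → Bool → Bool
axisEnd t _ _ y z = admissible y z (if t then z else y)

δ : Bool → ℕ
δ b = if b then 1 else 0

-- The axes of Mirror N are at 0 or -1/2 and at N/2, so the restriction to 0, …, m + 1
-- determines the sequence.
module _ (m n N : ℕ) .{{_ : NonZero n}} (s t : Bool)
         (N≡ : N ≡ δ t ℕ.+ (2 ℕ.+ (m ℕ.+ m))) (n≡ : n ≡ δ s ℕ.+ N) where

  private
    δ≤1 : ∀ b → δ b ℕ.≤ 1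
    δ≤1 false = ℕ.z≤n
    δ≤1 true  = ℕ.s≤s ℕ.z≤n

    N≤n : N ℕ.≤ n
    N≤n = subst (N ℕ.≤_) (sym n≡) (ℕ.m≤n+m N (δ s))

    n≤1+N : n ℕ.≤ suc N
    n≤1+N = subst (ℕ._≤ suc N) (sym n≡) (ℕ.+-monoˡ-≤ N (δ≤1 s))

    2+2m≤N : 2 ℕ.+ (m ℕ.+ m) ℕ.≤ N
    2+2m≤N = subst (2 ℕ.+ (m ℕ.+ m) ℕ.≤_) (sym N≡) (ℕ.m≤n+m _ (δ t))

    N≤3+2m : N ℕ.≤ 3 ℕ.+ (m ℕ.+ m)
    N≤3+2m = subst (ℕ._≤ 3 ℕ.+ (m ℕ.+ m)) (sym N≡) (ℕ.+-monoˡ-≤ (2 ℕ.+ (m ℕ.+ m)) (δ≤1 t))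

    2+m≤n : 2 ℕ.+ m ℕ.≤ n
    2+m≤n = ℕ.≤-trans (ℕ.≤-trans (ℕ.+-monoʳ-≤ 2 (ℕ.m≤m+n m m)) 2+2m≤N) N≤n

    1+m≤N∸j : ∀ {j} → j ℕ.≤ 1 ℕ.+ m → 1 ℕ.+ m ℕ.≤ N ℕ.∸ j
    1+m≤N∸j {j} j≤ = ℕ.m+n≤o⇒m≤o∸n (1 ℕ.+ m) (ℕ.≤-trans (ℕ.+-monoʳ-≤ (1 ℕ.+ m) j≤)
      (subst (ℕ._≤ N) (sym (cong suc (ℕ.+-suc m m))) 2+2m≤N))

    N∸j≤1+m : ∀ {j} → 1 ℕ.+ m ℕ.< j → N ℕ.∸ j ℕ.≤ 1 ℕ.+ m
    N∸j≤1+m {j} <j = ℕ.m≤n+o⇒m∸n≤o N j (ℕ.≤-trans N≤3+2m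
      (subst (ℕ._≤ j ℕ.+ (1 ℕ.+ m)) (cong (2 ℕ.+_) (ℕ.+-suc m m)) (ℕ.+-monoˡ-≤ (1 ℕ.+ m) <j)))

    +[N∸j] : ∀ {j} → j ℕ.≤ N → + (N ℕ.∸ j) ≡ + N - + j
    +[N∸j] {j} j≤N = sym (trans (ℤ.m-n≡m⊖n N j) (ℤ.⊖-≥ j≤N))

  module _ {x : ℤ → Bool} (x-periodic : Periodic n x) (x-mirror : Mirror (+ N) x) where

    -- The period carries -1 to n - 1 and the mirror carries that to N - n + 1, which is 0 or 1
    -- according to `s`.
    before : x -1ℤ ≡ (if s then x 0ℤ else x 1ℤ)
    before = trans (sym (x-periodic -1ℤ)) (lemma s n≡)
      where
      lemma : ∀ s → n ≡ δ s ℕ.+ N → x (-1ℤ + + n) ≡ (if s then x 0ℤ else x 1ℤ)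
      lemma true  refl = trans (cong x (trans (e (+ N)) refl)) (x-mirror 0ℤ)
        where
        e : ∀ N → -1ℤ + (1ℤ + N) ≡ N - 0ℤ
        e = solve-∀
      lemma false refl = trans (cong x (ℤ.+-comm -1ℤ (+ N))) (x-mirror 1ℤ)

    -- The mirror carries 2 + m to N - 2 - m, which is 1 + m or m according to `t`.
    after : x (+ (2 ℕ.+ m)) ≡ (if t then x (+ (1 ℕ.+ m)) else x (+ m))
    after = trans (sym (x-mirror (+ (2 ℕ.+ m)))) (lemma t N≡)
      where
      lemma : ∀ t → N ≡ δ t ℕ.+ (2 ℕ.+ (m ℕ.+ m)) → x (+ N - + (2 ℕ.+ m)) ≡ (if t then x (+ (1 ℕ.+ m)) else x (+ m))
      lemma true  refl = cong x (e (+ m))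
        where
        e : ∀ m → + 3 + (m + m) - (+ 2 + m) ≡ 1ℤ + m
        e = solve-∀
      lemma false refl = cong x (e (+ m))
        where
        e : ∀ m → + 2 + (m + m) - (+ 2 + m) ≡ m
        e = solve-∀

    private
      u : ℕ → Bool
      u j = x (+ j)

      -- Windows are indexed by their middle letter here, because the mirror takes the window
      -- centred at i to the reversed window centred at N - i.
      Centred : ℤ → Set
      Centred i = admissible (x (-1ℤ + i)) (x i) (x (1ℤ + i)) ≡ true

    admissible⇒valid : Admissible x → valid (axisStart s) (axisEnd t) (prefix (2 ℕ.+ m) u) ≡ true
    admissible⇒valid adm = ∧-true⁺ (admissible-cong {x -1ℤ} {u 0} {u 1} before refl refl (adm -1ℤ))
      (walk⁺ (axisEnd t (u 0) (u 1)) m u (λ {j} _ → adm (+ j))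
        (admissible-cong {u m} {u (1 ℕ.+ m)} {u (2 ℕ.+ m)} refl refl after (adm (+ m))))

    valid⇒admissible : valid (axisStart s) (axisEnd t) (prefix (2 ℕ.+ m) u) ≡ true → Admissible x
    valid⇒admissible v = admissible-mod n {x} x-periodic
        λ {j} _ → subst (λ i → admissible i (u (1 ℕ.+ j)) (u (2 ℕ.+ j)) ≡ true) (cong x (e (+ j))) (centred (1ℤ + + j))
      where
      e : ∀ j → -1ℤ + (1ℤ + j) ≡ j
      e = solve-∀
      e′ : ∀ i → 1ℤ + (-1ℤ + i) ≡ i
      e′ = solve-∀
      split₁ = ∧-true⁻ {axisStart s (u 0) (u 1)} v
      split₂ = walk⁻ (axisEnd t (u 0) (u 1)) m u (proj₂ split₁)

      near : ∀ {j} → j ℕ.≤ 1 ℕ.+ m → Centred (+ j)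
      near {zero}  _ = admissible-cong {if s then u 0 else u 1} {u 0} {u 1} (sym before) refl refl (proj₁ split₁)
      near {suc j} (ℕ.s≤s j≤m) = subst (λ i → admissible i (u (1 ℕ.+ j)) (u (2 ℕ.+ j)) ≡ true) (cong x (sym (e (+ j))))
        ([ proj₁ split₂ , (λ { refl → admissible-cong {u m} {u (1 ℕ.+ m)} {if t then u (1 ℕ.+ m) else u m}
             refl refl (sym after) (proj₂ split₂) }) ]′ (ℕ.m<1+n⇒m<n∨m≡n (ℕ.s≤s j≤m)))

      -- Centres beyond 1 + m are reflected to N - j, which is at most 1 + m.
      residual : ∀ {j} → j ℕ.< n → Centred (+ j)
      residual {j} j<n with j ℕ.≤? 1 ℕ.+ m
      ... | yes j≤ = near j≤
      ... | no  j≰ = trans (admissible-reverse (x (-1ℤ + + j)) (x (+ j)) (x (1ℤ + + j)))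
        (admissible-cong
          (trans (cong x (trans (cong (_+_ -1ℤ) N∸j≡) (shift₁ (+ N) (+ j)))) (x-mirror (1ℤ + + j)))
          (trans (cong x N∸j≡) (x-mirror (+ j)))
          (trans (cong x (trans (cong (_+_ 1ℤ) N∸j≡) (shift₂ (+ N) (+ j)))) (x-mirror (-1ℤ + + j)))
          (near (N∸j≤1+m (ℕ.≰⇒> j≰))))
        where
        N∸j≡ = +[N∸j] (ℕ.s≤s⁻¹ (ℕ.≤-trans j<n n≤1+N))
        shift₁ : ∀ N j → -1ℤ + (N - j) ≡ N - (1ℤ + j)
        shift₁ = solve-∀
        shift₂ : ∀ N j → 1ℤ + (N - j) ≡ N - (-1ℤ + j)
        shift₂ = solve-∀

      centred : ∀ i → Centred i
      centred i = admissible-cong (shift -1ℤ)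
        (trans (cong x (sym (ℤ.+-identityˡ (+ j)))) (trans (shift 0ℤ) (cong x (ℤ.+-identityˡ i)))) (shift 1ℤ)
        (residual (Fin.toℕ<n (residue n i)))
        where
        j = toℕ (residue n i)
        shift : ∀ c → x (c + + j) ≡ x (c + i)
        shift c = sym (periodic-≡ {n} {x} x-periodic (i /ℕ n) {c + i} {c + + j}
          (trans (cong (_+_ c) (residue-spec n i)) (sym (ℤ.+-assoc c (+ j) (i /ℕ n * + n)))))

  -- Of the two positions j and N - j exchanged by the mirror, the one within the half 0, ..., 1 +
  -- m.
  fold-index : ℕ → ℕ
  fold-index j = j ℕ.⊓ (N ℕ.∸ j)

  private
    fold-near : ∀ {j} → j ℕ.≤ 1 ℕ.+ m → fold-index j ≡ j
    fold-near j≤ = ℕ.m≤n⇒m⊓n≡m (ℕ.≤-trans j≤ (1+m≤N∸j j≤))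

    fold-far : ∀ {j} → 1 ℕ.+ m ℕ.< j → fold-index j ≡ N ℕ.∸ j
    fold-far <j = ℕ.m≥n⇒m⊓n≡n (ℕ.≤-trans (N∸j≤1+m <j) (ℕ.<⇒≤ <j))

    fold-mirror : ∀ {j} → j ℕ.≤ N → fold-index (N ℕ.∸ j) ≡ fold-index j
    fold-mirror {j} j≤N = trans (cong ((N ℕ.∸ j) ℕ.⊓_) (ℕ.m∸[m∸n]≡n j≤N)) (ℕ.⊓-comm (N ℕ.∸ j) j)

  -- Reading `W` through its periodic extension avoids carrying a bound on `fold-index`.
  unfold : Subset (2 ℕ.+ m) → Subset n
  unfold W = tabulate λ v → at (2 ℕ.+ m) W (+ fold-index (toℕ v))

  at-unfold : ∀ W {j} → j ℕ.< n → at n (unfold W) (+ j) ≡ at (2 ℕ.+ m) W (+ fold-index j)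
  at-unfold W {j} j<n = trans (cong (λ i → at n (unfold W) (+ i)) (sym (Fin.toℕ-fromℕ< j<n)))
    (trans (at-toℕ n (unfold W) (fromℕ< j<n)) (trans (Vec.lookup∘tabulate _ (fromℕ< j<n))
      (cong (λ i → at (2 ℕ.+ m) W (+ fold-index i)) (Fin.toℕ-fromℕ< j<n))))

  unfold-mirror : ∀ W → Mirror (+ N) (at n (unfold W))
  unfold-mirror W = periodic-ext n {λ i → x (+ N - i)} {x}
      (λ i → at-periodic-ℤ n (unfold W) -1ℤ (+ N - (i + + n)) (+ N - i) (lemma (+ N) i (+ n))) (at-periodic n (unfold W))
      λ v → reflected (Fin.toℕ<n v)
    where
    x = at n (unfold W)
    lemma : ∀ s i n → s - (i + n) ≡ s - i + -1ℤ * n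
    lemma = solve-∀
    reflected : ∀ {j} → j ℕ.< n → x (+ N - + j) ≡ x (+ j)
    reflected {j} j<n with N ℕ.∸ j ℕ.<? n
    ... | yes N∸j<n = begin
      x (+ N - + j)                                 ≡⟨ cong x (+[N∸j] j≤N) ⟨
      x (+ (N ℕ.∸ j))                               ≡⟨ at-unfold W N∸j<n ⟩
      at (2 ℕ.+ m) W (+ fold-index (N ℕ.∸ j))       ≡⟨ cong (λ i → at (2 ℕ.+ m) W (+ i)) (fold-mirror j≤N) ⟩
      at (2 ℕ.+ m) W (+ fold-index j)               ≡⟨ at-unfold W j<n ⟨
      x (+ j)                                       ∎
      where
      open ≡-Reasoning
      j≤N = ℕ.s≤s⁻¹ (ℕ.≤-trans j<n n≤1+N)
    -- This happens only for j = 0 and N = n, and then N - j = n is position 0 again.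
    ... | no N∸j≮n = trans (cong x (trans (sym (+[N∸j] j≤N)) (trans (cong +_ N∸j≡n+j) (ℤ.+-comm (+ n) (+ j)))))
                           (at-periodic n (unfold W) (+ j))
      where
      j≤N = ℕ.s≤s⁻¹ (ℕ.≤-trans j<n n≤1+N)
      n≤N∸j = ℕ.≮⇒≥ N∸j≮n
      n+j≤N : n ℕ.+ j ℕ.≤ N
      n+j≤N = subst (n ℕ.+ j ℕ.≤_) (ℕ.m∸n+n≡m j≤N) (ℕ.+-monoˡ-≤ j n≤N∸j)
      j≡0 : j ≡ 0
      j≡0 = ℕ.n≤0⇒n≡0 (ℕ.+-cancelˡ-≤ n j 0 (ℕ.≤-trans n+j≤N (subst (N ℕ.≤_) (sym (ℕ.+-identityʳ n)) N≤n)))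
      N∸j≡n+j : N ℕ.∸ j ≡ n ℕ.+ j
      N∸j≡n+j = trans (cong (N ℕ.∸_) j≡0) (trans (ℕ.≤-antisym N≤n (ℕ.≤-trans (ℕ.m≤m+n n j) n+j≤N))
        (sym (trans (cong (n ℕ.+_) j≡0) (ℕ.+-identityʳ n))))

  halve : Subset n → Subset (2 ℕ.+ m)
  halve X = prefix (2 ℕ.+ m) (λ j → at n X (+ j))

  at-halve : ∀ X {j} → j ℕ.< 2 ℕ.+ m → at (2 ℕ.+ m) (halve X) (+ j) ≡ at n X (+ j)
  at-halve X {j} j< = trans (cong (λ i → at (2 ℕ.+ m) (halve X) (+ i)) (sym (Fin.toℕ-fromℕ< j<)))
    (trans (at-toℕ (2 ℕ.+ m) (halve X) (fromℕ< j<)) (trans (Vec.lookup∘tabulate (λ v → at n X (+ toℕ v)) (fromℕ< j<))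
      (cong (λ i → at n X (+ i)) (Fin.toℕ-fromℕ< j<))))

  halve-unfold : ∀ W → halve (unfold W) ≡ W
  halve-unfold W = trans (Vec.tabulate-cong λ v →
      trans (at-unfold W (ℕ.≤-trans (Fin.toℕ<n v) 2+m≤n))
        (cong (λ i → at (2 ℕ.+ m) W (+ i)) (fold-near (ℕ.s≤s⁻¹ (Fin.toℕ<n v)))))
    (prefix-at (2 ℕ.+ m) W)

  unfold-halve : ∀ {X} → Mirror (+ N) (at n X) → unfold (halve X) ≡ X
  unfold-halve {X} mir = at-injective n (periodic-ext n {at n (unfold (halve X))} {at n X}
      (at-periodic n (unfold (halve X))) (at-periodic n X) λ v → agree (Fin.toℕ<n v))
    where
    agree : ∀ {j} → j ℕ.< n → at n (unfold (halve X)) (+ j) ≡ at n X (+ j)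
    agree {j} j<n = trans (at-unfold (halve X) j<n) folded
      where
      folded : at (2 ℕ.+ m) (halve X) (+ fold-index j) ≡ at n X (+ j)
      folded with j ℕ.≤? 1 ℕ.+ m
      ... | yes j≤ = trans (cong (λ i → at (2 ℕ.+ m) (halve X) (+ i)) (fold-near j≤)) (at-halve X (ℕ.s≤s j≤))
      ... | no  j≰ = trans (cong (λ i → at (2 ℕ.+ m) (halve X) (+ i)) (fold-far (ℕ.≰⇒> j≰)))
        (trans (at-halve X (ℕ.s≤s (N∸j≤1+m (ℕ.≰⇒> j≰))))
          (trans (cong (at n X) (+[N∸j] (ℕ.s≤s⁻¹ (ℕ.≤-trans j<n n≤1+N)))) (mir (+ j))))

  ∑-mirror : ∑ (𝐗 n) (λ X → 𝟙 (mirror? n (+ N) X)) ≡ validWords (axisStart s) (axisEnd t) m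
  ∑-mirror = begin
    ∑ (𝐗 n) (λ X → 𝟙 (mirror? n (+ N) X))
      ≡⟨ ∑-cong (𝐗 n) (λ {X} _ → sym (ℤ.*-identityʳ (𝟙 (mirror? n (+ N) X)))) ⟩
    ∑ (𝐗 n) (λ X → 𝟙 (mirror? n (+ N) X) * 1ℤ)
      ≡⟨ ∑-filter (mirror? n (+ N)) (𝐗 n) (λ _ → 1ℤ) ⟨
    ∑ (filter (mirror? n (+ N)) (𝐗 n)) (λ _ → 1ℤ)
      ≡⟨ ∑-bij halve unfold (λ _ → 1ℤ) (Unique.filter⁺ (mirror? n (+ N)) (𝐗-unique n))
           (Unique.filter⁺ valid? (subsets-unique (2 ℕ.+ m)))
           (λ {X} X∈ → let X∈𝐗 , mir = ∈-filter⁻ (mirror? n (+ N)) {xs = 𝐗 n} X∈ in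
             ∈-filter⁺ valid? (∈-subsets (halve X)) (admissible⇒valid {at n X} (at-periodic n X) mir (∈-𝐗⁻ X∈𝐗)) ,
             unfold-halve mir)
           (λ {W} W∈ → let mir = unfold-mirror W in
             ∈-filter⁺ (mirror? n (+ N)) (∈-𝐗⁺ (valid⇒admissible {at n (unfold W)} (at-periodic n (unfold W)) mir
               (trans (cong (valid (axisStart s) (axisEnd t)) (halve-unfold W))
                 (proj₂ (∈-filter⁻ valid? {xs = subsets (2 ℕ.+ m)} W∈))))) mir ,
             halve-unfold W) ⟩
    ∑ (filter valid? (subsets (2 ℕ.+ m))) (λ _ → 1ℤ)
      ≡⟨ ∑-filter valid? (subsets (2 ℕ.+ m)) (λ _ → 1ℤ) ⟩
    ∑ (subsets (2 ℕ.+ m)) (λ W → 𝟙 (valid? W) * 1ℤ)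
      ≡⟨ ∑-cong (subsets (2 ℕ.+ m)) (λ {W} _ → trans (ℤ.*-identityʳ (𝟙 (valid? W))) (𝟙-≟true (valid (axisStart s) (axisEnd t) W))) ⟩
    ∑ (subsets (2 ℕ.+ m)) (λ W → ⟦ valid (axisStart s) (axisEnd t) W ⟧)
      ≡⟨ ∑-valid (axisStart s) (axisEnd t) m ⟩
    validWords (axisStart s) (axisEnd t) m ∎
    where
    open ≡-Reasoning
    valid? : (W : Vec Bool (2 ℕ.+ m)) → Dec (valid (axisStart s) (axisEnd t) W ≡ true)
    valid? W = valid (axisStart s) (axisEnd t) W Bool.≟ true

-- Counting mirrors

∑-upTo-suc : ∀ k f → ∑ (upTo (suc k)) f ≡ ∑ (upTo k) f + f k
∑-upTo-suc k f = trans (cong (λ ks → ∑ ks f) (sym (List.upTo-∷ʳ k)))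
  (trans (∑-++ (upTo k) (k ∷ []) f) (cong (_+_ (∑ (upTo k) f)) (ℤ.+-identityʳ (f k))))

∑-upTo-+ : ∀ n k f → (∀ k → f (n ℕ.+ k) ≡ f k) → ∑ (upTo (n ℕ.+ k)) f ≡ ∑ (upTo n) f + ∑ (upTo k) f
∑-upTo-+ n zero    f f-periodic = trans (cong (λ m → ∑ (upTo m) f) (ℕ.+-identityʳ n)) (sym (ℤ.+-identityʳ _))
∑-upTo-+ n (suc k) f f-periodic = begin
  ∑ (upTo (n ℕ.+ suc k)) f                 ≡⟨ cong (λ m → ∑ (upTo m) f) (ℕ.+-suc n k) ⟩
  ∑ (upTo (suc (n ℕ.+ k))) f               ≡⟨ ∑-upTo-suc (n ℕ.+ k) f ⟩
  ∑ (upTo (n ℕ.+ k)) f + f (n ℕ.+ k)       ≡⟨ cong₂ _+_ (∑-upTo-+ n k f f-periodic) (f-periodic k) ⟩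
  ∑ (upTo n) f + ∑ (upTo k) f + f k        ≡⟨ ℤ.+-assoc (∑ (upTo n) f) (∑ (upTo k) f) (f k) ⟩
  ∑ (upTo n) f + (∑ (upTo k) f + f k)      ≡⟨ cong (_+_ (∑ (upTo n) f)) (∑-upTo-suc k f) ⟨
  ∑ (upTo n) f + ∑ (upTo (suc k)) f        ∎
  where open ≡-Reasoning

consecutive-const : ∀ (f : Seq) → (∀ k → f (2 ℕ.+ k) ≡ f k) → ∀ j k → f (suc j) + f j ≡ f (suc k) + f k
consecutive-const f f-2 j k = trans (to-0 j) (sym (to-0 k))
  where
  to-0 : ∀ j → f (suc j) + f j ≡ f 1 + f 0
  to-0 zero    = refl
  to-0 (suc j) = trans (cong (λ z → z + f (suc j)) (f-2 j)) (trans (ℤ.+-comm (f j) (f (suc j))) (to-0 j))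

∑-upTo-double : ∀ (f : Seq) c → (∀ k → f (suc k) + f k ≡ c) → ∀ k → ∑ (upTo (k ℕ.+ k)) f ≡ + k * c
∑-upTo-double f c f-c zero    = sym (ℤ.*-zeroˡ c)
∑-upTo-double f c f-c (suc k) = begin
  ∑ (upTo (suc (k ℕ.+ suc k))) f                           ≡⟨ cong (λ m → ∑ (upTo (suc m)) f) (ℕ.+-suc k k) ⟩
  ∑ (upTo (2 ℕ.+ (k ℕ.+ k))) f                             ≡⟨ ∑-upTo-suc (1 ℕ.+ (k ℕ.+ k)) f ⟩
  ∑ (upTo (1 ℕ.+ (k ℕ.+ k))) f + f (1 ℕ.+ (k ℕ.+ k))       ≡⟨ cong (λ z → z + f (1 ℕ.+ (k ℕ.+ k))) (∑-upTo-suc (k ℕ.+ k) f) ⟩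
  ∑ (upTo (k ℕ.+ k)) f + f (k ℕ.+ k) + f (1 ℕ.+ (k ℕ.+ k)) ≡⟨ lemma (∑ (upTo (k ℕ.+ k)) f) (f (k ℕ.+ k)) (f (1 ℕ.+ (k ℕ.+ k))) ⟩
  (f (1 ℕ.+ (k ℕ.+ k)) + f (k ℕ.+ k)) + ∑ (upTo (k ℕ.+ k)) f ≡⟨ cong₂ _+_ (f-c (k ℕ.+ k)) (∑-upTo-double f c f-c k) ⟩
  c + + k * c                                              ≡⟨ ℤ.suc-* (+ k) c ⟨
  + suc k * c                                              ∎
  where
  open ≡-Reasoning
  lemma : ∀ a b c → a + b + c ≡ c + b + a
  lemma = solve-∀

mirrored : ∀ n .{{_ : NonZero n}} → Seq
mirrored n k = ∑ (𝐗 n) (λ X → 𝟙 (mirror? n (+ k) X))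

module _ {n : ℕ} .{{_ : NonZero n}} where

  rotate-rotated : ∀ (X : Subset n) k → Rotated k (at n X) (at n (rotate X k))
  rotate-rotated X k i = trans (at-rotate X k (k + i)) (cong (at n X) (lemma k i))
    where
    lemma : ∀ k i → - k + (k + i) ≡ i
    lemma = solve-∀

  rotate-inverse : ∀ (X : Subset n) k → rotate (rotate X k) (- k) ≡ X
  rotate-inverse X k = at-injective n λ i → trans (at-rotate (rotate X k) (- k) i)
    (trans (cong (at n (rotate X k)) (lemma k i)) (rotate-rotated X k i))
    where
    lemma : ∀ k i → - - k + i ≡ k + i
    lemma = solve-∀

  rotate-∈𝐗 : ∀ {X : Subset n} k → X ∈ 𝐗 n → rotate X k ∈ 𝐗 n
  rotate-∈𝐗 {X} k X∈ = ∈-𝐗⁺ (admissible-resp {at n X} {at n (rotate X k)} (k , inj₁ (rotate-rotated X k)) (∈-𝐗⁻ X∈))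

  mirror-rotate⁺ : ∀ X k → Mirror (+ k) (at n X) → Mirror (+ (2 ℕ.+ k)) (at n (rotate X 1ℤ))
  mirror-rotate⁺ X k m i = begin
    at n (rotate X 1ℤ) (+ (2 ℕ.+ k) - i) ≡⟨ at-rotate X 1ℤ (+ (2 ℕ.+ k) - i) ⟩
    at n X (-1ℤ + (+ 2 + + k - i))       ≡⟨ cong (at n X) (lemma (+ k) i) ⟩
    at n X (+ k - (-1ℤ + i))             ≡⟨ m (-1ℤ + i) ⟩
    at n X (-1ℤ + i)                     ≡⟨ at-rotate X 1ℤ i ⟨
    at n (rotate X 1ℤ) i                 ∎
    where
    open ≡-Reasoning
    lemma : ∀ k i → -1ℤ + (+ 2 + k - i) ≡ k - (-1ℤ + i)
    lemma = solve-∀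

  mirror-rotate⁻ : ∀ X k → Mirror (+ (2 ℕ.+ k)) (at n (rotate X 1ℤ)) → Mirror (+ k) (at n X)
  mirror-rotate⁻ X k m i = begin
    at n X (+ k - i)                                ≡⟨ rotate-rotated X 1ℤ (+ k - i) ⟨
    at n (rotate X 1ℤ) (1ℤ + (+ k - i))             ≡⟨ cong (at n (rotate X 1ℤ)) (lemma (+ k) i) ⟩
    at n (rotate X 1ℤ) (+ (2 ℕ.+ k) - (1ℤ + i))     ≡⟨ m (1ℤ + i) ⟩
    at n (rotate X 1ℤ) (1ℤ + i)                     ≡⟨ rotate-rotated X 1ℤ i ⟩
    at n X i                                        ∎
    where
    open ≡-Reasoning
    lemma : ∀ k i → 1ℤ + (k - i) ≡ + 2 + k - (1ℤ + i)
    lemma = solve-∀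

  -- Rotation by one step permutes 𝐗 n and conjugates the mirror k to the mirror k + 2.
  mirrored-2+ : ∀ k → mirrored n (2 ℕ.+ k) ≡ mirrored n k
  mirrored-2+ k = trans
    (sym (∑-bij (λ X → rotate X 1ℤ) (λ X → rotate X -1ℤ) (λ X → 𝟙 (mirror? n (+ (2 ℕ.+ k)) X)) (𝐗-unique n) (𝐗-unique n)
      (λ {X} X∈ → rotate-∈𝐗 1ℤ X∈ , rotate-inverse X 1ℤ) (λ {X} X∈ → rotate-∈𝐗 -1ℤ X∈ , rotate-inverse X -1ℤ)))
    (∑-cong (𝐗 n) λ {X} _ → 𝟙-cong (mirror? n (+ (2 ℕ.+ k)) (rotate X 1ℤ)) (mirror? n (+ k) X)
      (mirror-rotate⁻ X k) (mirror-rotate⁺ X k))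

  mirrored-n+ : ∀ k → mirrored n (n ℕ.+ k) ≡ mirrored n k
  mirrored-n+ k = ∑-cong (𝐗 n) λ {X} _ → 𝟙-cong (mirror? n (+ (n ℕ.+ k)) X) (mirror? n (+ k) X)
    (mirror-≡ {n} {at n X} (at-periodic n X) -1ℤ {+ k} {+ (n ℕ.+ k)} (lemma₁ (+ n) (+ k)))
    (mirror-≡ {n} {at n X} (at-periodic n X) 1ℤ {+ (n ℕ.+ k)} {+ k} (lemma₂ (+ n) (+ k)))
    where
    lemma₁ : ∀ n k → k ≡ n + k + -1ℤ * n
    lemma₁ = solve-∀
    lemma₂ : ∀ n k → n + k ≡ k + 1ℤ * n
    lemma₂ = solve-∀

-- The axis counts as Padovan numbers

double : ∀ n → (∃ λ m → n ≡ m ℕ.+ m) ⊎ (∃ λ m → n ≡ 1 ℕ.+ (m ℕ.+ m))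
double zero    = inj₁ (0 , refl)
double (suc n) with double n
... | inj₁ (m , refl) = inj₂ (m , refl)
... | inj₂ (m , refl) = inj₁ (suc m , cong suc (sym (ℕ.+-suc m m)))

2∣m+m : ∀ m → 2 ∣ m ℕ.+ m
2∣m+m m = divides m (trans (cong (m ℕ.+_) (sym (ℕ.+-identityʳ m))) (ℕ.*-comm 2 m))

r-odd : ∀ m → r (3 ℕ.+ (m ℕ.+ m)) ≡ q (2 ℕ.+ m)
r-odd m = trans (if-no (2 ∣? 3 ℕ.+ (m ℕ.+ m)) 2∤)
  (cong (λ k → q (2 ℕ.+ k)) (sym (ℕ.n≡⌊n+n/2⌋ m)))
  where
  2∤ : ¬ 2 ∣ 3 ℕ.+ (m ℕ.+ m)
  2∤ 2∣ = contradiction (ℕ.∣1⇒≡1 (ℕ.∣m+n∣m⇒∣n (subst (2 ∣_) (ℕ.+-comm 1 (2 ℕ.+ (m ℕ.+ m))) 2∣)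
            (ℕ.∣m∣n⇒∣m+n ℕ.∣-refl (2∣m+m m)))) λ ()

r-even : ∀ m → r (4 ℕ.+ (m ℕ.+ m)) ≡ q (4 ℕ.+ m)
r-even m = trans (if-yes (2 ∣? 4 ℕ.+ (m ℕ.+ m)) (ℕ.∣m∣n⇒∣m+n (divides 2 refl) (2∣m+m m)))
  (cong q (trans (cong (λ k → 2 ℕ.+ k ℕ.+ 2) (sym (ℕ.n≡⌊n+n/2⌋ m))) (ℕ.+-comm (2 ℕ.+ m) 2)))

padovanLike-q : ∀ k → PadovanLike (λ m → + 2 * q (2 ℕ.+ k ℕ.+ m))
padovanLike-q k = padovanLike-* (+ 2) {λ m → q (2 ℕ.+ k ℕ.+ m)} λ m → shifted (k ℕ.+ m) k m refl
  where
  shifted : ∀ j k m → j ≡ k ℕ.+ m → q (2 ℕ.+ k ℕ.+ (3 ℕ.+ m)) ≡ q (2 ℕ.+ k ℕ.+ (1 ℕ.+ m)) + q (2 ℕ.+ k ℕ.+ m)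
  shifted j k m refl = trans (cong (λ i → q (2 ℕ.+ i)) (trans (ℕ.+-suc k (2 ℕ.+ m)) (cong suc (trans (ℕ.+-suc k (1 ℕ.+ m)) (cong suc (ℕ.+-suc k m))))))
    (cong (λ i → q (2 ℕ.+ i) + q (2 ℕ.+ (k ℕ.+ m))) (sym (ℕ.+-suc k m)))

axes : Bool → Bool → Seq
axes s t = validWords (axisStart s) (axisEnd t)

padovanLike-axes : ∀ s t → PadovanLike (axes s t)
padovanLike-axes true  t = validWords-padovanLike (axisStart true) (axisEnd t) refl
padovanLike-axes false t = validWords-padovanLike (axisStart false) (axisEnd t) refl

axes-odd : ∀ m → axes false true m + axes true false m ≡ + 2 * q (2 ℕ.+ m)
axes-odd = padovanLike-unique (λ m → axes false true m + axes true false m) (λ m → + 2 * q (2 ℕ.+ m))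
  (padovanLike-+ {axes false true} {axes true false} (padovanLike-axes false true) (padovanLike-axes true false))
  (padovanLike-q 0) refl refl refl

-- For n = 4 + 2m the half-word between two axes through vertices includes both of these vertices
-- and has 3 + m letters, against 2 + m between two axes that avoid the vertices; hence the shifted
-- argument of the first term.
axes-even : ∀ m → axes false false (1 ℕ.+ m) + axes true true m ≡ + 2 * q (4 ℕ.+ m)
axes-even = padovanLike-unique (λ m → axes false false (1 ℕ.+ m) + axes true true m) (λ m → + 2 * q (4 ℕ.+ m))
  (padovanLike-+ {axes false false ∘ suc} {axes true true} (padovanLike-axes false false ∘ suc) (padovanLike-axes true true))
  (padovanLike-q 2) refl refl refl

-- With n = `suc k`, the mirrors n and n - 1 are the two for which one axis lies at 0 or at -1/2, as
-- `∑-mirror` requires, and they represent both parities.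
mirrored-pair : ∀ k → mirrored (suc k) (suc k) + mirrored (suc k) k ≡ + 2 * r (suc k)
mirrored-pair 0 = refl
-- For n = 2 the mirror 1 falls below the range N ≥ 2 of `∑-mirror`. It exchanges the two vertices,
-- so a set with this mirror contains both or neither.
mirrored-pair 1 = trans (cong₂ _+_ (∑-mirror 0 2 2 false false refl refl) (∑-0 (𝐗 2) none)) refl
  where
  none : ∀ {X} → X ∈ 𝐗 2 → 𝟙 (mirror? 2 1ℤ X) ≡ 0ℤ
  none {X} X∈ = 𝟙-no (mirror? 2 1ℤ X) λ m →
    let ¬both , some = admissible⁻ (∈-𝐗⁻ X∈ 0ℤ) in
    ¬both ([ (λ a → a , trans (m 0ℤ) a) , [ (λ b → trans (sym (m 0ℤ)) b , b) , (λ c → c , trans (m 0ℤ) c) ]′ ]′ some)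
mirrored-pair (suc (suc k)) with double k
... | inj₁ (m , refl) = trans
  (cong₂ _+_ (∑-mirror m (3 ℕ.+ (m ℕ.+ m)) (3 ℕ.+ (m ℕ.+ m)) false true refl refl)
             (∑-mirror m (3 ℕ.+ (m ℕ.+ m)) (2 ℕ.+ (m ℕ.+ m)) true false refl refl))
  (trans (axes-odd m) (cong (+ 2 *_) (sym (r-odd m))))
... | inj₂ (m , refl) = trans
  (cong₂ _+_ (∑-mirror (suc m) (4 ℕ.+ (m ℕ.+ m)) (4 ℕ.+ (m ℕ.+ m)) false false (cong (3 ℕ.+_) (sym (ℕ.+-suc m m))) refl)
             (∑-mirror m (4 ℕ.+ (m ℕ.+ m)) (3 ℕ.+ (m ℕ.+ m)) true true refl refl))
  (trans (axes-even m) (cong (+ 2 *_) (sym (r-even m))))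

-- Consecutive mirrors together fix 2r(n) sets, but for odd n the n mirrors do not split into
-- consecutive pairs. Going round twice gives n pairs.
∑-mirrored : ∀ n .{{_ : NonZero n}} → ∑ (upTo n) (mirrored n) ≡ + n * r n
∑-mirrored n@(suc k) = ℤ.*-cancelˡ-≡ (+ 2) _ _ (begin
  + 2 * ∑ (upTo n) (mirrored n)                        ≡⟨ lemma (∑ (upTo n) (mirrored n)) ⟩
  ∑ (upTo n) (mirrored n) + ∑ (upTo n) (mirrored n)    ≡⟨ ∑-upTo-+ n n (mirrored n) mirrored-n+ ⟨
  ∑ (upTo (n ℕ.+ n)) (mirrored n)                      ≡⟨ ∑-upTo-double (mirrored n) (+ 2 * r n)
    (λ j → trans (consecutive-const (mirrored n) mirrored-2+ j k) (mirrored-pair k)) n ⟩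
  + n * (+ 2 * r n)                                    ≡⟨ lemma′ (+ n) (r n) ⟩
  + 2 * (+ n * r n)                                    ∎)
  where
  open ≡-Reasoning
  lemma : ∀ a → + 2 * a ≡ a + a
  lemma = solve-∀
  lemma′ : ∀ a b → a * (+ 2 * b) ≡ + 2 * (a * b)
  lemma′ = solve-∀

-- Assembling the identities

private
  a s : Seq
  a = primitiveCount false
  s = primitiveCount true

p≡∑ : ∀ n .{{_ : NonZero n}} → p n ≡ ∑ (divisors n) (λ d → a d + s d)
p≡∑ n = trans (sym (length-𝐗′ n)) (trans (∑-by-type (λ _ _ → 1ℤ) n)
  (∑-cong (divisors n) λ {d} _ → cong₂ _+_ (ℤ.*-identityˡ (a d)) (ℤ.*-identityˡ (s d))))
  where
  length-𝐗′ : ∀ n .{{_ : NonZero n}} → ∑ (𝐗 n) (λ _ → 1ℤ) ≡ p n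
  length-𝐗′ 1             = refl
  length-𝐗′ (suc (suc m)) = length-𝐗 m

p∗μ : ∀ n .{{_ : NonZero n}} → (p ∗ μ) n ≡ a n + s n
p∗μ = möbius-inversion p≡∑

n*r≡∑ : ∀ n .{{_ : NonZero n}} → + n * r n ≡ ∑ (divisors n) (λ d → + (n ÷ d) * s d)
n*r≡∑ n = begin
  + n * r n                                                      ≡⟨ ∑-mirrored n ⟨
  ∑ (upTo n) (λ k → ∑ (𝐗 n) (λ X → 𝟙 (mirror? n (+ k) X)))       ≡⟨ ∑-swap (upTo n) (𝐗 n) (λ k X → 𝟙 (mirror? n (+ k) X)) ⟩
  ∑ (𝐗 n) (λ X → ∑ (upTo n) (λ k → 𝟙 (mirror? n (+ k) X)))       ≡⟨ ∑-cong (𝐗 n) (λ {X} _ → ∑-mirrors X) ⟩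
  ∑ (𝐗 n) (λ X → if symmetry X then + (n ÷ period X) else 0ℤ)    ≡⟨ ∑-by-type (λ d b → if b then + (n ÷ d) else 0ℤ) n ⟩
  ∑ (divisors n) (λ d → 0ℤ * a d + + (n ÷ d) * s d)              ≡⟨ ∑-cong (divisors n) (λ {d} _ → lemma (a d) (+ (n ÷ d) * s d)) ⟩
  ∑ (divisors n) (λ d → + (n ÷ d) * s d)                         ∎
  where
  open ≡-Reasoning
  lemma : ∀ a b → 0ℤ * a + b ≡ b
  lemma = solve-∀

-- A function of orbits is spread over their elements as a weight w depending only on
-- the period and the existence of a mirror.
∑-orbits-by-type : ∀ (w : ℕ → Bool → ℤ) (v : ℕ → ℤ) n .{{_ : NonZero n}} →
  (∀ {d} → d ∣ n → ∀ b → + orbitLength d b * w d b ≡ v (orbitLength d b)) →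
  ∑ (orbits n) (λ O → v (length O)) ≡ ∑ (divisors n) (λ d → w d false * a d + w d true * s d)
∑-orbits-by-type w v n w-v = begin
  ∑ (orbits n) (λ O → v (length O))                           ≡⟨ ∑-cong (orbits n) spread ⟩
  ∑ (orbits n) (λ O → ∑ O (λ X → w (period X) (symmetry X)))  ≡⟨ ∑-orbits n (λ X → w (period X) (symmetry X)) ⟩
  ∑ (𝐗 n) (λ X → w (period X) (symmetry X))                   ≡⟨ ∑-by-type w n ⟩
  ∑ (divisors n) (λ d → w d false * a d + w d true * s d)     ∎
  where
  open ≡-Reasoning
  spread : ∀ {O} → O ∈ orbits n → v (length O) ≡ ∑ O (λ X → w (period X) (symmetry X))
  spread O∈ with ∈-map⁻ orbit (∈-deduplicate⁻ (List.≡-dec (_≟ˢ_ {n})) (map orbit (𝐗 n)) O∈)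
  ... | X , _ , refl = begin
    v (length (orbit X))
      ≡⟨ cong v (length-orbit X) ⟩
    v (orbitLength (period X) (symmetry X))
      ≡⟨ w-v (period-∣ X) (symmetry X) ⟨
    + orbitLength (period X) (symmetry X) * w (period X) (symmetry X)
      ≡⟨ cong (λ l → + l * w (period X) (symmetry X)) (length-orbit X) ⟨
    + length (orbit X) * w (period X) (symmetry X)
      ≡⟨ ∑-const (orbit X) (w (period X) (symmetry X)) ⟨
    ∑ (orbit X) (λ _ → w (period X) (symmetry X))
      ≡⟨ ∑-cong (orbit X) (λ {Y} Y∈ → let X≅Y = ∼⇒congruent (∈-orbit⁻ Y∈) in
           cong₂ w (period-≡ {X = X} {Y} X≅Y) (symmetry-≡ {X = X} {Y} X≅Y)) ⟩
    ∑ (orbit X) (λ Y → w (period Y) (symmetry Y)) ∎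

-- An orbit of length l is counted when le = 2n; weight e on each of its elements then adds up to 2n
-- without any division.
2n*orb[_] : ∀ e n .{{_ : NonZero n}} → + (2 ℕ.* n) * orb[ e ] n ≡
  ∑ (divisors n) (λ d → 𝟙 (2 ℕ.* d ℕ.* e ℕ.≟ 2 ℕ.* n) * + e * a d + 𝟙 (d ℕ.* e ℕ.≟ 2 ℕ.* n) * + e * s d)
2n*orb[ e ] n = begin
  + (2 ℕ.* n) * + length (filter (λ O → length O ℕ.* e ℕ.≟ 2 ℕ.* n) (orbits n))
    ≡⟨ cong (+ (2 ℕ.* n) *_) (∑-1 (filter (λ O → length O ℕ.* e ℕ.≟ 2 ℕ.* n) (orbits n))) ⟨
  + (2 ℕ.* n) * ∑ (filter (λ O → length O ℕ.* e ℕ.≟ 2 ℕ.* n) (orbits n)) (λ _ → 1ℤ)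
    ≡⟨ cong (+ (2 ℕ.* n) *_) (∑-filter (λ O → length O ℕ.* e ℕ.≟ 2 ℕ.* n) (orbits n) (λ _ → 1ℤ)) ⟩
  + (2 ℕ.* n) * ∑ (orbits n) (λ O → 𝟙 (length O ℕ.* e ℕ.≟ 2 ℕ.* n) * 1ℤ)
    ≡⟨ ∑-*ˡ (orbits n) (+ (2 ℕ.* n)) (λ O → 𝟙 (length O ℕ.* e ℕ.≟ 2 ℕ.* n) * 1ℤ) ⟨
  ∑ (orbits n) (λ O → v (length O))
    ≡⟨ ∑-orbits-by-type (λ d b → 𝟙 (orbitLength d b ℕ.* e ℕ.≟ 2 ℕ.* n) * + e) v n (λ {d} _ b → weight (orbitLength d b) (orbitLength d b ℕ.* e ℕ.≟ 2 ℕ.* n)) ⟩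
  ∑ (divisors n) (λ d → 𝟙 (2 ℕ.* d ℕ.* e ℕ.≟ 2 ℕ.* n) * + e * a d + 𝟙 (d ℕ.* e ℕ.≟ 2 ℕ.* n) * + e * s d) ∎
  where
  open ≡-Reasoning
  v : ℕ → ℤ
  v l = + (2 ℕ.* n) * (𝟙 (l ℕ.* e ℕ.≟ 2 ℕ.* n) * 1ℤ)
  weight : ∀ l (D : Dec (l ℕ.* e ≡ 2 ℕ.* n)) → + l * (𝟙 D * + e) ≡ + (2 ℕ.* n) * (𝟙 D * 1ℤ)
  weight l (yes l*e≡2n) = begin
    + l * (1ℤ * + e)      ≡⟨ cong (+ l *_) (ℤ.*-identityˡ (+ e)) ⟩
    + l * + e             ≡⟨ ℤ.pos-* l e ⟨
    + (l ℕ.* e)           ≡⟨ cong +_ l*e≡2n ⟩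
    + (2 ℕ.* n)           ≡⟨ ℤ.*-identityʳ (+ (2 ℕ.* n)) ⟨
    + (2 ℕ.* n) * 1ℤ      ∎
  weight l (no _) = trans (trans (cong (+ l *_) (ℤ.*-zeroˡ (+ e))) (ℤ.*-zeroʳ (+ l))) (sym (ℤ.*-zeroʳ (+ (2 ℕ.* n))))

∑-𝟙-self : ∀ n .{{_ : NonZero n}} f → ∑ (divisors n) (λ d → 𝟙 (d ℕ.≟ n) * f d) ≡ f n
∑-𝟙-self n f = ∑-single (ℕ._≟ n) f (divisors-unique n) (∈-divisors⁺ ℕ.∣-refl) refl (λ _ → id)

-- Length 2n arises only as 2d with d = n and no mirror, since the length d of a symmetric orbit is
-- at most n.
a≡2n*orb₁ : ∀ n .{{_ : NonZero n}} → a n ≡ + (2 ℕ.* n) * orb[ 1 ] n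
a≡2n*orb₁ n = sym (trans (2n*orb[ 1 ] n) (trans (∑-cong (divisors n) term) (∑-𝟙-self n a)))
  where
  term : ∀ {d} → d ∈ divisors n →
         𝟙 (2 ℕ.* d ℕ.* 1 ℕ.≟ 2 ℕ.* n) * 1ℤ * a d + 𝟙 (d ℕ.* 1 ℕ.≟ 2 ℕ.* n) * 1ℤ * s d ≡ 𝟙 (d ℕ.≟ n) * a d
  term {d} d∈ = trans (cong₂ (λ i j → i * 1ℤ * a d + j * 1ℤ * s d)
      (𝟙-cong (2 ℕ.* d ℕ.* 1 ℕ.≟ 2 ℕ.* n) (d ℕ.≟ n)
        (λ e → ℕ.*-cancelˡ-≡ d n 2 (trans (sym (ℕ.*-identityʳ (2 ℕ.* d))) e)) λ { refl → ℕ.*-identityʳ (2 ℕ.* d) })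
      (𝟙-no (d ℕ.* 1 ℕ.≟ 2 ℕ.* n) λ e → ℕ.<⇒≱ (ℕ.m<m*n n 2 (ℕ.s≤s (ℕ.s≤s ℕ.z≤n)))
        (subst (ℕ._≤ n) (trans (sym (ℕ.*-identityʳ d)) (trans e (ℕ.*-comm 2 n))) (ℕ.∣⇒≤ (∈-divisors⁻ d∈)))))
    (lemma (𝟙 (d ℕ.≟ n)) (a d) (s d))
    where
    lemma : ∀ i a s → i * 1ℤ * a + 0ℤ * 1ℤ * s ≡ i * a
    lemma = solve-∀

n*[orb₁∗e₂] : ∀ n .{{_ : NonZero n}} → + n * (orb[ 1 ] ∗ e₂) n ≡ ∑ (divisors n) (λ d → 𝟙 (d ℕ.* 2 ℕ.≟ n) * a d)
n*[orb₁∗e₂] n = begin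
  + n * (orb[ 1 ] ∗ e₂) n                                       ≡⟨ cong (+ n *_) (∗≡∑ orb[ 1 ] e₂ n) ⟩
  + n * ∑ (divisors n) (λ d → orb[ 1 ] d * e₂ (n ÷ d))          ≡⟨ ∑-*ˡ (divisors n) (+ n) (λ d → orb[ 1 ] d * e₂ (n ÷ d)) ⟨
  ∑ (divisors n) (λ d → + n * (orb[ 1 ] d * 𝟙 (n ÷ d ℕ.≟ 2)))   ≡⟨ ∑-cong (divisors n) term ⟩
  ∑ (divisors n) (λ d → 𝟙 (d ℕ.* 2 ℕ.≟ n) * a d)                ∎
  where
  open ≡-Reasoning
  term : ∀ {d} → d ∈ divisors n → + n * (orb[ 1 ] d * 𝟙 (n ÷ d ℕ.≟ 2)) ≡ 𝟙 (d ℕ.* 2 ℕ.≟ n) * a d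
  term {d} d∈ = trans (cong (λ i → + n * (orb[ 1 ] d * i)) (𝟙-cong (n ÷ d ℕ.≟ 2) (d ℕ.* 2 ℕ.≟ n)
      (λ e → trans (ℕ.*-comm d 2) (trans (cong (ℕ._* d) (sym e)) (n÷d*d≡n (∈-divisors⁻ d∈))))
      (λ e → trans (cong (_÷ d) (trans (sym e) (ℕ.*-comm d 2))) (m*n÷n≡m 2 d)))) (value (d ℕ.* 2 ℕ.≟ n))
    where
    instance _ = ∣-nonZero (∈-divisors⁻ d∈)
    value : (D : Dec (d ℕ.* 2 ≡ n)) → + n * (orb[ 1 ] d * 𝟙 D) ≡ 𝟙 D * a d
    value (no _)  = trans (cong (+ n *_) (ℤ.*-zeroʳ (orb[ 1 ] d))) (trans (ℤ.*-zeroʳ (+ n)) (sym (ℤ.*-zeroˡ (a d))))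
    -- Here n = 2d, so the factor in front of `orb[ 1 ] d` is exactly the one in `a≡2n*orb₁ d`.
    value (yes e) = trans (cong₂ _*_ (cong +_ (trans (sym e) (ℕ.*-comm d 2))) (ℤ.*-identityʳ (orb[ 1 ] d)))
      (trans (sym (a≡2n*orb₁ d)) (sym (ℤ.*-identityˡ (a d))))

-- Length n arises in two ways: from least period n with a mirror, and from least period n/2 without
-- one.
n*orb₂ : ∀ n .{{_ : NonZero n}} → + n * orb[ 2 ] n ≡ s n + + n * (orb[ 1 ] ∗ e₂) n
n*orb₂ n = ℤ.*-cancelˡ-≡ (+ 2) _ _ (begin
  + 2 * (+ n * orb[ 2 ] n)
    ≡⟨ ℤ.*-assoc (+ 2) (+ n) (orb[ 2 ] n) ⟨
  + 2 * + n * orb[ 2 ] n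
    ≡⟨ cong (_* orb[ 2 ] n) (ℤ.pos-* 2 n) ⟨
  + (2 ℕ.* n) * orb[ 2 ] n
    ≡⟨ 2n*orb[ 2 ] n ⟩
  ∑ (divisors n) (λ d → 𝟙 (2 ℕ.* d ℕ.* 2 ℕ.≟ 2 ℕ.* n) * + 2 * a d + 𝟙 (d ℕ.* 2 ℕ.≟ 2 ℕ.* n) * + 2 * s d)
    ≡⟨ ∑-cong (divisors n) (λ {d} _ → term d) ⟩
  ∑ (divisors n) (λ d → + 2 * (𝟙 (d ℕ.≟ n) * s d + 𝟙 (d ℕ.* 2 ℕ.≟ n) * a d))
    ≡⟨ ∑-*ˡ (divisors n) (+ 2) (λ d → 𝟙 (d ℕ.≟ n) * s d + 𝟙 (d ℕ.* 2 ℕ.≟ n) * a d) ⟩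
  + 2 * ∑ (divisors n) (λ d → 𝟙 (d ℕ.≟ n) * s d + 𝟙 (d ℕ.* 2 ℕ.≟ n) * a d)
    ≡⟨ cong (+ 2 *_) (∑-+ (divisors n) (λ d → 𝟙 (d ℕ.≟ n) * s d) (λ d → 𝟙 (d ℕ.* 2 ℕ.≟ n) * a d)) ⟩
  + 2 * (∑ (divisors n) (λ d → 𝟙 (d ℕ.≟ n) * s d) + ∑ (divisors n) (λ d → 𝟙 (d ℕ.* 2 ℕ.≟ n) * a d))
    ≡⟨ cong (+ 2 *_) (cong₂ _+_ (∑-𝟙-self n s) (sym (n*[orb₁∗e₂] n))) ⟩
  + 2 * (s n + + n * (orb[ 1 ] ∗ e₂) n) ∎)
  where
  open ≡-Reasoning
  term : ∀ d → 𝟙 (2 ℕ.* d ℕ.* 2 ℕ.≟ 2 ℕ.* n) * + 2 * a d + 𝟙 (d ℕ.* 2 ℕ.≟ 2 ℕ.* n) * + 2 * s d ≡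
               + 2 * (𝟙 (d ℕ.≟ n) * s d + 𝟙 (d ℕ.* 2 ℕ.≟ n) * a d)
  term d = trans (cong₂ (λ i j → i * + 2 * a d + j * + 2 * s d)
      (𝟙-cong (2 ℕ.* d ℕ.* 2 ℕ.≟ 2 ℕ.* n) (d ℕ.* 2 ℕ.≟ n)
        (λ e → ℕ.*-cancelˡ-≡ (d ℕ.* 2) n 2 (trans (sym (ℕ.*-assoc 2 d 2)) e)) (λ { refl → ℕ.*-assoc 2 d 2 }))
      (𝟙-cong (d ℕ.* 2 ℕ.≟ 2 ℕ.* n) (d ℕ.≟ n)
        (λ e → ℕ.*-cancelˡ-≡ d n 2 (trans (ℕ.*-comm 2 d) e)) (λ { refl → ℕ.*-comm d 2 })))
    (lemma (𝟙 (d ℕ.* 2 ℕ.≟ n)) (𝟙 (d ℕ.≟ n)) (a d) (s d))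
    where
    lemma : ∀ i j a s → i * + 2 * a + j * + 2 * s ≡ + 2 * (j * s + i * a)
    lemma = solve-∀

-- The S of the overview, as a difference of integers; that n divides s(n) then follows in
-- `s≡n*symmetricOrbits`.
symmetricOrbits : Seq
symmetricOrbits n = orb[ 2 ] n - (orb[ 1 ] ∗ e₂) n

s≡n*symmetricOrbits : ∀ n .{{_ : NonZero n}} → s n ≡ + n * symmetricOrbits n
s≡n*symmetricOrbits n = begin
  s n                                                                     ≡⟨ lemma (s n) (+ n * (orb[ 1 ] ∗ e₂) n) ⟩
  s n + + n * (orb[ 1 ] ∗ e₂) n - + n * (orb[ 1 ] ∗ e₂) n                 ≡⟨ cong (_- + n * (orb[ 1 ] ∗ e₂) n) (n*orb₂ n) ⟨
  + n * orb[ 2 ] n - + n * (orb[ 1 ] ∗ e₂) n                              ≡⟨ lemma′ (+ n) (orb[ 2 ] n) ((orb[ 1 ] ∗ e₂) n) ⟩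
  + n * symmetricOrbits n                                                 ∎
  where
  open ≡-Reasoning
  lemma : ∀ s c → s ≡ s + c - c
  lemma = solve-∀
  lemma′ : ∀ n b c → n * b - n * c ≡ n * (b - c)
  lemma′ = solve-∀

+n÷d*d : ∀ {d n} .{{_ : NonZero n}} → d ∣ n → + (n ÷ d) * + d ≡ + n
+n÷d*d {d} {n} d∣n = trans (sym (ℤ.pos-* (n ÷ d) d)) (cong +_ (n÷d*d≡n d∣n))

r≡∑ : ∀ n .{{_ : NonZero n}} → r n ≡ ∑ (divisors n) symmetricOrbits
r≡∑ n@(suc _) = ℤ.*-cancelˡ-≡ (+ n) _ _ (begin
  + n * r n                                          ≡⟨ n*r≡∑ n ⟩
  ∑ (divisors n) (λ d → + (n ÷ d) * s d)             ≡⟨ ∑-cong (divisors n) term ⟩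
  ∑ (divisors n) (λ d → + n * symmetricOrbits d)     ≡⟨ ∑-*ˡ (divisors n) (+ n) symmetricOrbits ⟩
  + n * ∑ (divisors n) symmetricOrbits               ∎)
  where
  open ≡-Reasoning
  term : ∀ {d} → d ∈ divisors n → + (n ÷ d) * s d ≡ + n * symmetricOrbits d
  term {d} d∈ = begin
    + (n ÷ d) * s d                          ≡⟨ cong (+ (n ÷ d) *_) (s≡n*symmetricOrbits d) ⟩
    + (n ÷ d) * (+ d * symmetricOrbits d)    ≡⟨ ℤ.*-assoc (+ (n ÷ d)) (+ d) (symmetricOrbits d) ⟨
    + (n ÷ d) * + d * symmetricOrbits d      ≡⟨ cong (_* symmetricOrbits d) (+n÷d*d (∈-divisors⁻ {n = n} d∈)) ⟩
    + n * symmetricOrbits d                  ∎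
    where instance _ = ∣-nonZero (∈-divisors⁻ {n = n} d∈)

r∗μ : ∀ n .{{_ : NonZero n}} → (r ∗ μ) n ≡ symmetricOrbits n
r∗μ = möbius-inversion r≡∑

-- Each orbit receives the total 2n, spread as 2n/d over the d elements of a symmetric orbit and as
-- n/d over the 2d elements of the others, so that all weights are integers.
orb≡∑ : ∀ n .{{_ : NonZero n}} → orb n ≡ ∑ (divisors n) (λ d → orb[ 1 ] d + symmetricOrbits d)
orb≡∑ n@(suc _) = ℤ.*-cancelˡ-≡ (+ (2 ℕ.* n)) _ _ (begin
  + (2 ℕ.* n) * orb n
    ≡⟨ ℤ.*-comm (+ (2 ℕ.* n)) (orb n) ⟩
  orb n * + (2 ℕ.* n)
    ≡⟨ ∑-const (orbits n) (+ (2 ℕ.* n)) ⟨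
  ∑ (orbits n) (λ _ → + (2 ℕ.* n))
    ≡⟨ ∑-orbits-by-type (λ d b → + (if b then 2 ℕ.* (n ÷ d) else n ÷ d)) (λ _ → + (2 ℕ.* n)) n weight ⟩
  ∑ (divisors n) (λ d → + (n ÷ d) * a d + + (2 ℕ.* (n ÷ d)) * s d)
    ≡⟨ ∑-cong (divisors n) term ⟩
  ∑ (divisors n) (λ d → + (2 ℕ.* n) * (orb[ 1 ] d + symmetricOrbits d))
    ≡⟨ ∑-*ˡ (divisors n) (+ (2 ℕ.* n)) (λ d → orb[ 1 ] d + symmetricOrbits d) ⟩
  + (2 ℕ.* n) * ∑ (divisors n) (λ d → orb[ 1 ] d + symmetricOrbits d) ∎)
  where
  open ≡-Reasoning
  weight : ∀ {d} → d ∣ n → ∀ b → + orbitLength d b * + (if b then 2 ℕ.* (n ÷ d) else n ÷ d) ≡ + (2 ℕ.* n)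
  weight {d} d∣n true = begin
    + d * + (2 ℕ.* (n ÷ d))       ≡⟨ cong (+ d *_) (ℤ.pos-* 2 (n ÷ d)) ⟩
    + d * (+ 2 * + (n ÷ d))       ≡⟨ lemma (+ d) (+ (n ÷ d)) ⟩
    + 2 * (+ (n ÷ d) * + d)       ≡⟨ cong (+ 2 *_) (+n÷d*d d∣n) ⟩
    + 2 * + n                     ≡⟨ ℤ.pos-* 2 n ⟨
    + (2 ℕ.* n)                   ∎
    where
    lemma : ∀ d c → d * (+ 2 * c) ≡ + 2 * (c * d)
    lemma = solve-∀
  weight {d} d∣n false = begin
    + (2 ℕ.* d) * + (n ÷ d)       ≡⟨ cong (_* + (n ÷ d)) (ℤ.pos-* 2 d) ⟩
    + 2 * + d * + (n ÷ d)         ≡⟨ lemma (+ d) (+ (n ÷ d)) ⟩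
    + 2 * (+ (n ÷ d) * + d)       ≡⟨ cong (+ 2 *_) (+n÷d*d d∣n) ⟩
    + 2 * + n                     ≡⟨ ℤ.pos-* 2 n ⟨
    + (2 ℕ.* n)                   ∎
    where
    lemma : ∀ d c → + 2 * d * c ≡ + 2 * (c * d)
    lemma = solve-∀
  term : ∀ {d} → d ∈ divisors n →
         + (n ÷ d) * a d + + (2 ℕ.* (n ÷ d)) * s d ≡ + (2 ℕ.* n) * (orb[ 1 ] d + symmetricOrbits d)
  term {d} d∈ = begin
    + (n ÷ d) * a d + + (2 ℕ.* (n ÷ d)) * s d
      ≡⟨ cong₂ (λ i j → + (n ÷ d) * i + + (2 ℕ.* (n ÷ d)) * j) (a≡2n*orb₁ d) (s≡n*symmetricOrbits d) ⟩
    + (n ÷ d) * (+ (2 ℕ.* d) * orb[ 1 ] d) + + (2 ℕ.* (n ÷ d)) * (+ d * symmetricOrbits d)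
      ≡⟨ cong₂ (λ i j → + (n ÷ d) * (i * orb[ 1 ] d) + j * (+ d * symmetricOrbits d)) (ℤ.pos-* 2 d) (ℤ.pos-* 2 (n ÷ d)) ⟩
    + (n ÷ d) * (+ 2 * + d * orb[ 1 ] d) + + 2 * + (n ÷ d) * (+ d * symmetricOrbits d)
      ≡⟨ lemma (+ (n ÷ d)) (+ d) (orb[ 1 ] d) (symmetricOrbits d) ⟩
    + 2 * (+ (n ÷ d) * + d) * (orb[ 1 ] d + symmetricOrbits d)
      ≡⟨ cong (λ i → + 2 * i * (orb[ 1 ] d + symmetricOrbits d)) (+n÷d*d (∈-divisors⁻ {n = n} d∈)) ⟩
    + 2 * + n * (orb[ 1 ] d + symmetricOrbits d)
      ≡⟨ cong (_* (orb[ 1 ] d + symmetricOrbits d)) (ℤ.pos-* 2 n) ⟨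
    + (2 ℕ.* n) * (orb[ 1 ] d + symmetricOrbits d) ∎
    where
    instance _ = ∣-nonZero (∈-divisors⁻ {n = n} d∈)
    lemma : ∀ c d o t → c * (+ 2 * d * o) + + 2 * c * (d * t) ≡ + 2 * (c * d) * (o + t)
    lemma = solve-∀

-- Passing to unnormalised fractions avoids the common factors removed by `ℚ._/_` and leaves a
-- polynomial identity.
/-minus : ∀ i j n .{{_ : NonZero n}} → i ℚ./ 1 ≡ (+ n * (i + j)) ℚ./ n ℚ.- j ℚ./ 1
/-minus i j n@(suc k) = ℚ.toℚᵘ-injective (begin
  ℚ.toℚᵘ (i ℚ./ 1)                                            ≈⟨ ℚ.toℚᵘ-fromℚᵘ (mkℚᵘ i 0) ⟩
  mkℚᵘ i 0                                                    ≈⟨ ℚᵘ.*≡* (lemma i j (+ n)) ⟩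
  mkℚᵘ (+ n * (i + j)) k ℚᵘ.+ ℚᵘ.- mkℚᵘ j 0                   ≈⟨ ℚᵘ.+-cong (ℚ.toℚᵘ-fromℚᵘ (mkℚᵘ (+ n * (i + j)) k)) (ℚᵘ.-‿cong (ℚ.toℚᵘ-fromℚᵘ (mkℚᵘ j 0))) ⟨
  ℚ.toℚᵘ x ℚᵘ.+ ℚᵘ.- ℚ.toℚᵘ y                                 ≈⟨ ℚᵘ.+-cong (ℚᵘ.≃-refl {ℚ.toℚᵘ x}) (ℚ.toℚᵘ-homo‿- y) ⟨
  ℚ.toℚᵘ x ℚᵘ.+ ℚ.toℚᵘ (ℚ.- y)                                ≈⟨ ℚ.toℚᵘ-homo-+ x (ℚ.- y) ⟨
  ℚ.toℚᵘ (x ℚ.- y)                                            ∎)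
  where
  open import Relation.Binary.Reasoning.Setoid ℚᵘ.≃-setoid
  x = (+ n * (i + j)) ℚ./ n
  y = j ℚ./ 1
  lemma : ∀ i j n → i * (n * 1ℤ) ≡ (n * (i + j) * 1ℤ + - j * n) * 1ℤ
  lemma = solve-∀

theorem3p1 : (n : ℕ) .{{_ : NonZero n}} →
    (orb n ≡ r n ℤ.+ (orb[ 1 ] ∗ 𝟏) n)
    × ((+ 2 ℤ.* orb[ 1 ] n) ℚ./ 1 ≡ A113788 n ℚ.- ((r ∗ μ) n ℚ./ 1))
    × (orb[ 2 ] n ≡ (r ∗ μ) n ℤ.+ (orb[ 1 ] ∗ e₂) n)
theorem3p1 n = all-orbits , asymmetric-orbits , symmetric-orbits
  where
  open ≡-Reasoning

  all-orbits : orb n ≡ r n + (orb[ 1 ] ∗ 𝟏) n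
  all-orbits = begin
    orb n                                                              ≡⟨ orb≡∑ n ⟩
    ∑ (divisors n) (λ d → orb[ 1 ] d + symmetricOrbits d)              ≡⟨ ∑-+ (divisors n) orb[ 1 ] symmetricOrbits ⟩
    ∑ (divisors n) orb[ 1 ] + ∑ (divisors n) symmetricOrbits           ≡⟨ ℤ.+-comm (∑ (divisors n) orb[ 1 ]) _ ⟩
    ∑ (divisors n) symmetricOrbits + ∑ (divisors n) orb[ 1 ]           ≡⟨ cong₂ _+_ (r≡∑ n)
      (trans (∗≡∑ orb[ 1 ] 𝟏 n) (∑-cong (divisors n) λ {d} _ → ℤ.*-identityʳ (orb[ 1 ] d))) ⟨
    r n + (orb[ 1 ] ∗ 𝟏) n                                             ∎

  asymmetric-orbits : (+ 2 * orb[ 1 ] n) ℚ./ 1 ≡ A113788 n ℚ.- ((r ∗ μ) n ℚ./ 1)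
  -- It remains to write `(p ∗ μ) n` as n times an integer, namely a(n) + s(n) = n (2 orb₁(n) +
  -- S(n)) with S(n) = `(r ∗ μ) n`.
  asymmetric-orbits = trans (/-minus (+ 2 * orb[ 1 ] n) ((r ∗ μ) n) n)
    (cong (λ i → i ℚ./ n ℚ.- ((r ∗ μ) n ℚ./ 1)) (sym (begin
      (p ∗ μ) n                                                ≡⟨ p∗μ n ⟩
      a n + s n                                                ≡⟨ cong₂ _+_ (a≡2n*orb₁ n) (s≡n*symmetricOrbits n) ⟩
      + (2 ℕ.* n) * orb[ 1 ] n + + n * symmetricOrbits n       ≡⟨ cong₂ (λ i j → i * orb[ 1 ] n + + n * j) (ℤ.pos-* 2 n) (sym (r∗μ n)) ⟩
      + 2 * + n * orb[ 1 ] n + + n * (r ∗ μ) n                 ≡⟨ lemma (+ n) (orb[ 1 ] n) ((r ∗ μ) n) ⟩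
      + n * (+ 2 * orb[ 1 ] n + (r ∗ μ) n)                     ∎)))
    where
    lemma : ∀ n o t → + 2 * n * o + n * t ≡ n * (+ 2 * o + t)
    lemma = solve-∀

  symmetric-orbits : orb[ 2 ] n ≡ (r ∗ μ) n + (orb[ 1 ] ∗ e₂) n
  symmetric-orbits = trans (lemma (orb[ 2 ] n) ((orb[ 1 ] ∗ e₂) n)) (cong (λ z → z + (orb[ 1 ] ∗ e₂) n) (sym (r∗μ n)))
    where
    lemma : ∀ b c → b ≡ b - c + c
    lemma = solve-∀
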